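{- For all integers $a,b\ge2$, the $1$-subdivision $\operatorname{sub}(K_{a,b})$ of $K_{a,b}$ satisfies the operator-norm Sidorenko certificate. In particular, for every $t\ge2$ and every graph $G$ with adjacency matrix $A(G)$, $$\hom(\operatorname{sub}(K_{t,t}),G)\ge\|A(G)\|_{\frac{4t}{3t-2}\to\frac{4t}{t+2}}^{2t^2}.$$
   Context: Graphs are finite and simple. $\hom(H,G)$ is the number of homomorphisms from $H$ to $G$. The $1$-subdivision $\operatorname{sub}(H)$ is obtained from $H$ by subdividing every edge exactly once. For a real $n\times n$ matrix $A$ and $1\le p,r\le\infty$, $\|A\|_{p\to r}:=\sup_{x\ne0}\|Ax\|_r/\|x\|_p$. Operator-norm Sidorenko certificate: a bipartite graph $F$ with $v$ vertices and $e$ edges, $v\le e$, satisfies it if for every graph $G$ with adjacency matrix $A$, $\hom(F,G)\ge\|A\|_{s_F'\to s_F}^{e}$, where $s_F=\frac{2e}{v}$ and $s_F'=\frac{2e}{2e-v}$. -}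

module Defs where

open import Data.Bool.Base using (Bool; if_then_else_)
open import Data.Empty using (⊥)
open import Data.Fin.Base as Fin using (Fin; splitAt; finToFun)
import Data.Fin.Properties as Fin
open import Data.Integer.Base as ℤ using (+_)
import Data.Integer.Properties as ℤ
open import Data.List.Base using (List; allFin; cartesianProduct; filter; length; lookup)
open import Data.Nat.Base as ℕ using (ℕ; zero; suc)
import Data.Nat.Properties as ℕ
open import Data.Product.Base using (Σ; ∃-syntax; _×_; _,_; proj₁; proj₂)
open import Data.Rational.Base as ℚ using (ℚ; 0ℚ; 1ℚ; ½; ↥_; ↧ₙ_)
import Data.Rational.Properties as ℚ
open import Data.Rational.Solver using (module +-*-Solver)
import Data.Rational.Unnormalised.Base as ℚᵘ
import Data.Rational.Unnormalised.Properties as ℚᵘ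
open import Data.Sum.Base using (_⊎_; inj₁; inj₂; [_,_]′)
open import Data.Unit.Base using (⊤; tt)
open import Data.Vec.Functional using (Vector; foldr)
open import Level using (0ℓ)
open import Relation.Binary.Core using (Rel)
open import Relation.Binary.Definitions using (Decidable; Irreflexive; Symmetric)
open import Relation.Binary.PropositionalEquality
  using (_≡_; _≢_; refl; sym; trans; cong; cong₂; subst; subst₂)
open import Relation.Nullary using (¬_; Dec; yes; no; does; contradiction)
open import Relation.Nullary.Decidable using (_×-dec_; _⊎-dec_; _→-dec_)

------------------------------------------------------------------------
-- Rational preliminaries

infixr 8 _^_

_^_ : ℚ → ℕ → ℚ
q ^ zero  = 1ℚ
q ^ suc k = q ℚ.* q ^ k

0<1 : 0ℚ ℚ.< 1ℚ
0<1 = ℚ.positive⁻¹ 1ℚ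

0≤1 : 0ℚ ℚ.≤ 1ℚ
0≤1 = ℚ.<⇒≤ 0<1

half+half : ∀ q → ½ ℚ.* q ℚ.+ ½ ℚ.* q ≡ q
half+half q = trans (sym (ℚ.*-distribʳ-+ q ½ ½)) (ℚ.*-identityˡ q)

*-pos : ∀ {p q} → 0ℚ ℚ.< p → 0ℚ ℚ.< q → 0ℚ ℚ.< p ℚ.* q
*-pos {p} {q} 0<p 0<q =
  ℚ.positive⁻¹ (p ℚ.* q) {{ℚ.pos*pos⇒pos p {{ℚ.positive 0<p}} q {{ℚ.positive 0<q}}}}

*-mono-≤ : ∀ {p q r s} → 0ℚ ℚ.≤ r → 0ℚ ℚ.≤ q → p ℚ.≤ q → r ℚ.≤ s → p ℚ.* r ℚ.≤ q ℚ.* s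
*-mono-≤ {p} {q} {r} {s} 0≤r 0≤q p≤q r≤s = ℚ.≤-trans
  (ℚ.*-monoʳ-≤-nonNeg r {{ℚ.nonNegative 0≤r}} p≤q)
  (ℚ.*-monoˡ-≤-nonNeg q {{ℚ.nonNegative 0≤q}} r≤s)

*-nonNeg : ∀ {p q} → 0ℚ ℚ.≤ p → 0ℚ ℚ.≤ q → 0ℚ ℚ.≤ p ℚ.* q
*-nonNeg {p} {q} 0≤p 0≤q =
  ℚ.nonNegative⁻¹ (p ℚ.* q)
    {{ℚ.nonNeg*nonNeg⇒nonNeg p {{ℚ.nonNegative 0≤p}} q {{ℚ.nonNegative 0≤q}}}}

+-nonNeg : ∀ {p q} → 0ℚ ℚ.≤ p → 0ℚ ℚ.≤ q → 0ℚ ℚ.≤ p ℚ.+ q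
+-nonNeg 0≤p 0≤q = ℚ.+-mono-≤ 0≤p 0≤q

^-nonNeg : ∀ {q} k → 0ℚ ℚ.≤ q → 0ℚ ℚ.≤ q ^ k
^-nonNeg zero    0≤q = 0≤1
^-nonNeg (suc k) 0≤q = *-nonNeg 0≤q (^-nonNeg k 0≤q)

^-pos : ∀ {q} k → 0ℚ ℚ.< q → 0ℚ ℚ.< q ^ k
^-pos zero    0<q = 0<1
^-pos (suc k) 0<q = *-pos 0<q (^-pos k 0<q)

^-mono-≤ : ∀ {p q} k → 0ℚ ℚ.≤ p → p ℚ.≤ q → p ^ k ℚ.≤ q ^ k
^-mono-≤ zero    0≤p p≤q = ℚ.≤-refl
^-mono-≤ (suc k) 0≤p p≤q =
  *-mono-≤ (^-nonNeg k 0≤p) (ℚ.≤-trans 0≤p p≤q) p≤q (^-mono-≤ k 0≤p p≤q)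

^-mono-< : ∀ {p q} k → 0ℚ ℚ.≤ p → p ℚ.< q → p ^ suc k ℚ.< q ^ suc k
^-mono-< {p} {q} k 0≤p p<q = ℚ.≤-<-trans
  (ℚ.*-monoˡ-≤-nonNeg p {{ℚ.nonNegative 0≤p}} (^-mono-≤ k 0≤p (ℚ.<⇒≤ p<q)))
  (ℚ.*-monoˡ-<-pos (q ^ k) {{ℚ.positive (^-pos k (ℚ.≤-<-trans 0≤p p<q))}} p<q)

^-cancel-≤ : ∀ {p q} k → 0ℚ ℚ.≤ q → p ^ suc k ℚ.≤ q ^ suc k → p ℚ.≤ q
^-cancel-≤ {p} {q} k 0≤q pᵏ≤qᵏ with p ℚ.≤? q
... | yes p≤q = p≤q
... | no  p≰q = contradiction (ℚ.<-≤-trans (^-mono-< k 0≤q (ℚ.≰⇒> p≰q)) pᵏ≤qᵏ)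
                              (ℚ.<-irrefl refl)

^-increasing : ∀ {q} k → 1ℚ ℚ.≤ q → q ℚ.≤ q ^ suc k
^-increasing {q} zero    1≤q = ℚ.≤-reflexive (sym (ℚ.*-identityʳ q))
^-increasing {q} (suc k) 1≤q = subst (ℚ._≤ q ^ suc (suc k)) (ℚ.*-identityʳ q)
  (ℚ.*-monoˡ-≤-nonNeg q {{ℚ.nonNegative (ℚ.≤-trans 0≤1 1≤q)}}
    (ℚ.≤-trans 1≤q (^-increasing k 1≤q)))

^-superadditive : ∀ {p q} k → 0ℚ ℚ.≤ p → 0ℚ ℚ.≤ q → p ^ suc k ℚ.+ q ^ suc k ℚ.≤ (p ℚ.+ q) ^ suc k
^-superadditive {p} {q} k 0≤p 0≤q = subst (p ^ suc k ℚ.+ q ^ suc k ℚ.≤_)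
  (sym (ℚ.*-distribʳ-+ ((p ℚ.+ q) ^ k) p q))
  (ℚ.+-mono-≤
    (ℚ.*-monoˡ-≤-nonNeg p {{ℚ.nonNegative 0≤p}} (^-mono-≤ k 0≤p
      (subst (ℚ._≤ p ℚ.+ q) (ℚ.+-identityʳ p) (ℚ.+-monoʳ-≤ p 0≤q))))
    (ℚ.*-monoˡ-≤-nonNeg q {{ℚ.nonNegative 0≤q}} (^-mono-≤ k 0≤q
      (subst (ℚ._≤ p ℚ.+ q) (ℚ.+-identityˡ q) (ℚ.+-monoˡ-≤ q 0≤p)))))

≤+⇒-≤ : ∀ {p q ε} → p ℚ.≤ q ℚ.+ ε → p ℚ.- q ℚ.≤ ε
≤+⇒-≤ {p} {q} {ε} p≤q+ε = subst (p ℚ.- q ℚ.≤_)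
  (solve 2 (λ q ε → (q :+ ε) :- q := ε) refl q ε)
  (ℚ.+-monoˡ-≤ (ℚ.- q) p≤q+ε)
  where open +-*-Solver

∣-∣≤-intro : ∀ {p q ε} → p ℚ.≤ q ℚ.+ ε → q ℚ.≤ p ℚ.+ ε → ℚ.∣ p ℚ.- q ∣ ℚ.≤ ε
∣-∣≤-intro {p} {q} {ε} p≤q+ε q≤p+ε with ℚ.∣p∣≡p∨∣p∣≡-p (p ℚ.- q)
... | inj₁ eq = subst (ℚ._≤ ε) (sym eq) (≤+⇒-≤ p≤q+ε)
... | inj₂ eq = subst (ℚ._≤ ε)
  (trans (solve 2 (λ p q → q :- p := :- (p :- q)) refl p q) (sym eq)) (≤+⇒-≤ q≤p+ε)
  where open +-*-Solver

p≤∣p∣ : ∀ p → p ℚ.≤ ℚ.∣ p ∣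
p≤∣p∣ p with ℚ.≤-total 0ℚ p
... | inj₁ 0≤p = ℚ.≤-reflexive (sym (ℚ.0≤p⇒∣p∣≡p 0≤p))
... | inj₂ p≤0 = ℚ.≤-trans p≤0 (ℚ.0≤∣p∣ p)

∣-∣≤-elim : ∀ {p q ε} → ℚ.∣ p ℚ.- q ∣ ℚ.≤ ε → p ℚ.≤ q ℚ.+ ε
∣-∣≤-elim {p} {q} {ε} h = subst (ℚ._≤ q ℚ.+ ε)
  (solve 2 (λ p q → q :+ (p :- q) := p) refl p q)
  (ℚ.+-monoʳ-≤ q (ℚ.≤-trans (p≤∣p∣ (p ℚ.- q)) h))
  where open +-*-Solver

∣∣p∣-∣q∣∣≤∣p-q∣ : ∀ p q → ℚ.∣ ℚ.∣ p ∣ ℚ.- ℚ.∣ q ∣ ∣ ℚ.≤ ℚ.∣ p ℚ.- q ∣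
∣∣p∣-∣q∣∣≤∣p-q∣ p q = ∣-∣≤-intro
  (subst (λ z → ℚ.∣ z ∣ ℚ.≤ ℚ.∣ q ∣ ℚ.+ ℚ.∣ p ℚ.- q ∣) (solve 2 (λ p q → q :+ (p :- q) := p) refl p q)
    (ℚ.∣p+q∣≤∣p∣+∣q∣ q (p ℚ.- q)))
  (subst₂ (λ z d → ℚ.∣ z ∣ ℚ.≤ ℚ.∣ p ∣ ℚ.+ d)
    (solve 2 (λ p q → p :+ (:- (p :- q)) := q) refl p q)
    (ℚ.∣-p∣≡∣p∣ (p ℚ.- q))
    (ℚ.∣p+q∣≤∣p∣+∣q∣ p (ℚ.- (p ℚ.- q))))
  where open +-*-Solver

------------------------------------------------------------------------
-- Real numbers: Cauchy sequences of rationals, up to _≃ᵣ_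

Cauchy : (ℕ → ℚ) → Set
Cauchy s = ∀ ε → 0ℚ ℚ.< ε → ∃[ N ] (∀ m n → N ℕ.≤ m → N ℕ.≤ n → ℚ.∣ s m ℚ.- s n ∣ ℚ.≤ ε)

record ℝ : Set where
  constructor mkℝ
  field
    seq    : ℕ → ℚ
    cauchy : Cauchy seq

open ℝ public

infix 4 _≤ᵣ_ _≃ᵣ_

_≤ᵣ_ : ℝ → ℝ → Set
x ≤ᵣ y = ∀ ε → 0ℚ ℚ.< ε → ∃[ N ] (∀ n → N ℕ.≤ n → seq x n ℚ.≤ seq y n ℚ.+ ε)

_≃ᵣ_ : ℝ → ℝ → Set
x ≃ᵣ y = x ≤ᵣ y × y ≤ᵣ x

opaque
  const-cauchy : ∀ q → Cauchy (λ _ → q)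
  const-cauchy q ε 0<ε = 0 , λ _ _ _ _ →
    subst (λ d → ℚ.∣ d ∣ ℚ.≤ ε) (sym (ℚ.+-inverseʳ q)) (ℚ.<⇒≤ 0<ε)

fromℚ : ℚ → ℝ
fromℚ q = mkℝ (λ _ → q) (const-cauchy q)

fromℕ : ℕ → ℝ
fromℕ k = fromℚ (+ k ℚ./ 1)

0ᵣ 1ᵣ : ℝ
0ᵣ = fromℕ 0
1ᵣ = fromℕ 1

infixl 6 _+ᵣ_
infixl 7 _*ᵣ_
infixr 8 _^ᵣ_ _^ℚ_

opaque
  +-cauchy : ∀ x y → Cauchy (λ n → seq x n ℚ.+ seq y n)
  +-cauchy x y ε 0<ε =
    let 0<ε/2      = *-pos {½} (ℚ.positive⁻¹ ½) 0<ε
        (N₁ , hx)  = cauchy x (½ ℚ.* ε) 0<ε/2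
        (N₂ , hy)  = cauchy y (½ ℚ.* ε) 0<ε/2
    in N₁ ℕ.⊔ N₂ , λ m n N≤m N≤n → begin
      ℚ.∣ (seq x m ℚ.+ seq y m) ℚ.- (seq x n ℚ.+ seq y n) ∣
        ≡⟨ cong ℚ.∣_∣ (rearrange (seq x m) (seq y m) (seq x n) (seq y n)) ⟩
      ℚ.∣ (seq x m ℚ.- seq x n) ℚ.+ (seq y m ℚ.- seq y n) ∣
        ≤⟨ ℚ.∣p+q∣≤∣p∣+∣q∣ (seq x m ℚ.- seq x n) (seq y m ℚ.- seq y n) ⟩
      ℚ.∣ seq x m ℚ.- seq x n ∣ ℚ.+ ℚ.∣ seq y m ℚ.- seq y n ∣
        ≤⟨ ℚ.+-mono-≤
             (hx m n (ℕ.m⊔n≤o⇒m≤o N₁ N₂ N≤m) (ℕ.m⊔n≤o⇒m≤o N₁ N₂ N≤n))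
             (hy m n (ℕ.m⊔n≤o⇒n≤o N₁ N₂ N≤m) (ℕ.m⊔n≤o⇒n≤o N₁ N₂ N≤n)) ⟩
      ½ ℚ.* ε ℚ.+ ½ ℚ.* ε
        ≡⟨ half+half ε ⟩
      ε ∎
    where
    open ℚ.≤-Reasoning
    open +-*-Solver
    rearrange : ∀ a b c d → (a ℚ.+ b) ℚ.- (c ℚ.+ d) ≡ (a ℚ.- c) ℚ.+ (b ℚ.- d)
    rearrange = solve 4 (λ a b c d → (a :+ b) :- (c :+ d) := (a :- c) :+ (b :- d)) refl

_+ᵣ_ : ℝ → ℝ → ℝ
x +ᵣ y = mkℝ (λ n → seq x n ℚ.+ seq y n) (+-cauchy x y)

opaque
  ∣∣-cauchy : ∀ x → Cauchy (λ n → ℚ.∣ seq x n ∣)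
  ∣∣-cauchy x ε 0<ε =
    let (N , hx) = cauchy x ε 0<ε
    in N , λ m n N≤m N≤n →
      ℚ.≤-trans (∣∣p∣-∣q∣∣≤∣p-q∣ (seq x m) (seq x n)) (hx m n N≤m N≤n)

∣_∣ᵣ : ℝ → ℝ
∣ x ∣ᵣ = mkℝ (λ n → ℚ.∣ seq x n ∣) (∣∣-cauchy x)

eventuallyBounded : ∀ x → ∃[ K ] 0ℚ ℚ.< K × ∃[ N ] (∀ n → N ℕ.≤ n → ℚ.∣ seq x n ∣ ℚ.≤ K)
eventuallyBounded x =
  let (N , hx) = cauchy x 1ℚ 0<1
      K        = ℚ.∣ seq x N ∣ ℚ.+ 1ℚ
  in K , ℚ.+-mono-≤-< (ℚ.0≤∣p∣ (seq x N)) 0<1 , N , λ n N≤n →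
    ∣-∣≤-elim (ℚ.≤-trans (∣∣p∣-∣q∣∣≤∣p-q∣ (seq x n) (seq x N)) (hx n N N≤n ℕ.≤-refl))

opaque
  *-cauchy : ∀ x y → Cauchy (λ n → seq x n ℚ.* seq y n)
  *-cauchy x y ε 0<ε =
    let (K , 0<K , N₁ , hK) = eventuallyBounded x
        (L , 0<L , N₂ , hL) = eventuallyBounded y
        0<ε/2     = *-pos {½} (ℚ.positive⁻¹ ½) 0<ε
        (N₃ , hx) = cauchy x (share L 0<L (½ ℚ.* ε)) (share-pos L 0<L 0<ε/2)
        (N₄ , hy) = cauchy y (share K 0<K (½ ℚ.* ε)) (share-pos K 0<K 0<ε/2)
        N₁₂       = N₁ ℕ.⊔ N₂
        N₃₄       = N₃ ℕ.⊔ N₄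
    in N₁₂ ℕ.⊔ N₃₄ , λ m n N≤m N≤n →
      let a  = seq x m ; b = seq y m ; c = seq x n ; d = seq y n
          ≤m₁₂ = ℕ.m⊔n≤o⇒m≤o N₁₂ N₃₄ N≤m
          ≤n₁₂ = ℕ.m⊔n≤o⇒m≤o N₁₂ N₃₄ N≤n
          ≤m₃₄ = ℕ.m⊔n≤o⇒n≤o N₁₂ N₃₄ N≤m
          ≤n₃₄ = ℕ.m⊔n≤o⇒n≤o N₁₂ N₃₄ N≤n
      in begin
      ℚ.∣ a ℚ.* b ℚ.- c ℚ.* d ∣
        ≡⟨ cong ℚ.∣_∣ (rearrange a b c d) ⟩
      ℚ.∣ a ℚ.* (b ℚ.- d) ℚ.+ d ℚ.* (a ℚ.- c) ∣
        ≤⟨ ℚ.∣p+q∣≤∣p∣+∣q∣ (a ℚ.* (b ℚ.- d)) (d ℚ.* (a ℚ.- c)) ⟩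
      ℚ.∣ a ℚ.* (b ℚ.- d) ∣ ℚ.+ ℚ.∣ d ℚ.* (a ℚ.- c) ∣
        ≡⟨ cong₂ ℚ._+_ (ℚ.∣p*q∣≡∣p∣*∣q∣ a (b ℚ.- d)) (ℚ.∣p*q∣≡∣p∣*∣q∣ d (a ℚ.- c)) ⟩
      ℚ.∣ a ∣ ℚ.* ℚ.∣ b ℚ.- d ∣ ℚ.+ ℚ.∣ d ∣ ℚ.* ℚ.∣ a ℚ.- c ∣
        ≤⟨ ℚ.+-mono-≤
             (*-mono-≤ (ℚ.0≤∣p∣ (b ℚ.- d)) (ℚ.<⇒≤ 0<K)
               (hK m (ℕ.m⊔n≤o⇒m≤o N₁ N₂ ≤m₁₂))
               (hy m n (ℕ.m⊔n≤o⇒n≤o N₃ N₄ ≤m₃₄) (ℕ.m⊔n≤o⇒n≤o N₃ N₄ ≤n₃₄)))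
             (*-mono-≤ (ℚ.0≤∣p∣ (a ℚ.- c)) (ℚ.<⇒≤ 0<L)
               (hL n (ℕ.m⊔n≤o⇒n≤o N₁ N₂ ≤n₁₂))
               (hx m n (ℕ.m⊔n≤o⇒m≤o N₃ N₄ ≤m₃₄) (ℕ.m⊔n≤o⇒m≤o N₃ N₄ ≤n₃₄))) ⟩
      K ℚ.* share K 0<K (½ ℚ.* ε) ℚ.+ L ℚ.* share L 0<L (½ ℚ.* ε)
        ≡⟨ cong₂ ℚ._+_ (share-* K 0<K (½ ℚ.* ε)) (share-* L 0<L (½ ℚ.* ε)) ⟩
      ½ ℚ.* ε ℚ.+ ½ ℚ.* ε
        ≡⟨ half+half ε ⟩
      ε ∎
    where
    open ℚ.≤-Reasoning
    open +-*-Solver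
    rearrange : ∀ a b c d → a ℚ.* b ℚ.- c ℚ.* d ≡ a ℚ.* (b ℚ.- d) ℚ.+ d ℚ.* (a ℚ.- c)
    rearrange = solve 4 (λ a b c d → a :* b :- c :* d := a :* (b :- d) :+ d :* (a :- c)) refl
    share : ∀ K → 0ℚ ℚ.< K → ℚ → ℚ
    share K 0<K ε = (ℚ.1/ K) {{ℚ.>-nonZero 0<K}} ℚ.* ε
    share-pos : ∀ K (0<K : 0ℚ ℚ.< K) {ε} → 0ℚ ℚ.< ε → 0ℚ ℚ.< share K 0<K ε
    share-pos K 0<K 0<ε =
      *-pos (ℚ.positive⁻¹ ((ℚ.1/ K) {{ℚ.>-nonZero 0<K}}) {{ℚ.1/pos⇒pos K {{ℚ.positive 0<K}}}}) 0<ε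
    share-* : ∀ K (0<K : 0ℚ ℚ.< K) ε → K ℚ.* share K 0<K ε ≡ ε
    share-* K 0<K ε = trans (sym (ℚ.*-assoc K _ ε))
      (trans (cong (ℚ._* ε) (ℚ.*-inverseʳ K {{ℚ.>-nonZero 0<K}})) (ℚ.*-identityˡ ε))

_*ᵣ_ : ℝ → ℝ → ℝ
x *ᵣ y = mkℝ (λ n → seq x n ℚ.* seq y n) (*-cauchy x y)

_^ᵣ_ : ℝ → ℕ → ℝ
x ^ᵣ zero  = 1ᵣ
x ^ᵣ suc k = x *ᵣ x ^ᵣ k

------------------------------------------------------------------------
-- Roots

grid : ℕ → ℕ → ℚ
grid n j = + j ℚ./ suc n

grid-suc : ∀ n j → grid n (suc j) ≡ grid n j ℚ.+ grid n 1
grid-suc n j = ℚ.toℚᵘ-injective (begin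
  ℚ.toℚᵘ (grid n (suc j))                       ≈⟨ unfold (suc j) ⟩
  ℚᵘ.mkℚᵘ (+ suc j) n                           ≈⟨ step ⟩
  ℚᵘ.mkℚᵘ (+ j) n ℚᵘ.+ ℚᵘ.mkℚᵘ (+ 1) n          ≈⟨ ℚᵘ.+-cong (unfold j) (unfold 1) ⟨
  ℚ.toℚᵘ (grid n j) ℚᵘ.+ ℚ.toℚᵘ (grid n 1)      ≈⟨ ℚ.toℚᵘ-homo-+ (grid n j) (grid n 1) ⟨
  ℚ.toℚᵘ (grid n j ℚ.+ grid n 1)                ∎)
  where
  open import Relation.Binary.Reasoning.Setoid ℚᵘ.≃-setoid
  unfold : ∀ i → ℚ.toℚᵘ (grid n i) ℚᵘ.≃ ℚᵘ.mkℚᵘ (+ i) n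
  unfold i = ℚ.toℚᵘ-fromℚᵘ (ℚᵘ.mkℚᵘ (+ i) n)
  step : ℚᵘ.mkℚᵘ (+ suc j) n ℚᵘ.≃ ℚᵘ.mkℚᵘ (+ j) n ℚᵘ.+ ℚᵘ.mkℚᵘ (+ 1) n
  step = ℚᵘ.*≡* (trans (sym (ℤ.*-assoc (+ suc j) (+ suc n) (+ suc n)))
    (cong (ℤ._* + suc n) (trans (cong (ℤ._* + suc n) (ℤ.+-comm (+ 1) (+ j)))
      (ℤ.*-distribʳ-+ (+ suc n) (+ j) (+ 1)))))

≤-grid : ∀ n j q → ↥ q ℤ.* + suc n ℤ.≤ + j ℤ.* + ↧ₙ q → q ℚ.≤ grid n j
≤-grid n j q h = ℚ.toℚᵘ-cancel-≤ (ℚᵘ.≤-trans (ℚᵘ.*≤* (bound q h))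
  (ℚᵘ.≤-reflexive (ℚᵘ.≃-sym (ℚ.toℚᵘ-fromℚᵘ (ℚᵘ.mkℚᵘ (+ j) n)))))
  where
  bound : ∀ q → ↥ q ℤ.* + suc n ℤ.≤ + j ℤ.* + ↧ₙ q →
          ℚᵘ.↥ ℚ.toℚᵘ q ℤ.* + suc n ℤ.≤ + j ℤ.* ℚᵘ.↧ ℚ.toℚᵘ q
  bound (ℚ.mkℚ _ _ _) h = h

grid-≤ : ∀ n j q → + j ℤ.* + ↧ₙ q ℤ.≤ ↥ q ℤ.* + suc n → grid n j ℚ.≤ q
grid-≤ n j q h = ℚ.toℚᵘ-cancel-≤ (ℚᵘ.≤-trans
  (ℚᵘ.≤-reflexive (ℚ.toℚᵘ-fromℚᵘ (ℚᵘ.mkℚᵘ (+ j) n))) (ℚᵘ.*≤* (bound q h)))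
  where
  bound : ∀ q → + j ℤ.* + ↧ₙ q ℤ.≤ ↥ q ℤ.* + suc n →
          + j ℤ.* ℚᵘ.↧ ℚ.toℚᵘ q ℤ.≤ ℚᵘ.↥ ℚ.toℚᵘ q ℤ.* + suc n
  bound (ℚ.mkℚ _ _ _) h = h

grid-nonNeg : ∀ n j → 0ℚ ℚ.≤ grid n j
grid-nonNeg n j = ℚ.nonNegative⁻¹ (grid n j) {{ℚ.normalize-nonNeg j (suc n)}}

grid-zero : ∀ n → grid n 0 ≡ 0ℚ
grid-zero n = ℚ.0/n≡0 (suc n)

grid-archimedean : ∀ ε → 0ℚ ℚ.< ε → ∃[ N ] (∀ n → N ℕ.≤ n → grid n 1 ℚ.≤ ε)
grid-archimedean ε@(ℚ.mkℚ (+ suc a) d _) 0<ε = d , λ n d≤n → grid-≤ n 1 ε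
  (ℤ.+≤+ (ℕ.*-mono-≤ {1} {suc a} (ℕ.s≤s ℕ.z≤n) (ℕ.s≤s d≤n)))
grid-archimedean (ℚ.mkℚ (+ zero) d _)    0<ε with ℚ.positive 0<ε
... | ()
grid-archimedean (ℚ.mkℚ ℤ.-[1+ _ ] d _)  0<ε with ℚ.positive 0<ε
... | ()

if-elim : ∀ {X : Set} (P : ℕ → Set) (X? : Dec X) i j → (X → P i) → (¬ X → P j) →
          P (if does X? then i else j)
if-elim P (yes x) i j f g = f x
if-elim P (no ¬x) i j f g = g ¬x

-- search k n q B is the greatest j ≤ B with (j / (n+1))ᵏ ≤ q, or 0 if there is none.
search : ℕ → ℕ → ℚ → ℕ → ℕ
search k n q zero    = 0
search k n q (suc j) = if does (grid n (suc j) ^ k ℚ.≤? q) then suc j else search k n q j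

-- For k ≥ 1, no j > searchBound n q satisfies (j / (n+1))ᵏ < q.
searchBound : ℕ → ℚ → ℕ
searchBound n q = suc ℤ.∣ ↥ q ∣ ℕ.* suc n

opaque
  -- The k-th root of q rounded down to a multiple of 1 / (n+1) (for q < 0 it is 0).
  rootℚ : ℕ → ℕ → ℚ → ℚ
  rootℚ k n q = grid n (search k n q (searchBound n q))

  rootℚ-lower : ∀ k n q → rootℚ k n q ≡ 0ℚ ⊎ rootℚ k n q ^ k ℚ.≤ q
  rootℚ-lower k n q = go (searchBound n q)
    where
    go : ∀ j → grid n (search k n q j) ≡ 0ℚ ⊎ grid n (search k n q j) ^ k ℚ.≤ q
    go zero = inj₁ (grid-zero n)
    go (suc j) = if-elim (λ i → grid n i ≡ 0ℚ ⊎ grid n i ^ k ℚ.≤ q)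
      (grid n (suc j) ^ k ℚ.≤? q) (suc j) (search k n q j) inj₂ (λ _ → go j)

  rootℚ-upper : ∀ k n q → q ℚ.≤ (rootℚ (suc k) n q ℚ.+ grid n 1) ^ suc k
  rootℚ-upper k n q =
    subst (λ r → q ℚ.≤ r ^ suc k) (grid-suc n (search (suc k) n q B)) (go B start)
    where
    B : ℕ
    B = searchBound n q

    go : ∀ j → q ℚ.≤ grid n (suc j) ^ suc k → q ℚ.≤ grid n (suc (search (suc k) n q j)) ^ suc k
    go zero h = h
    go (suc j) h = if-elim (λ i → q ℚ.≤ grid n (suc i) ^ suc k)
      (grid n (suc j) ^ suc k ℚ.≤? q) (suc j) (search (suc k) n q j)
      (λ _ → h) (λ ¬h → go j (ℚ.<⇒≤ (ℚ.≰⇒> ¬h)))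

    i≤∣i∣ : ∀ i → i ℤ.≤ + ℤ.∣ i ∣
    i≤∣i∣ (+ n)      = ℤ.≤-refl
    i≤∣i∣ ℤ.-[1+ n ] = ℤ.-≤+

    q≤grid : q ℚ.≤ grid n (suc B)
    q≤grid = ≤-grid n (suc B) q (ℤ.≤-trans (ℤ.*-monoʳ-≤-nonNeg (+ suc n) (i≤∣i∣ (↥ q)))
      (subst₂ ℤ._≤_ (ℤ.pos-* ℤ.∣ ↥ q ∣ (suc n)) (ℤ.pos-* (suc B) (↧ₙ q)) (ℤ.+≤+ (ℕ.≤-trans
        (ℕ.≤-trans (ℕ.m≤n+m (ℤ.∣ ↥ q ∣ ℕ.* suc n) (suc n)) (ℕ.n≤1+n B))
        (ℕ.m≤m*n (suc B) (↧ₙ q))))))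

    1≤grid : 1ℚ ℚ.≤ grid n (suc B)
    1≤grid = ≤-grid n (suc B) 1ℚ (subst₂ ℤ._≤_ (sym (ℤ.*-identityˡ (+ suc n)))
      (sym (ℤ.*-identityʳ (+ suc B)))
      (ℤ.+≤+ (ℕ.≤-trans (ℕ.m≤m+n (suc n) (ℤ.∣ ↥ q ∣ ℕ.* suc n)) (ℕ.n≤1+n B))))

    start : q ℚ.≤ grid n (suc B) ^ suc k
    start = ℚ.≤-trans q≤grid (^-increasing k 1≤grid)

  rootℚ-nonNeg : ∀ k n q → 0ℚ ℚ.≤ rootℚ k n q
  rootℚ-nonNeg k n q = grid-nonNeg n (search k n q (searchBound n q))

rootℚ-close : ∀ k m n p q η → 0ℚ ℚ.≤ η → p ℚ.≤ q ℚ.+ η ^ suc k →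
              rootℚ (suc k) m p ℚ.≤ rootℚ (suc k) n q ℚ.+ (grid n 1 ℚ.+ η)
rootℚ-close k m n p q η 0≤η p≤q+ηᵏ = [ zero-case , pos-case ]′ (rootℚ-lower (suc k) m p)
  where
  0≤s+δ : 0ℚ ℚ.≤ rootℚ (suc k) n q ℚ.+ grid n 1
  0≤s+δ = +-nonNeg (rootℚ-nonNeg (suc k) n q) (grid-nonNeg n 1)

  zero-case : rootℚ (suc k) m p ≡ 0ℚ →
              rootℚ (suc k) m p ℚ.≤ rootℚ (suc k) n q ℚ.+ (grid n 1 ℚ.+ η)
  zero-case r≡0 = ℚ.≤-trans (ℚ.≤-reflexive r≡0)
    (+-nonNeg (rootℚ-nonNeg (suc k) n q) (+-nonNeg (grid-nonNeg n 1) 0≤η))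

  pos-case : rootℚ (suc k) m p ^ suc k ℚ.≤ p →
             rootℚ (suc k) m p ℚ.≤ rootℚ (suc k) n q ℚ.+ (grid n 1 ℚ.+ η)
  pos-case rᵏ≤p = ℚ.≤-trans
    (^-cancel-≤ k (+-nonNeg 0≤s+δ 0≤η)
      (ℚ.≤-trans rᵏ≤p (ℚ.≤-trans p≤q+ηᵏ (ℚ.≤-trans
        (ℚ.+-monoˡ-≤ (η ^ suc k) (rootℚ-upper k n q))
        (^-superadditive k 0≤s+δ 0≤η)))))
    (ℚ.≤-reflexive (ℚ.+-assoc (rootℚ (suc k) n q) (grid n 1) η))

opaque
  root-cauchy : ∀ k x → Cauchy (λ n → rootℚ (suc k) n (seq x n))
  root-cauchy k x ε 0<ε =
    let η         = ½ ℚ.* ε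
        0<η       = *-pos {½} (ℚ.positive⁻¹ ½) 0<ε
        (N₁ , hx) = cauchy x (η ^ suc k) (^-pos (suc k) 0<η)
        (N₂ , hδ) = grid-archimedean η 0<η
        close : ∀ m n → N₁ ℕ.⊔ N₂ ℕ.≤ m → N₁ ℕ.⊔ N₂ ℕ.≤ n →
                rootℚ (suc k) m (seq x m) ℚ.≤ rootℚ (suc k) n (seq x n) ℚ.+ ε
        close = λ m n N≤m N≤n → ℚ.≤-trans
          (rootℚ-close k m n (seq x m) (seq x n) η (ℚ.<⇒≤ 0<η)
            (∣-∣≤-elim (hx m n (ℕ.m⊔n≤o⇒m≤o N₁ N₂ N≤m) (ℕ.m⊔n≤o⇒m≤o N₁ N₂ N≤n))))
          (ℚ.+-monoʳ-≤ (rootℚ (suc k) n (seq x n)) (ℚ.≤-trans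
            (ℚ.+-monoˡ-≤ η (hδ n (ℕ.m⊔n≤o⇒n≤o N₁ N₂ N≤n)))
            (ℚ.≤-reflexive (half+half ε))))
    in N₁ ℕ.⊔ N₂ , λ m n N≤m N≤n → ∣-∣≤-intro (close m n N≤m N≤n) (close n m N≤n N≤m)

-- The k-th root of a nonnegative real (and 0 at negative reals).
root : (k : ℕ) .{{_ : ℕ.NonZero k}} → ℝ → ℝ
root (suc k) x = mkℝ (λ n → rootℚ (suc k) n (seq x n)) (root-cauchy k x)

-- x raised to the power p, for x ≥ 0 and p ≥ 0.
_^ℚ_ : ℝ → ℚ → ℝ
x ^ℚ p = root (↧ₙ p) (x ^ᵣ ℤ.∣ ↥ p ∣)

------------------------------------------------------------------------
-- ℓᵖ norms and operator norms, for rational exponents p ≥ 1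

record Exponent : Set where
  constructor mkExponent
  field
    value   : ℚ
    1≤value : 1ℚ ℚ.≤ value

  nonZero : ℚ.NonZero value
  nonZero = ℚ.>-nonZero (ℚ.<-≤-trans 0<1 1≤value)

opaque
  1≤n/d : ∀ n d → d ℕ.< n → 1ℚ ℚ.≤ + n ℚ./ suc d
  1≤n/d n d d<n = ≤-grid d n 1ℚ
    (subst₂ ℤ._≤_ (sym (ℤ.*-identityˡ (+ suc d))) (sym (ℤ.*-identityʳ (+ n))) (ℤ.+≤+ d<n))

-- The exponent n / d.
exponent : ∀ n d → 0 ℕ.< d → d ℕ.≤ n → Exponent
exponent n (suc d) _ d<n = mkExponent (+ n ℚ./ suc d) (1≤n/d n d d<n)

Matrix : ℕ → Set
Matrix n = Fin n → Fin n → ℝ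

Σᵣ : ∀ {n} → Vector ℝ n → ℝ
Σᵣ = foldr _+ᵣ_ 0ᵣ

infixl 7 _·_

_·_ : ∀ {n} → Matrix n → Vector ℝ n → Vector ℝ n
(A · x) i = Σᵣ λ j → A i j *ᵣ x j

‖_‖ : ∀ {n} → Vector ℝ n → Exponent → ℝ
‖ x ‖ p = (Σᵣ λ i → ∣ x i ∣ᵣ ^ℚ value) ^ℚ (ℚ.1/ value) {{nonZero}}
  where open Exponent p

-- ρ is one of the quotients ‖Ax‖ᵣ / ‖x‖ₚ with x ≠ 0.
NormRatio : ∀ {n} → Matrix n → (p r : Exponent) → ℝ → Set
NormRatio {n} A p r ρ =
  Σ (Vector ℝ n) λ x → ¬ (∀ i → x i ≃ᵣ 0ᵣ) × ρ *ᵣ ‖ x ‖ p ≃ᵣ ‖ A · x ‖ r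

-- Suprema are taken in [0, ∞), so that sup ∅ = 0; this is only relevant for 0 × 0 matrices.
record IsSupremum (S : ℝ → Set) (s : ℝ) : Set where
  field
    nonNeg     : 0ᵣ ≤ᵣ s
    upperBound : ∀ ρ → S ρ → ρ ≤ᵣ s
    least      : ∀ t → 0ᵣ ≤ᵣ t → (∀ ρ → S ρ → ρ ≤ᵣ t) → s ≤ᵣ t

-- N = ‖A‖ with respect to ℓᵖ → ℓʳ.
IsOperatorNorm : ∀ {n} → Matrix n → (p r : Exponent) → ℝ → Set
IsOperatorNorm A p r N = IsSupremum (NormRatio A p r) N

------------------------------------------------------------------------
-- Finite simple graphs

record Graph (n : ℕ) : Set₁ where
  field
    _~_    : Rel (Fin n) 0ℓ
    _~?_   : Decidable _~_
    ~-sym  : Symmetric _~_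
    irrefl : Irreflexive _≡_ _~_

adjacencyMatrix : ∀ {n} → Graph n → Matrix n
adjacencyMatrix G i j = if does (i ~? j) then 1ᵣ else 0ᵣ
  where open Graph G

-- Each edge is listed once, with its smaller endpoint first.
edges : ∀ {n} → Graph n → List (Fin n × Fin n)
edges {n} G = filter (λ (i , j) → (i Fin.<? j) ×-dec (i ~? j))
                     (cartesianProduct (allFin n) (allFin n))
  where open Graph G

∣E∣ : ∀ {n} → Graph n → ℕ
∣E∣ G = length (edges G)

Bipartite : ∀ {n} → Graph n → Set
Bipartite {n} G = Σ (Fin n → Bool) λ side → ∀ {i j} → i ~ j → side i ≢ side j
  where open Graph G

IsHom : ∀ {m n} → Graph m → Graph n → (Fin m → Fin n) → Set
IsHom H G f = ∀ i j → i ~ᴴ j → f i ~ᴳ f j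
  where
  open Graph H using () renaming (_~_ to _~ᴴ_)
  open Graph G using () renaming (_~_ to _~ᴳ_)

isHom? : ∀ {m n} (H : Graph m) (G : Graph n) f → Dec (IsHom H G f)
isHom? H G f = Fin.all? λ i → Fin.all? λ j → (i ~ᴴ? j) →-dec (f i ~ᴳ? f j)
  where
  open Graph H using () renaming (_~?_ to _~ᴴ?_)
  open Graph G using () renaming (_~?_ to _~ᴳ?_)

-- finToFun is a bijection from Fin (n ^ m) onto the maps Fin m → Fin n.
hom : ∀ {m n} → Graph m → Graph n → ℕ
hom {m} {n} H G =
  length (filter (λ k → isHom? H G (finToFun {n} {m} k)) (allFin (n ℕ.^ m)))

completeBipartite : ∀ a b → Graph (a ℕ.+ b)
completeBipartite a b = record
  { _~_    = λ u v → Adj (splitAt a u) (splitAt a v)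
  ; _~?_   = λ u v → adj? (splitAt a u) (splitAt a v)
  ; ~-sym  = λ {u} {v} → adj-sym (splitAt a u) (splitAt a v)
  ; irrefl = λ { {u} refl → adj-irrefl (splitAt a u) }
  }
  where
  Adj : Rel (Fin a ⊎ Fin b) 0ℓ
  Adj (inj₁ _) (inj₁ _) = ⊥
  Adj (inj₁ _) (inj₂ _) = ⊤
  Adj (inj₂ _) (inj₁ _) = ⊤
  Adj (inj₂ _) (inj₂ _) = ⊥

  adj? : Decidable Adj
  adj? (inj₁ _) (inj₁ _) = no λ ()
  adj? (inj₁ _) (inj₂ _) = yes tt
  adj? (inj₂ _) (inj₁ _) = yes tt
  adj? (inj₂ _) (inj₂ _) = no λ ()

  adj-sym : ∀ u v → Adj u v → Adj v u
  adj-sym (inj₁ _) (inj₂ _) _ = tt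
  adj-sym (inj₂ _) (inj₁ _) _ = tt

  adj-irrefl : ∀ u → ¬ Adj u u
  adj-irrefl (inj₁ _) ()
  adj-irrefl (inj₂ _) ()

-- The 1-subdivision: the first n vertices are those of G, and vertex n + k is the midpoint
-- of the k-th edge of G.
sub : ∀ {n} (G : Graph n) → Graph (n ℕ.+ ∣E∣ G)
sub {n} G = record
  { _~_    = λ u v → Adj (splitAt n u) (splitAt n v)
  ; _~?_   = λ u v → adj? (splitAt n u) (splitAt n v)
  ; ~-sym  = λ {u} {v} → adj-sym (splitAt n u) (splitAt n v)
  ; irrefl = λ { {u} refl → adj-irrefl (splitAt n u) }
  }
  where
  IsEndpoint : Fin n → Fin (∣E∣ G) → Set
  IsEndpoint v k = v ≡ proj₁ (lookup (edges G) k) ⊎ v ≡ proj₂ (lookup (edges G) k)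

  isEndpoint? : Decidable IsEndpoint
  isEndpoint? v k =
    (v Fin.≟ proj₁ (lookup (edges G) k)) ⊎-dec (v Fin.≟ proj₂ (lookup (edges G) k))

  Adj : Rel (Fin n ⊎ Fin (∣E∣ G)) 0ℓ
  Adj (inj₁ _) (inj₁ _) = ⊥
  Adj (inj₁ v) (inj₂ k) = IsEndpoint v k
  Adj (inj₂ k) (inj₁ v) = IsEndpoint v k
  Adj (inj₂ _) (inj₂ _) = ⊥

  adj? : Decidable Adj
  adj? (inj₁ _) (inj₁ _) = no λ ()
  adj? (inj₁ v) (inj₂ k) = isEndpoint? v k
  adj? (inj₂ k) (inj₁ v) = isEndpoint? v k
  adj? (inj₂ _) (inj₂ _) = no λ ()

  adj-sym : ∀ u v → Adj u v → Adj v u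
  adj-sym (inj₁ _) (inj₂ _) h = h
  adj-sym (inj₂ _) (inj₁ _) h = h

  adj-irrefl : ∀ u → ¬ Adj u u
  adj-irrefl (inj₁ _) ()
  adj-irrefl (inj₂ _) ()

------------------------------------------------------------------------
-- The operator-norm Sidorenko certificate

-- 2e / v
s-exponent : ∀ v e → 0 ℕ.< v → v ℕ.≤ e → Exponent
s-exponent v e 0<v v≤e = exponent (2 ℕ.* e) v 0<v (ℕ.≤-trans v≤e (ℕ.m≤m+n e (e ℕ.+ 0)))

-- 2e / (2e - v)
s′-exponent : ∀ v e → 0 ℕ.< v → v ℕ.≤ e → Exponent
s′-exponent v e 0<v v≤e = exponent (2 ℕ.* e) (2 ℕ.* e ℕ.∸ v)
  (ℕ.m<n⇒0<n∸m (ℕ.≤-<-trans v≤e (ℕ.m<m+n e (ℕ.<-≤-trans (ℕ.<-≤-trans 0<v v≤e) (ℕ.m≤m+n e 0)))))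
  (ℕ.m∸n≤m (2 ℕ.* e) v)

-- The certificate is only defined for nonempty bipartite graphs with v ≤ e, so these
-- conditions are part of it.
record Certificate {v} (F : Graph v) : Set₁ where
  private
    e : ℕ
    e = ∣E∣ F

  field
    bipartite : Bipartite F
    0<v       : 0 ℕ.< v
    v≤e       : v ℕ.≤ e
    bound     : ∀ {n} (G : Graph n) (N : ℝ) →
                IsOperatorNorm (adjacencyMatrix G)
                  (s′-exponent v e 0<v v≤e) (s-exponent v e 0<v v≤e) N →
                N ^ᵣ e ≤ᵣ fromℕ (hom F G)

-- 4t / (3t - 2)
domainExponent : ∀ t → 2 ℕ.≤ t → Exponent
domainExponent t 2≤t = exponent (4 ℕ.* t) (3 ℕ.* t ℕ.∸ 2)
  (ℕ.m<n⇒0<n∸m (ℕ.≤-<-trans 2≤t (ℕ.m<m+n t (ℕ.<-≤-trans (ℕ.<-≤-trans ℕ.z<s 2≤t) (ℕ.m≤m+n t (t ℕ.+ 0))))))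
  (ℕ.≤-trans (ℕ.m∸n≤m (3 ℕ.* t) 2) (ℕ.m≤n+m (3 ℕ.* t) t))

-- 4t / (t + 2)
codomainExponent : ∀ t → 2 ℕ.≤ t → Exponent
codomainExponent t 2≤t = exponent (4 ℕ.* t) (t ℕ.+ 2)
  (ℕ.<-≤-trans ℕ.z<s (ℕ.m≤n+m 2 t))
  (ℕ.+-monoʳ-≤ t (ℕ.≤-trans 2≤t (ℕ.m≤m+n t (2 ℕ.* t))))

{-# OPTIONS --safe #-}
-- Put α = a-1, β = b-1, q = ab, p = aβ + bα, v = a + b + q and e = 2q, so that 2e - v = p + q,
-- and let B = A² be the codegree matrix. Then M = Σ_{x,y} Π_{i,j} B(x_i, y_j) counts the homomorphisms from
-- sub(K_{a,b}) to G. For nonnegative vectors η, ξ let S = Σ A_ij η_i^(p+q) ξ_j^(p+q).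
-- Cauchy-Schwarz gives S² ≤ U(η,ξ) U(ξ,η) with U(η,ξ) = Σ A_ij η_i^2p ξ_j^2q, and then
-- U(η,ξ)² ≤ ⟨u,Bu⟩ Σ ξ^4q with u = η^2p. By AM-GM and the symmetry of B,
-- ⟨u,Bu⟩ ≤ W = Σ B_ij η_i^4aβ η_j^4bα, and Hölder's inequality, applied once over the
-- vertices and once over a-tuples of vertices, gives W^q ≤ M (Σ η^4q)^p. Altogether
-- S^4q ≤ M² (Σ η^4q · Σ ξ^4q)^(p+q), which for ξ = |x|^(1/(2e-v)) and η = |Ax|^(1/v) becomes
-- ‖Ax‖ ≤ M^(1/e) ‖x‖.
--
-- As all exponents in the inequality for S are natural numbers, it can be proved over ℚ and then
-- applied to each term of the sequences that represent real η, ξ.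
module Submission where

open import Data.Nat.Base using (ℕ; _≤_; _*_; _^_)
open import Data.Product.Base using (_×_)
open import Defs using (ℝ; Graph; Certificate; sub; completeBipartite; hom; adjacencyMatrix; IsOperatorNorm; domainExponent; codomainExponent; fromℕ; _≤ᵣ_; _^ᵣ_)

open import Defs renaming (_^_ to _↑_)
open import Algebra.Bundles using (CommutativeMonoid; CommutativeRing)
open import Data.Bool.Base using (Bool; false; if_then_else_; true)
open import Data.Fin.Base as Fin using (Fin; combine; finToFun; splitAt; suc; zero; _↑ʳ_; _↑ˡ_)
import Data.Fin.Properties as Fin
open import Data.Integer.Base as ℤ using (+_)
import Data.Integer.Properties as ℤ
open import Data.List.Base as List using (List; allFin; cartesianProduct; filter; lookup; tabulate)
open import Data.List.Membership.Propositional.Properties using (∈-filter⁻; ∈-lookup)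
open import Data.Nat.Base as ℕ using (suc; zero)
import Data.Nat.Properties as ℕ
open import Data.Nat.Solver using () renaming (module +-*-Solver to ℕ-Solver)
open import Data.Product.Base using (∃-syntax; proj₁; proj₂; _,_)
open import Data.Rational.Base as ℚ using (0ℚ; 1ℚ; mkℚ; ½; ℚ; ↥_; ↧ₙ_)
import Data.Rational.Properties as ℚ
open import Data.Rational.Solver using (module +-*-Solver)
import Data.Rational.Unnormalised.Base as ℚᵘ
open import Data.Sum.Base using (inj₁; inj₂; [_,_]′; _⊎_)
open import Data.Vec.Functional using (Vector; _++_; _∷_)
open import Data.Vec.Functional.Properties using (lookup-++ʳ; lookup-++ˡ)
open import Function.Base using (_∘_)
open import Function.Bundles using (mk⇔)
open import Level using (0ℓ)
open import Relation.Binary.Bundles using (Poset)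
open import Relation.Binary.PropositionalEquality
open import Relation.Nullary using (Dec; contradiction; does; no; yes; ¬_)
open import Relation.Nullary.Decidable using (dec-false; dec-true; does-⇔; _×-dec_; _⊎-dec_)
open import Relation.Unary using (Decidable; Pred)

open import Algebra.Properties.CommutativeMonoid.Sum ℕ.+-0-commutativeMonoid
  using () renaming (sum to sumℕ; sum-cong-≗ to sumℕ-cong; ∑-comm to sumℕ-comm; ∑-distrib-+ to sumℕ-+)
open import Algebra.Properties.CommutativeMonoid.Sum ℚ.*-1-commutativeMonoid
  using () renaming (sum to product; sum-cong-≗ to product-cong; ∑-comm to product-comm; ∑-distrib-+ to product-*)
open import Algebra.Properties.Semiring.Sum (CommutativeRing.semiring ℚ.+-*-commutativeRing)
  using (sum; sum-cong-≗; ∑-comm; ∑-distrib-+; *-distribʳ-sum; *-distribˡ-sum)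

-- Powers and order on ℚ

-- The exponents s = 2e/v and s' = 2e/(2e-v) are conjugate, so the operator norm is also the
-- supremum of the bilinear form of A over two unit balls of one and the same space, that of s'.
-- With y = η^(p+q) in place of a dual vector, S is this form and Σ η^4q is the s'-th power of the
-- norm of y. This is why the inequality for S is symmetric in η and ξ. The choice η = |Ax|^(1/v)
-- makes y = |Ax|^(s-1), the extremal vector of the duality. Two obstacles shape the details.
-- Vectors cannot be normalised over ℚ, since norms involve roots; Hölder's inequality is therefore
-- stated with natural powers and obtained from Young's inequality with two free scaling factors.
-- Over the Cauchy reals it is undecidable whether Σ η^4q vanishes, although a power of it has to be
-- cancelled at the end; that cancellation is done term by term with a tolerance.

↑-+ : ∀ x m n → x ↑ (m ℕ.+ n) ≡ x ↑ m ℚ.* x ↑ n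
↑-+ x zero    n = sym (ℚ.*-identityˡ (x ↑ n))
↑-+ x (suc m) n = trans (cong (x ℚ.*_) (↑-+ x m n)) (sym (ℚ.*-assoc x (x ↑ m) (x ↑ n)))

↑-distrib-* : ∀ x y k → (x ℚ.* y) ↑ k ≡ x ↑ k ℚ.* y ↑ k
↑-distrib-* x y zero    = refl
↑-distrib-* x y (suc k) = trans (cong (x ℚ.* y ℚ.*_) (↑-distrib-* x y k))
  (solve 4 (λ x y u v → x :* y :* (u :* v) := x :* u :* (y :* v)) refl x y (x ↑ k) (y ↑ k))
  where open +-*-Solver

1↑ : ∀ k → 1ℚ ↑ k ≡ 1ℚ
1↑ zero    = refl
1↑ (suc k) = trans (ℚ.*-identityˡ _) (1↑ k)

↑-* : ∀ x m n → (x ↑ m) ↑ n ≡ x ↑ (m ℕ.* n)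
↑-* x zero    n = 1↑ n
↑-* x (suc m) n = trans (↑-distrib-* x (x ↑ m) n)
  (trans (cong (x ↑ n ℚ.*_) (↑-* x m n)) (sym (↑-+ x n (m ℕ.* n))))

*-monoˡ-≤ : ∀ {r p q} → 0ℚ ℚ.≤ r → p ℚ.≤ q → r ℚ.* p ℚ.≤ r ℚ.* q
*-monoˡ-≤ {r} 0≤r = ℚ.*-monoˡ-≤-nonNeg r {{ℚ.nonNegative 0≤r}}

*-monoʳ-≤ : ∀ {r p q} → 0ℚ ℚ.≤ r → p ℚ.≤ q → p ℚ.* r ℚ.≤ q ℚ.* r
*-monoʳ-≤ {r} 0≤r = ℚ.*-monoʳ-≤-nonNeg r {{ℚ.nonNegative 0≤r}}

*-cancelˡ-≤ : ∀ {r p q} → 0ℚ ℚ.< r → r ℚ.* p ℚ.≤ r ℚ.* q → p ℚ.≤ q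
*-cancelˡ-≤ {r} 0<r = ℚ.*-cancelˡ-≤-pos r {{ℚ.positive 0<r}}

+-cancelˡ-≤ : ∀ r {p q} → r ℚ.+ p ℚ.≤ r ℚ.+ q → p ℚ.≤ q
+-cancelˡ-≤ r {p} {q} h = subst₂ ℚ._≤_ (cancel r p) (cancel r q) (ℚ.+-monoʳ-≤ (ℚ.- r) h)
  where
  open +-*-Solver
  cancel : ∀ r p → ℚ.- r ℚ.+ (r ℚ.+ p) ≡ p
  cancel = solve 2 (λ r p → :- r :+ (r :+ p) := p) refl

square-nonNeg : ∀ q → 0ℚ ℚ.≤ q ℚ.* q
square-nonNeg q with ℚ.≤-total 0ℚ q
... | inj₁ 0≤q = *-nonNeg 0≤q 0≤q
... | inj₂ q≤0 = ℚ.nonNegative⁻¹ (q ℚ.* q)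
  {{ℚ.nonPos*nonPos⇒nonPos q {{ℚ.nonPositive q≤0}} q {{ℚ.nonPositive q≤0}}}}

≤-from-gap : ∀ {p q} d → 0ℚ ℚ.≤ d → p ℚ.+ d ≡ q → p ℚ.≤ q
≤-from-gap {p} d 0≤d refl = subst (ℚ._≤ p ℚ.+ d) (ℚ.+-identityʳ p) (ℚ.+-monoʳ-≤ p 0≤d)

am-gm : ∀ x y → x ℚ.* y ℚ.+ x ℚ.* y ℚ.≤ x ℚ.* x ℚ.+ y ℚ.* y
am-gm x y = ≤-from-gap ((x ℚ.- y) ℚ.* (x ℚ.- y)) (square-nonNeg (x ℚ.- y))
  (solve 2 (λ x y → x :* y :+ x :* y :+ (x :- y) :* (x :- y) := x :* x :+ y :* y) refl x y)
  where open +-*-Solver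

-- Weighted AM-GM, where `grid 0 k` is the number k in ℚ. By induction and without roots: the gap at
-- k + 1 is x times the gap at k plus (1 + k) y^k (x - y)^2.
young : ∀ k {x y} → 0ℚ ℚ.≤ x → 0ℚ ℚ.≤ y →
        (1ℚ ℚ.+ grid 0 k) ℚ.* (x ℚ.* y ↑ k) ℚ.≤ x ↑ suc k ℚ.+ grid 0 k ℚ.* y ↑ suc k
young zero {x} {y} 0≤x 0≤y = ℚ.≤-reflexive
  (solve 2 (λ x y → con 1ℚ :* (x :* con 1ℚ) := x :* con 1ℚ :+ con 0ℚ :* (y :* con 1ℚ)) refl x y)
  where open +-*-Solver
young (suc k) {x} {y} 0≤x 0≤y rewrite grid-suc 0 k = ≤-from-gap
  (x ℚ.* (xᵏ⁺¹+cyᵏ⁺¹ ℚ.- 1+cxyᵏ) ℚ.+ (1ℚ ℚ.+ c) ℚ.* (y ↑ k ℚ.* ((x ℚ.- y) ℚ.* (x ℚ.- y))))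
  (+-nonNeg
    (*-nonNeg 0≤x (subst (ℚ._≤ xᵏ⁺¹+cyᵏ⁺¹ ℚ.- 1+cxyᵏ) (ℚ.+-inverseʳ 1+cxyᵏ)
      (ℚ.+-monoˡ-≤ (ℚ.- 1+cxyᵏ) (young k 0≤x 0≤y))))
    (*-nonNeg (+-nonNeg 0≤1 (grid-nonNeg 0 k))
      (*-nonNeg (^-nonNeg k 0≤y) (square-nonNeg (x ℚ.- y)))))
  (solve 5 (λ x y u v c →
      (con 1ℚ :+ (c :+ con 1ℚ)) :* (x :* (y :* v)) :+
      (x :* (x :* u :+ c :* (y :* v) :- (con 1ℚ :+ c) :* (x :* v)) :+
        (con 1ℚ :+ c) :* (v :* ((x :- y) :* (x :- y))))
      := x :* (x :* u) :+ (c :+ con 1ℚ) :* (y :* (y :* v)))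
    refl x y (x ↑ k) (y ↑ k) c)
  where
  open +-*-Solver
  c 1+cxyᵏ xᵏ⁺¹+cyᵏ⁺¹ : ℚ
  c = grid 0 k
  1+cxyᵏ = (1ℚ ℚ.+ c) ℚ.* (x ℚ.* y ↑ k)
  xᵏ⁺¹+cyᵏ⁺¹ = x ↑ suc k ℚ.+ c ℚ.* y ↑ suc k

-- Positive linear functionals and Hölder's inequality

-- A common form for sums over vertices, sums over tuples of vertices and sums over pairs weighted
-- by a kernel, so that one proof of Hölder's inequality serves all of them.
record PositiveFunctional (X : Set) : Set₁ where
  field
    I           : (X → ℚ) → ℚ
    mono        : ∀ {f g} → (∀ x → f x ℚ.≤ g x) → I f ℚ.≤ I g
    additive    : ∀ f g → I (λ x → f x ℚ.+ g x) ≡ I f ℚ.+ I g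
    homogeneous : ∀ c f → I (λ x → c ℚ.* f x) ≡ c ℚ.* I f

  congruent : ∀ {f g} → f ≗ g → I f ≡ I g
  congruent f≗g = ℚ.≤-antisym (mono (ℚ.≤-reflexive ∘ f≗g)) (mono (ℚ.≤-reflexive ∘ sym ∘ f≗g))

  nonNeg : ∀ {f} → (∀ x → 0ℚ ℚ.≤ f x) → 0ℚ ℚ.≤ I f
  nonNeg {f} 0≤f = subst (ℚ._≤ I f)
    (trans (homogeneous 0ℚ f) (ℚ.*-zeroˡ (I f)))
    (mono λ x → subst (ℚ._≤ f x) (sym (ℚ.*-zeroˡ (f x))) (0≤f x))

module Hölder {X : Set} (Λ : PositiveFunctional X) {φ C : X → ℚ}
  (0≤φ : ∀ x → 0ℚ ℚ.≤ φ x) (0≤C : ∀ x → 0ℚ ℚ.≤ C x) (k : ℕ) where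

  open PositiveFunctional Λ
  open +-*-Solver

  private
    P Q S c : ℚ
    P = I λ x → φ x ↑ k ℚ.* C x
    Q = I λ x → φ x ↑ suc k
    S = I λ x → C x ↑ suc k
    c = grid 0 k

    0≤P : 0ℚ ℚ.≤ P
    0≤P = nonNeg λ x → *-nonNeg (^-nonNeg k (0≤φ x)) (0≤C x)

    0≤Q : 0ℚ ℚ.≤ Q
    0≤Q = nonNeg λ x → ^-nonNeg (suc k) (0≤φ x)

    0≤S : 0ℚ ℚ.≤ S
    0≤S = nonNeg λ x → ^-nonNeg (suc k) (0≤C x)

  -- Young's inequality for s C and t φ, integrated. The free factors s and t take over the role of
  -- normalising C and φ.
  young-integrated : ∀ {s t} → 0ℚ ℚ.≤ s → 0ℚ ℚ.≤ t →
    (1ℚ ℚ.+ c) ℚ.* (s ℚ.* t ↑ k) ℚ.* P ℚ.≤ s ↑ suc k ℚ.* S ℚ.+ c ℚ.* t ↑ suc k ℚ.* Q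
  young-integrated {s} {t} 0≤s 0≤t = subst₂ ℚ._≤_
    (homogeneous ((1ℚ ℚ.+ c) ℚ.* (s ℚ.* t ↑ k)) λ x → φ x ↑ k ℚ.* C x)
    (trans (additive (λ x → s ↑ suc k ℚ.* C x ↑ suc k) (λ x → c ℚ.* t ↑ suc k ℚ.* φ x ↑ suc k))
      (cong₂ ℚ._+_ (homogeneous (s ↑ suc k) λ x → C x ↑ suc k)
                   (homogeneous (c ℚ.* t ↑ suc k) λ x → φ x ↑ suc k)))
    (mono λ x → subst₂ ℚ._≤_
      (trans (cong (λ z → (1ℚ ℚ.+ c) ℚ.* (s ℚ.* C x ℚ.* z)) (↑-distrib-* t (φ x) k))
        (solve 5 (λ c s C tk φk → (con 1ℚ :+ c) :* (s :* C :* (tk :* φk))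
            := (con 1ℚ :+ c) :* (s :* tk) :* (φk :* C))
          refl c s (C x) (t ↑ k) (φ x ↑ k)))
      (cong₂ ℚ._+_ (↑-distrib-* s (C x) (suc k))
        (trans (cong (c ℚ.*_) (↑-distrib-* t (φ x) (suc k))) (sym (ℚ.*-assoc c (t ↑ suc k) (φ x ↑ suc k)))))
      (young k (*-nonNeg 0≤s (0≤C x)) (*-nonNeg 0≤t (0≤φ x))))

  private
    -- The choice s = Q, t = P is dictated by the equality case: if C = λ φ then P = λ Q, and so Q C
    -- = P φ.
    Q·P≤Q·SQ : Q ℚ.* P ↑ suc k ℚ.≤ Q ℚ.* (S ℚ.* Q ↑ k)
    Q·P≤Q·SQ = +-cancelˡ-≤ (c ℚ.* P ↑ suc k ℚ.* Q) (subst₂ ℚ._≤_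
      (solve 4 (λ c q p pk → (con 1ℚ :+ c) :* (q :* pk) :* p
          := c :* (p :* pk) :* q :+ q :* (p :* pk)) refl c Q P (P ↑ k))
      (solve 5 (λ c q qk s pp → q :* qk :* s :+ c :* pp :* q
          := c :* pp :* q :+ q :* (s :* qk)) refl c Q (Q ↑ k) S (P ↑ suc k))
      (young-integrated 0≤Q 0≤P))

    -- For Q = 0 the choice s = P, t = S + P contradicts P > 0.
    P≡0 : ∀ j → k ≡ suc j → Q ≡ 0ℚ → P ≡ 0ℚ
    P≡0 j k≡1+j Q≡0 with P ℚ.≤? 0ℚ
    ... | yes P≤0 = ℚ.≤-antisym P≤0 0≤P
    ... | no  P≰0 = contradiction (ℚ.<-≤-trans 0<cw cw≤0) (ℚ.<-irrefl refl)
      where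
      0<P : 0ℚ ℚ.< P
      0<P = ℚ.≰⇒> P≰0
      T w : ℚ
      T = S ℚ.+ P
      w = P ℚ.* (P ℚ.* T ↑ k)
      P≤T : P ℚ.≤ T
      P≤T = ≤-from-gap S 0≤S (ℚ.+-comm P S)
      S≤T : S ℚ.≤ T
      S≤T = ≤-from-gap P 0≤P refl
      0<cw : 0ℚ ℚ.< c ℚ.* w
      0<cw = *-pos (subst (λ i → 0ℚ ℚ.< grid 0 i) (sym k≡1+j)
          (ℚ.positive⁻¹ (grid 0 (suc j)) {{ℚ.normalize-pos (suc j) 1}}))
        (*-pos 0<P (*-pos 0<P (^-pos k (ℚ.<-≤-trans 0<P P≤T))))
      Pᵏ⁺¹S≤w : P ↑ suc k ℚ.* S ℚ.≤ w
      Pᵏ⁺¹S≤w = subst (λ i → P ↑ suc i ℚ.* S ℚ.≤ P ℚ.* (P ℚ.* T ↑ i)) (sym k≡1+j)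
        (ℚ.≤-trans
          (ℚ.≤-reflexive (solve 3 (λ p pj s → p :* (p :* pj) :* s := p :* (p :* (s :* pj)))
            refl P (P ↑ j) S))
          (*-monoˡ-≤ 0≤P (*-monoˡ-≤ 0≤P
            (*-mono-≤ (^-nonNeg j 0≤P) (ℚ.≤-trans 0≤S S≤T) S≤T (^-mono-≤ j 0≤P P≤T)))))
      -- With Q = 0, s = P and t = T, `young-integrated` says (1 + c) w ≤ P^(k+1) S; since T is at
      -- least S and P, the right side is at most w.
      cw≤0 : c ℚ.* w ℚ.≤ 0ℚ
      cw≤0 = +-cancelˡ-≤ w (ℚ.≤-trans
        (subst₂ ℚ._≤_
          (solve 3 (λ c p t → (con 1ℚ :+ c) :* (p :* t) :* p := p :* (p :* t) :+ c :* (p :* (p :* t)))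
            refl c P (T ↑ k))
          (trans (cong (λ z → P ↑ suc k ℚ.* S ℚ.+ c ℚ.* T ↑ suc k ℚ.* z) Q≡0)
            (solve 2 (λ u v → u :+ v :* con 0ℚ := u) refl (P ↑ suc k ℚ.* S) (c ℚ.* T ↑ suc k)))
          (young-integrated 0≤P (ℚ.≤-trans 0≤P P≤T)))
        (ℚ.≤-trans Pᵏ⁺¹S≤w (ℚ.≤-reflexive (sym (ℚ.+-identityʳ w)))))

  hölder : P ↑ suc k ℚ.≤ S ℚ.* Q ↑ k
  hölder with Q ℚ.≤? 0ℚ
  ... | no Q≰0 = *-cancelˡ-≤ (ℚ.≰⇒> Q≰0) Q·P≤Q·SQ
  ... | yes Q≤0 = go k refl
    where
    go : ∀ i → k ≡ i → P ↑ suc k ℚ.≤ S ℚ.* Q ↑ k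
    -- For k = 0 the vanishing of Q says nothing about P, but then both sides are the integral of C.
    go zero    refl = ℚ.≤-reflexive (cong (ℚ._* 1ℚ) (congruent λ x →
      trans (ℚ.*-identityˡ (C x)) (sym (ℚ.*-identityʳ (C x)))))
    go (suc j) k≡1+j = subst (ℚ._≤ S ℚ.* Q ↑ k)
      (sym (trans (cong (ℚ._* P ↑ k) (P≡0 j k≡1+j (ℚ.≤-antisym Q≤0 0≤Q))) (ℚ.*-zeroˡ (P ↑ k))))
      (*-nonNeg 0≤S (^-nonNeg k 0≤Q))

open Hölder using (hölder)

-- Sums over index sets split into blocks

module BlockSums {c ℓ} (M : CommutativeMonoid c ℓ) where
  open CommutativeMonoid M renaming (refl to ≈-refl; sym to ≈-sym; trans to ≈-trans)
  open import Algebra.Properties.CommutativeMonoid.Sum M using () renaming (sum to ∑)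

  ∑-++ : ∀ m {n} (f : Vector Carrier (m ℕ.+ n)) →
         ∑ f ≈ ∑ (λ i → f (i ↑ˡ n)) ∙ ∑ (λ j → f (m ↑ʳ j))
  ∑-++ zero    f = ≈-sym (identityˡ _)
  ∑-++ (suc m) f = ≈-trans (∙-congˡ (∑-++ m (f ∘ suc))) (≈-sym (assoc _ _ _))

  ∑-combine : ∀ m {n} (f : Vector Carrier (m ℕ.* n)) → ∑ f ≈ ∑ λ i → ∑ λ j → f (combine {m} {n} i j)
  ∑-combine zero        f = ≈-refl
  ∑-combine (suc m) {n} f = ≈-trans (∑-++ n f) (∙-congˡ (∑-combine m (λ i → f (n ↑ʳ i))))

open BlockSums ℚ.+-0-commutativeMonoid using () renaming (∑-combine to sum-combine)

sum-mono : ∀ {n} {f g : Vector ℚ n} → (∀ i → f i ℚ.≤ g i) → sum f ℚ.≤ sum g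
sum-mono {zero}  f≤g = ℚ.≤-refl
sum-mono {suc n} f≤g = ℚ.+-mono-≤ (f≤g zero) (sum-mono (f≤g ∘ suc))

product-const : ∀ n q → product {n} (λ _ → q) ≡ q ↑ n
product-const zero    q = refl
product-const (suc n) q = cong (q ℚ.*_) (product-const n q)

product-nonNeg : ∀ {n} {f : Vector ℚ n} → (∀ i → 0ℚ ℚ.≤ f i) → 0ℚ ℚ.≤ product f
product-nonNeg {zero}  0≤f = 0≤1
product-nonNeg {suc n} 0≤f = *-nonNeg (0≤f zero) (product-nonNeg (0≤f ∘ suc))

-- Sums over all maps Fin m → Fin n

-- `finToFun` at a combined index agrees with `i ∷ finToFun j` only pointwise, so splitting a sum
-- over maps relies on this condition.
Extensional : ∀ {m n} → ((Fin m → Fin n) → ℚ) → Set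
Extensional F = ∀ {f g} → f ≗ g → F f ≡ F g

sumMaps : ∀ m {n} → ((Fin m → Fin n) → ℚ) → ℚ
sumMaps m {n} F = sum λ k → F (finToFun {n} {m} k)

sumMaps-cong : ∀ m {n} {F G : (Fin m → Fin n) → ℚ} → F ≗ G → sumMaps m F ≡ sumMaps m G
sumMaps-cong m F≗G = sum-cong-≗ λ k → F≗G (finToFun k)

sumMaps-suc : ∀ m {n} (F : (Fin (suc m) → Fin n) → ℚ) → Extensional F →
              sumMaps (suc m) F ≡ sum λ i → sumMaps m λ f → F (i ∷ f)
sumMaps-suc m {n} F ext = trans (sum-combine n (λ k → F (finToFun {n} {suc m} k)))
  (sum-cong-≗ λ i → sum-cong-≗ λ j → ext (split i j))
  where
  split : ∀ i j → finToFun {n} {suc m} (combine i j) ≗ i ∷ finToFun j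
  split i j zero    = cong proj₁ (Fin.remQuot-combine {n} i j)
  split i j (suc k) = cong (λ r → finToFun (proj₂ r) k) (Fin.remQuot-combine {n} i j)

∷-cong : ∀ {m n} (i : Fin n) {f g : Fin m → Fin n} → f ≗ g → (i ∷ f) ≗ (i ∷ g)
∷-cong i f≗g zero    = refl
∷-cong i f≗g (suc k) = f≗g k

∷-++ : ∀ {m k n} (i : Fin n) (f : Fin m → Fin n) (g : Fin k → Fin n) →
       i ∷ (f ++ g) ≗ (i ∷ f) ++ g
∷-++ i f g zero = refl
∷-++ {m} i f g (suc j) with splitAt m j
... | inj₁ _ = refl
... | inj₂ _ = refl

++-congˡ : ∀ {m k n} {f f′ : Fin m → Fin n} (g : Fin k → Fin n) → f ≗ f′ → (f ++ g) ≗ (f′ ++ g)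
++-congˡ {m} g f≗f′ j with splitAt m j
... | inj₁ i = f≗f′ i
... | inj₂ _ = refl

sumMaps-++ : ∀ m k {n} (F : (Fin (m ℕ.+ k) → Fin n) → ℚ) → Extensional F →
             sumMaps (m ℕ.+ k) F ≡ sumMaps m λ f → sumMaps k λ g → F (f ++ g)
sumMaps-++ zero    k F ext = sym (ℚ.+-identityʳ _)
sumMaps-++ (suc m) k F ext = begin
  sumMaps (suc m ℕ.+ k) F
    ≡⟨ sumMaps-suc (m ℕ.+ k) F ext ⟩
  (sum λ i → sumMaps (m ℕ.+ k) λ h → F (i ∷ h))
    ≡⟨ sum-cong-≗ (λ i → sumMaps-++ m k (λ h → F (i ∷ h)) (λ f≗g → ext (∷-cong i f≗g))) ⟩
  (sum λ i → sumMaps m λ f → sumMaps k λ g → F (i ∷ (f ++ g)))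
    ≡⟨ sum-cong-≗ (λ i → sumMaps-cong m λ f → sumMaps-cong k λ g → ext (∷-++ i f g)) ⟩
  (sum λ i → sumMaps m λ f → sumMaps k λ g → F ((i ∷ f) ++ g))
    ≡⟨ sumMaps-suc m (λ f → sumMaps k λ g → F (f ++ g))
         (λ f≗g → sumMaps-cong k λ h → ext (++-congˡ h f≗g)) ⟨
  (sumMaps (suc m) λ f → sumMaps k λ g → F (f ++ g)) ∎
  where open ≡-Reasoning

-- Generalised distributivity: expanding a product of m sums means choosing one index per factor,
-- which is a map.
sumMaps-product : ∀ m {n} (G : Fin m → Fin n → ℚ) →
                  sumMaps m (λ f → product λ i → G i (f i)) ≡ product λ i → sum (G i)
sumMaps-product zero    G = refl
sumMaps-product (suc m) {n} G = begin
  sumMaps (suc m) (λ f → product λ i → G i (f i))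
    ≡⟨ sumMaps-suc m (λ f → product λ i → G i (f i)) (λ f≗g → product-cong λ i → cong (G i) (f≗g i)) ⟩
  (sum λ z → sumMaps m λ f → G zero z ℚ.* product λ i → G (suc i) (f i))
    ≡⟨ sum-cong-≗ (λ z → *-distribˡ-sum (G zero z) (λ k → product λ i → G (suc i) (finToFun {n} {m} k i))) ⟨
  (sum λ z → G zero z ℚ.* sumMaps m λ f → product λ i → G (suc i) (f i))
    ≡⟨ sum-cong-≗ (λ z → cong (G zero z ℚ.*_) (sumMaps-product m (G ∘ suc))) ⟩
  (sum λ z → G zero z ℚ.* product λ i → sum (G (suc i)))
    ≡⟨ *-distribʳ-sum (product λ i → sum (G (suc i))) (G zero) ⟨
  sum (G zero) ℚ.* (product λ i → sum (G (suc i))) ∎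
  where open ≡-Reasoning

-- The positive functionals in use, and the Cauchy-Schwarz inequality

sumFunctional : ∀ n → PositiveFunctional (Fin n)
sumFunctional n = record
  { I           = sum
  ; mono        = sum-mono
  ; additive    = ∑-distrib-+
  ; homogeneous = λ c f → sym (*-distribˡ-sum c f)
  }

mapsFunctional : ∀ m n → PositiveFunctional (Fin m → Fin n)
mapsFunctional m n = record
  { I           = sumMaps m
  ; mono        = λ f≤g → sum-mono λ k → f≤g (finToFun k)
  ; additive    = λ f g → ∑-distrib-+ (f ∘ finToFun) (g ∘ finToFun)
  ; homogeneous = λ c f → sym (*-distribˡ-sum c (f ∘ finToFun))
  }

Kernel : ℕ → Set
Kernel n = Fin n → Fin n → ℚ

form : ∀ {n} → Kernel n → (Fin n × Fin n → ℚ) → ℚ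
form K F = sum λ i → sum λ j → K i j ℚ.* F (i , j)

kernelFunctional : ∀ {n} (K : Kernel n) → (∀ i j → 0ℚ ℚ.≤ K i j) → PositiveFunctional (Fin n × Fin n)
kernelFunctional K 0≤K = record
  { I           = form K
  ; mono        = λ f≤g → sum-mono λ i → sum-mono λ j → *-monoˡ-≤ (0≤K i j) (f≤g (i , j))
  ; additive    = λ f g → trans
      (sum-cong-≗ λ i → trans
        (sum-cong-≗ λ j → ℚ.*-distribˡ-+ (K i j) (f (i , j)) (g (i , j)))
        (∑-distrib-+ (λ j → K i j ℚ.* f (i , j)) (λ j → K i j ℚ.* g (i , j))))
      (∑-distrib-+ (λ i → sum λ j → K i j ℚ.* f (i , j)) (λ i → sum λ j → K i j ℚ.* g (i , j)))
  ; homogeneous = λ c f → sym (trans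
      (*-distribˡ-sum c λ i → sum λ j → K i j ℚ.* f (i , j))
      (sum-cong-≗ λ i → trans
        (*-distribˡ-sum c λ j → K i j ℚ.* f (i , j))
        (sum-cong-≗ λ j → solve 3 (λ c k f → c :* (k :* f) := k :* (c :* f)) refl c (K i j) (f (i , j)))))
  }
  where open +-*-Solver

form-swap : ∀ {n} (K : Kernel n) → (∀ i j → K i j ≡ K j i) →
            ∀ F → form K (λ (i , j) → F (j , i)) ≡ form K F
form-swap K K-sym F = trans (∑-comm λ i j → K i j ℚ.* F (j , i))
  (sum-cong-≗ λ j → sum-cong-≗ λ i → cong (ℚ._* F (j , i)) (K-sym i j))

cauchy-schwarz : ∀ {X} (Λ : PositiveFunctional X) → let open PositiveFunctional Λ in
  ∀ {f g} → (∀ x → 0ℚ ℚ.≤ f x) → (∀ x → 0ℚ ℚ.≤ g x) →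
  I (λ x → f x ℚ.* g x) ℚ.* I (λ x → f x ℚ.* g x) ℚ.≤
  I (λ x → f x ℚ.* f x) ℚ.* I (λ x → g x ℚ.* g x)
cauchy-schwarz Λ {f} {g} 0≤f 0≤g = subst₂ ℚ._≤_
  (trans (^2 (I λ x → f x ↑ 1 ℚ.* g x)) (cong₂ ℚ._*_ fg fg))
  (trans (ℚ.*-comm (I λ x → g x ↑ 2) ((I λ x → f x ↑ 2) ↑ 1))
    (cong₂ ℚ._*_ (trans (^1 (I λ x → f x ↑ 2)) (congruent (^2 ∘ f))) (congruent (^2 ∘ g))))
  (hölder Λ 0≤f 0≤g 1)
  where
  open PositiveFunctional Λ
  ^1 : ∀ x → x ↑ 1 ≡ x
  ^1 = ℚ.*-identityʳ
  ^2 : ∀ x → x ↑ 2 ≡ x ℚ.* x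
  ^2 x = cong (x ℚ.*_) (^1 x)
  fg : I (λ x → f x ↑ 1 ℚ.* g x) ≡ I (λ x → f x ℚ.* g x)
  fg = congruent λ x → cong (ℚ._* g x) (^1 (f x))

-- Hölder's inequality for weighted counts of complete bipartite graphs

product-↑ : ∀ {n} (f : Vector ℚ n) k → product f ↑ k ≡ product λ i → f i ↑ k
product-↑ {zero}  f k = 1↑ k
product-↑ {suc n} f k = trans (↑-distrib-* (f zero) (product (f ∘ suc)) k)
  (cong (f zero ↑ k ℚ.*_) (product-↑ (f ∘ suc) k))

weightedHom : ∀ a b {n} → Kernel n → ℚ
weightedHom a b K = sumMaps a λ x → sumMaps b λ y → product λ i → product λ j → K (x i) (y j)

module CompleteBipartiteBound {n} (K : Kernel n) (0≤K : ∀ i j → 0ℚ ℚ.≤ K i j)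
  (α β : ℕ) {ω : Vector ℚ n} (0≤ω : ∀ i → 0ℚ ℚ.≤ ω i) where

  open ≡-Reasoning

  private
    a b : ℕ
    a = suc α
    b = suc β

    N : ℚ
    N = sum λ i → ω i ↑ (a ℕ.* b)

    h : Vector ℚ n
    h j = sum λ i → K i j ℚ.* (ω i ↑ a) ↑ β

    0≤h : ∀ j → 0ℚ ℚ.≤ h j
    0≤h j = PositiveFunctional.nonNeg (sumFunctional n)
      λ i → *-nonNeg (0≤K i j) (^-nonNeg β (^-nonNeg a (0≤ω i)))

    C φ : (Fin a → Fin n) → ℚ
    C x = sum λ j → product λ i → K (x i) j
    φ x = product λ i → ω (x i) ↑ a

    -- The a-th power of h j expands over a-tuples x of vertices. The weights of the tuple do not
    -- depend on j and factor out, leaving the weight `C x` of its common neighbours.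
    ∑hᵃ : (sum λ j → h j ↑ a) ≡ sumMaps a λ x → φ x ↑ β ℚ.* C x
    ∑hᵃ = begin
      (sum λ j → h j ↑ a)
        ≡⟨ sum-cong-≗ (λ j → trans (sumMaps-product a λ i z → K z j ℚ.* (ω z ↑ a) ↑ β)
             (product-const a (h j))) ⟨
      (sum λ j → sumMaps a λ x → product λ i → K (x i) j ℚ.* (ω (x i) ↑ a) ↑ β)
        ≡⟨ ∑-comm (λ j k → product λ i → K (finToFun {n} {a} k i) j ℚ.* (ω (finToFun {n} {a} k i) ↑ a) ↑ β) ⟩
      (sumMaps a λ x → sum λ j → product λ i → K (x i) j ℚ.* (ω (x i) ↑ a) ↑ β)
        ≡⟨ sumMaps-cong a (λ x → sum-cong-≗ λ j → trans
             (product-* (λ i → K (x i) j) (λ i → (ω (x i) ↑ a) ↑ β))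
             (trans (ℚ.*-comm (product λ i → K (x i) j) (product λ i → (ω (x i) ↑ a) ↑ β))
               (cong (ℚ._* product λ i → K (x i) j) (sym (product-↑ (λ i → ω (x i) ↑ a) β))))) ⟩
      (sumMaps a λ x → sum λ j → φ x ↑ β ℚ.* product λ i → K (x i) j)
        ≡⟨ sumMaps-cong a (λ x → *-distribˡ-sum (φ x ↑ β) λ j → product λ i → K (x i) j) ⟨
      (sumMaps a λ x → φ x ↑ β ℚ.* C x) ∎

    -- Once x is fixed, the b vertices on the other side are chosen independently, and each choice
    -- contributes a factor `C x`.
    ∑Cᵇ : (sumMaps a λ x → C x ↑ b) ≡ weightedHom a b K
    ∑Cᵇ = sumMaps-cong a λ x → begin
      C x ↑ b
        ≡⟨ product-const b (C x) ⟨
      product {b} (λ _ → C x)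
        ≡⟨ sumMaps-product b (λ _ z → product λ i → K (x i) z) ⟨
      (sumMaps b λ y → product λ j → product λ i → K (x i) (y j))
        ≡⟨ sumMaps-cong b (λ y → product-comm λ j i → K (x i) (y j)) ⟩
      (sumMaps b λ y → product λ i → product λ j → K (x i) (y j)) ∎

    ∑φᵇ : (sumMaps a λ x → φ x ↑ b) ≡ N ↑ a
    ∑φᵇ = begin
      (sumMaps a λ x → φ x ↑ b)
        ≡⟨ sumMaps-cong a (λ x → trans (product-↑ (λ i → ω (x i) ↑ a) b)
             (product-cong λ i → ↑-* (ω (x i)) a b)) ⟩
      (sumMaps a λ x → product λ i → ω (x i) ↑ (a ℕ.* b))
        ≡⟨ sumMaps-product a (λ _ z → ω z ↑ (a ℕ.* b)) ⟩
      product {a} (λ _ → N)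
        ≡⟨ product-const a N ⟩
      N ↑ a ∎

    ∑hᵃ-bound : (sum λ j → h j ↑ a) ↑ b ℚ.≤ weightedHom a b K ℚ.* (N ↑ a) ↑ β
    ∑hᵃ-bound = subst₂ ℚ._≤_ (cong (_↑ b) (sym ∑hᵃ)) (cong₂ (λ u v → u ℚ.* v ↑ β) ∑Cᵇ ∑φᵇ)
      (hölder (mapsFunctional a n)
        (λ x → product-nonNeg λ i → ^-nonNeg a (0≤ω (x i)))
        (λ x → PositiveFunctional.nonNeg (sumFunctional n) λ j → product-nonNeg λ i → 0≤K (x i) j) β)

    -- The nested powers have the shape φ^k of `hölder`: φ = ω^b with k = α over vertices, and
    -- products of ω^a with k = β over a-tuples.
    W : ℚ
    W = form K λ (i , j) → (ω i ↑ a) ↑ β ℚ.* (ω j ↑ b) ↑ α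

    W≡ : W ≡ sum λ j → (ω j ↑ b) ↑ α ℚ.* h j
    W≡ = trans (∑-comm λ i j → K i j ℚ.* ((ω i ↑ a) ↑ β ℚ.* (ω j ↑ b) ↑ α))
      (sum-cong-≗ λ j → trans
        (sum-cong-≗ λ i → solve 3 (λ k f g → k :* (f :* g) := g :* (k :* f)) refl
          (K i j) ((ω i ↑ a) ↑ β) ((ω j ↑ b) ↑ α))
        (sym (*-distribˡ-sum ((ω j ↑ b) ↑ α) λ i → K i j ℚ.* (ω i ↑ a) ↑ β)))
      where open +-*-Solver

    Wᵃ-bound : W ↑ a ℚ.≤ (sum λ j → h j ↑ a) ℚ.* N ↑ α
    Wᵃ-bound = subst₂ (λ u v → u ↑ a ℚ.≤ (sum λ j → h j ↑ a) ℚ.* v ↑ α) (sym W≡)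
      (sum-cong-≗ λ j → trans (↑-* (ω j) b a) (cong (ω j ↑_) (ℕ.*-comm b a)))
      (hölder (sumFunctional n) (λ j → ^-nonNeg b (0≤ω j)) 0≤h α)

    0≤N : 0ℚ ℚ.≤ N
    0≤N = PositiveFunctional.nonNeg (sumFunctional n) λ i → ^-nonNeg (a ℕ.* b) (0≤ω i)

    0≤W : 0ℚ ℚ.≤ W
    0≤W = PositiveFunctional.nonNeg (kernelFunctional K 0≤K)
      λ (i , j) → *-nonNeg (^-nonNeg β (^-nonNeg a (0≤ω i))) (^-nonNeg α (^-nonNeg b (0≤ω j)))

  -- The b-th power of `Wᵃ-bound` contains exactly the quantity that `∑hᵃ-bound` estimates; N then
  -- collects aβ factors from the tuples and bα from the vertices.
  form-bound : W ↑ (a ℕ.* b) ℚ.≤ weightedHom a b K ℚ.* N ↑ (a ℕ.* β ℕ.+ b ℕ.* α)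
  form-bound = subst₂ ℚ._≤_ (↑-* W a b) regroup (ℚ.≤-trans
    (^-mono-≤ b (^-nonNeg a 0≤W) Wᵃ-bound)
    (ℚ.≤-trans (ℚ.≤-reflexive (↑-distrib-* (sum λ j → h j ↑ a) (N ↑ α) b))
      (*-monoʳ-≤ (^-nonNeg b (^-nonNeg α 0≤N)) ∑hᵃ-bound)))
    where
    regroup : weightedHom a b K ℚ.* (N ↑ a) ↑ β ℚ.* (N ↑ α) ↑ b ≡
              weightedHom a b K ℚ.* N ↑ (a ℕ.* β ℕ.+ b ℕ.* α)
    regroup = trans (ℚ.*-assoc (weightedHom a b K) ((N ↑ a) ↑ β) ((N ↑ α) ↑ b))
      (cong (weightedHom a b K ℚ.*_) (trans
        (cong₂ ℚ._*_ (↑-* N a β) (trans (↑-* N α b) (cong (N ↑_) (ℕ.*-comm α b))))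
        (sym (↑-+ N (a ℕ.* β) (b ℕ.* α)))))

open CompleteBipartiteBound using (form-bound)

-- The rational inequality for the bilinear form of A

half-≤ : ∀ {x y} → x ℚ.+ x ℚ.≤ y ℚ.+ y → x ℚ.≤ y
half-≤ {x} {y} h = subst₂ ℚ._≤_ (halve x) (halve y) (*-monoˡ-≤ {½} (ℚ.nonNegative⁻¹ ½) h)
  where
  halve : ∀ x → ½ ℚ.* (x ℚ.+ x) ≡ x
  halve x = trans (ℚ.*-distribˡ-+ ½ x x) (half+half x)

codegree : ∀ {n} → Kernel n → Kernel n
codegree K i j = sum λ z → K i z ℚ.* K j z

module SubdivisionBound {n} (A : Kernel n) (0≤A : ∀ i j → 0ℚ ℚ.≤ A i j)
  (A-sym : ∀ i j → A i j ≡ A j i) (α β : ℕ) where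

  private
    a b p q : ℕ
    a = suc α
    b = suc β
    p = a ℕ.* β ℕ.+ b ℕ.* α
    q = a ℕ.* b

    0≤codegree : ∀ i j → 0ℚ ℚ.≤ codegree A i j
    0≤codegree i j = PositiveFunctional.nonNeg (sumFunctional n) λ z → *-nonNeg (0≤A i z) (0≤A j z)

    codegree-sym : ∀ i j → codegree A i j ≡ codegree A j i
    codegree-sym i j = sum-cong-≗ λ z → ℚ.*-comm (A i z) (A j z)

    M : ℚ
    M = weightedHom a b (codegree A)

    N : Vector ℚ n → ℚ
    N η = sum λ i → η i ↑ (4 ℕ.* q)

    U : (η ξ : Vector ℚ n) → ℚ
    U η ξ = form A λ (i , j) → η i ↑ p ℚ.* ξ j ↑ q ℚ.* (η i ↑ p ℚ.* ξ j ↑ q)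

  module _ {η ξ : Vector ℚ n} (0≤η : ∀ i → 0ℚ ℚ.≤ η i) (0≤ξ : ∀ i → 0ℚ ℚ.≤ ξ i) where

    private
      u : Vector ℚ n
      u i = η i ↑ p ℚ.* η i ↑ p

      Au : Vector ℚ n
      Au j = sum λ i → A i j ℚ.* u i

      V W : ℚ
      V = form (codegree A) λ (i , j) → u i ℚ.* u j
      W = form (codegree A) λ (i , j) → ((η i ↑ 4) ↑ a) ↑ β ℚ.* ((η j ↑ 4) ↑ b) ↑ α

      0≤u : ∀ i → 0ℚ ℚ.≤ u i
      0≤u i = *-nonNeg (^-nonNeg p (0≤η i)) (^-nonNeg p (0≤η i))

      -- The squared length of the transpose of A applied to u is ⟨u, Bu⟩ with B the product of A
      -- and its transpose, which is `codegree A`.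
      ∑Au² : (sum λ j → Au j ℚ.* Au j) ≡ V
      ∑Au² = begin
        (sum λ j → Au j ℚ.* Au j)
          ≡⟨ sum-cong-≗ (λ j → trans (*-distribʳ-sum (Au j) λ i → A i j ℚ.* u i)
               (sum-cong-≗ λ i → *-distribˡ-sum (A i j ℚ.* u i) λ k → A k j ℚ.* u k)) ⟩
        (sum λ j → sum λ i → sum λ k → A i j ℚ.* u i ℚ.* (A k j ℚ.* u k))
          ≡⟨ ∑-comm (λ j i → sum λ k → A i j ℚ.* u i ℚ.* (A k j ℚ.* u k)) ⟩
        (sum λ i → sum λ j → sum λ k → A i j ℚ.* u i ℚ.* (A k j ℚ.* u k))
          ≡⟨ sum-cong-≗ (λ i → ∑-comm (λ j k → A i j ℚ.* u i ℚ.* (A k j ℚ.* u k))) ⟩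
        (sum λ i → sum λ k → sum λ j → A i j ℚ.* u i ℚ.* (A k j ℚ.* u k))
          ≡⟨ sum-cong-≗ (λ i → sum-cong-≗ λ k → trans
               (sum-cong-≗ λ j → solve 4 (λ x u y v → x :* u :* (y :* v) := x :* y :* (u :* v)) refl
                 (A i j) (u i) (A k j) (u k))
               (sym (*-distribʳ-sum (u i ℚ.* u k) λ j → A i j ℚ.* A k j))) ⟩
        V ∎
        where
        open ≡-Reasoning
        open +-*-Solver

      U² : U η ξ ℚ.* U η ξ ℚ.≤ V ℚ.* N ξ
      U² = subst₂ ℚ._≤_ (cong₂ ℚ._*_ (sym U≡) (sym U≡))
        (cong₂ ℚ._*_ ∑Au² (sum-cong-≗ λ j → trans (fourth (ξ j ↑ q))
          (trans (↑-* (ξ j) q 4) (cong (ξ j ↑_) (ℕ.*-comm q 4)))))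
        (cauchy-schwarz (sumFunctional n)
          (λ j → PositiveFunctional.nonNeg (sumFunctional n) λ i → *-nonNeg (0≤A i j) (0≤u i))
          (λ j → *-nonNeg (^-nonNeg q (0≤ξ j)) (^-nonNeg q (0≤ξ j))))
        where
        open +-*-Solver
        fourth : ∀ x → x ℚ.* x ℚ.* (x ℚ.* x) ≡ x ↑ 4
        fourth = solve 1 (λ x → x :* x :* (x :* x) := x :* (x :* (x :* (x :* con 1ℚ)))) refl
        U≡ : U η ξ ≡ sum λ j → Au j ℚ.* (ξ j ↑ q ℚ.* ξ j ↑ q)
        U≡ = trans (∑-comm λ i j → A i j ℚ.* (η i ↑ p ℚ.* ξ j ↑ q ℚ.* (η i ↑ p ℚ.* ξ j ↑ q)))
          (sum-cong-≗ λ j → trans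
            (sum-cong-≗ λ i → solve 3 (λ k x y → k :* (x :* y :* (x :* y)) := k :* (x :* x) :* (y :* y))
              refl (A i j) (η i ↑ p) (ξ j ↑ q))
            (sym (*-distribʳ-sum (ξ j ↑ q ℚ.* ξ j ↑ q) λ i → A i j ℚ.* u i)))

      -- `form-bound` wants the exponents aβ and bα on different sides, whereas V has p = aβ + bα on
      -- both. Hence u_i u_j is written as f(i,j) f(j,i) with f(i,j) = η_i^(2aβ) η_j^(2bα); AM-GM
      -- gives two squares, and both integrate to W because the codegree matrix is symmetric.
      V≤W : V ℚ.≤ W
      V≤W = half-≤ (subst₂ ℚ._≤_
        (trans (additive (λ x → f x ℚ.* g x) (λ x → f x ℚ.* g x)) (cong₂ ℚ._+_ V≡ V≡))
        (trans (additive (λ x → f x ℚ.* f x) (λ x → g x ℚ.* g x)) (cong₂ ℚ._+_ W≡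
          (trans (form-swap (codegree A) codegree-sym λ x → f x ℚ.* f x) W≡)))
        (mono λ x → am-gm (f x) (g x)))
        where
        open PositiveFunctional (kernelFunctional (codegree A) 0≤codegree)
        open +-*-Solver
        x y : Vector ℚ n
        x i = η i ↑ (a ℕ.* β)
        y i = η i ↑ (b ℕ.* α)
        f g : Fin n × Fin n → ℚ
        f (i , j) = x i ℚ.* y j ℚ.* (x i ℚ.* y j)
        g (i , j) = f (j , i)
        V≡ : form (codegree A) (λ x → f x ℚ.* g x) ≡ V
        V≡ = congruent λ (i , j) → trans
          (solve 4 (λ x y z w → x :* w :* (x :* w) :* (z :* y :* (z :* y))
              := x :* y :* (x :* y) :* (z :* w :* (z :* w))) refl (x i) (y i) (x j) (y j))
          (cong₂ ℚ._*_ (square i) (square j))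
          where
          square : ∀ i → x i ℚ.* y i ℚ.* (x i ℚ.* y i) ≡ u i
          square i = sym (cong₂ ℚ._*_ (↑-+ (η i) (a ℕ.* β) (b ℕ.* α)) (↑-+ (η i) (a ℕ.* β) (b ℕ.* α)))
        fourth : ∀ z c d → (z ↑ (c ℕ.* d)) ↑ 4 ≡ ((z ↑ 4) ↑ c) ↑ d
        fourth z c d = trans (↑-* z (c ℕ.* d) 4) (trans
          (cong (z ↑_) (trans (ℕ.*-comm (c ℕ.* d) 4) (sym (ℕ.*-assoc 4 c d))))
          (sym (trans (cong (_↑ d) (↑-* z 4 c)) (↑-* z (4 ℕ.* c) d))))
        W≡ : form (codegree A) (λ x → f x ℚ.* f x) ≡ W
        W≡ = congruent λ (i , j) → trans
          (solve 2 (λ x y → x :* y :* (x :* y) :* (x :* y :* (x :* y))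
            := x :* (x :* (x :* (x :* con 1ℚ))) :* (y :* (y :* (y :* (y :* con 1ℚ))))) refl (x i) (y j))
          (cong₂ ℚ._*_ (fourth (η i) a β) (fourth (η j) b α))

    N-nonNeg : 0ℚ ℚ.≤ N ξ
    N-nonNeg = PositiveFunctional.nonNeg (sumFunctional n) λ j → ^-nonNeg (4 ℕ.* q) (0≤ξ j)

    U-nonNeg : 0ℚ ℚ.≤ U η ξ
    U-nonNeg = PositiveFunctional.nonNeg (kernelFunctional A 0≤A)
      λ (i , j) → square-nonNeg (η i ↑ p ℚ.* ξ j ↑ q)

    U-bound : (U η ξ ℚ.* U η ξ) ↑ q ℚ.≤ M ℚ.* N η ↑ p ℚ.* N ξ ↑ q
    U-bound = ℚ.≤-trans
      (^-mono-≤ q (square-nonNeg (U η ξ))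
        (ℚ.≤-trans U² (*-monoʳ-≤ N-nonNeg V≤W)))
      (ℚ.≤-trans (ℚ.≤-reflexive (↑-distrib-* W (N ξ) q))
        (*-monoʳ-≤ (^-nonNeg q N-nonNeg)
          -- `form-bound` is applied with ω = η^4, whose q-th powers sum to `N η`.
          (subst (λ z → W ↑ q ℚ.≤ M ℚ.* z ↑ p) (sum-cong-≗ λ i → ↑-* (η i) 4 q)
            (form-bound (codegree A) 0≤codegree α β λ i → ^-nonNeg 4 (0≤η i)))))

  -- The estimates of U(η,ξ) and U(ξ,η) carry `N η` and `N ξ` with exponents p, q and q, p
  -- respectively, so their product has exponent p + q on both.
  subdivision-bound : ∀ {η ξ : Vector ℚ n} → (∀ i → 0ℚ ℚ.≤ η i) → (∀ i → 0ℚ ℚ.≤ ξ i) →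
    form A (λ (i , j) → η i ↑ (p ℕ.+ q) ℚ.* ξ j ↑ (p ℕ.+ q)) ↑ (4 ℕ.* q) ℚ.≤
    M ℚ.* M ℚ.* (N η ℚ.* N ξ) ↑ (p ℕ.+ q)
  subdivision-bound {η} {ξ} 0≤η 0≤ξ = subst₂ ℚ._≤_
    (trans (cong (_↑ q) (fourth S)) (↑-* S 4 q)) regroup
    (ℚ.≤-trans (^-mono-≤ q (square-nonNeg (S ℚ.* S)) (ℚ.≤-trans
        (*-mono-≤ (square-nonNeg S) (*-nonNeg 0≤U 0≤U′) S² S²)
        (ℚ.≤-reflexive (interchange (U η ξ) (U ξ η)))))
      (ℚ.≤-trans (ℚ.≤-reflexive (↑-distrib-* (U η ξ ℚ.* U η ξ) (U ξ η ℚ.* U ξ η) q))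
        (*-mono-≤ (^-nonNeg q (square-nonNeg (U ξ η)))
          (ℚ.≤-trans (^-nonNeg q (square-nonNeg (U η ξ))) (U-bound 0≤η 0≤ξ))
          (U-bound 0≤η 0≤ξ) (U-bound 0≤ξ 0≤η))))
    where
    open +-*-Solver
    S : ℚ
    S = form A (λ (i , j) → η i ↑ (p ℕ.+ q) ℚ.* ξ j ↑ (p ℕ.+ q))
    0≤U : 0ℚ ℚ.≤ U η ξ
    0≤U = U-nonNeg 0≤η 0≤ξ
    0≤U′ : 0ℚ ℚ.≤ U ξ η
    0≤U′ = U-nonNeg 0≤ξ 0≤η
    fourth : ∀ x → x ℚ.* x ℚ.* (x ℚ.* x) ≡ x ↑ 4
    fourth = solve 1 (λ x → x :* x :* (x :* x) := x :* (x :* (x :* (x :* con 1ℚ)))) refl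
    interchange : ∀ x y → x ℚ.* y ℚ.* (x ℚ.* y) ≡ x ℚ.* x ℚ.* (y ℚ.* y)
    interchange = solve 2 (λ x y → x :* y :* (x :* y) := x :* x :* (y :* y)) refl
    -- The summand is split as (η^p ξ^q)(η^q ξ^p); the square of the second factor sums to U(ξ,η)
    -- after transposing A.
    S² : S ℚ.* S ℚ.≤ U η ξ ℚ.* U ξ η
    S² = subst₂ ℚ._≤_ (cong₂ ℚ._*_ S≡ S≡)
      (cong (U η ξ ℚ.*_) (trans
        (congruent λ (i , j) → cong₂ ℚ._*_ (ℚ.*-comm (η i ↑ q) (ξ j ↑ p)) (ℚ.*-comm (η i ↑ q) (ξ j ↑ p)))
        (form-swap A A-sym λ (i , j) → ξ i ↑ p ℚ.* η j ↑ q ℚ.* (ξ i ↑ p ℚ.* η j ↑ q))))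
      (cauchy-schwarz (kernelFunctional A 0≤A)
        {λ (i , j) → η i ↑ p ℚ.* ξ j ↑ q} {λ (i , j) → η i ↑ q ℚ.* ξ j ↑ p}
        (λ (i , j) → *-nonNeg (^-nonNeg p (0≤η i)) (^-nonNeg q (0≤ξ j)))
        (λ (i , j) → *-nonNeg (^-nonNeg q (0≤η i)) (^-nonNeg p (0≤ξ j))))
      where
      open PositiveFunctional (kernelFunctional A 0≤A)
      S≡ : form A (λ (i , j) → η i ↑ p ℚ.* ξ j ↑ q ℚ.* (η i ↑ q ℚ.* ξ j ↑ p)) ≡ S
      S≡ = congruent λ (i , j) → trans
        (solve 4 (λ x y z w → x :* y :* (z :* w) := x :* z :* (w :* y)) refl
          (η i ↑ p) (ξ j ↑ q) (η i ↑ q) (ξ j ↑ p))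
        (sym (cong₂ ℚ._*_ (↑-+ (η i) p q) (↑-+ (ξ j) p q)))
    regroup : M ℚ.* N η ↑ p ℚ.* N ξ ↑ q ℚ.* (M ℚ.* N ξ ↑ p ℚ.* N η ↑ q) ≡
              M ℚ.* M ℚ.* (N η ℚ.* N ξ) ↑ (p ℕ.+ q)
    regroup = trans
      (solve 5 (λ m x y z w → m :* x :* y :* (m :* z :* w) := m :* m :* (x :* w :* (z :* y)))
        refl M (N η ↑ p) (N ξ ↑ q) (N ξ ↑ p) (N η ↑ q))
      (cong (M ℚ.* M ℚ.*_) (sym (trans (↑-distrib-* (N η) (N ξ) (p ℕ.+ q))
        (cong₂ ℚ._*_ (↑-+ (N η) p q) (↑-+ (N ξ) p q)))))

open SubdivisionBound using (subdivision-bound)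

-- Sums over lists, in particular over edge lists

module ListSums {c} (M : CommutativeMonoid c 0ℓ) where
  open CommutativeMonoid M renaming (refl to ≈-refl; sym to ≈-sym; trans to ≈-trans)
  open import Algebra.Properties.CommutativeMonoid.Sum M
    using (sum-cong-≋; sum-replicate-zero) renaming (sum to ∑)
  open BlockSums M using (∑-++)

  -- The monoid is arbitrary because three are needed: addition in ℕ for edge counts, multiplication
  -- in ℚ for products over edges, and addition in ℚ for `hom`.
  ∑ˡ : ∀ {A : Set} → List A → (A → Carrier) → Carrier
  ∑ˡ xs F = ∑ λ k → F (lookup xs k)

  ∑ˡ-filter : ∀ {A : Set} {P : Pred A 0ℓ} (P? : Decidable P) xs F →
              ∑ˡ (filter P? xs) F ≈ ∑ˡ xs λ x → if does (P? x) then F x else ε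
  ∑ˡ-filter P? List.[]       F = ≈-refl
  ∑ˡ-filter P? (x List.∷ xs) F with does (P? x)
  ... | true  = ∙-congˡ (∑ˡ-filter P? xs F)
  ... | false = ≈-trans (∑ˡ-filter P? xs F) (≈-sym (identityˡ _))

  ∑ˡ-++ : ∀ {A : Set} (xs ys : List A) F → ∑ˡ (xs List.++ ys) F ≈ ∑ˡ xs F ∙ ∑ˡ ys F
  ∑ˡ-++ List.[]       ys F = ≈-sym (identityˡ _)
  ∑ˡ-++ (x List.∷ xs) ys F = ≈-trans (∙-congˡ (∑ˡ-++ xs ys F)) (≈-sym (assoc _ _ _))

  ∑ˡ-map : ∀ {A B : Set} (g : A → B) xs F → ∑ˡ (List.map g xs) F ≈ ∑ˡ xs (F ∘ g)
  ∑ˡ-map g List.[]       F = ≈-refl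
  ∑ˡ-map g (x List.∷ xs) F = ∙-congˡ (∑ˡ-map g xs F)

  ∑ˡ-tabulate : ∀ {A : Set} {n} (g : Fin n → A) F → ∑ˡ (tabulate g) F ≈ ∑ (F ∘ g)
  ∑ˡ-tabulate {n = zero}  g F = ≈-refl
  ∑ˡ-tabulate {n = suc n} g F = ∙-congˡ (∑ˡ-tabulate (g ∘ suc) F)

  ∑ˡ-cartesianProduct : ∀ {A B : Set} (xs : List A) (ys : List B) F →
    ∑ˡ (cartesianProduct xs ys) F ≈ ∑ˡ xs λ x → ∑ˡ ys λ y → F (x , y)
  ∑ˡ-cartesianProduct List.[]       ys F = ≈-refl
  ∑ˡ-cartesianProduct (x List.∷ xs) ys F = ≈-trans
    (∑ˡ-++ (List.map (x ,_) ys) (cartesianProduct xs ys) F)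
    (∙-cong (∑ˡ-map (x ,_) ys F) (∑ˡ-cartesianProduct xs ys F))

  ∑ˡ-edges : ∀ {n} (G : Graph n) (let open Graph G) F →
    ∑ˡ (edges G) F ≈ ∑ λ i → ∑ λ j → if does ((i Fin.<? j) ×-dec (i ~? j)) then F (i , j) else ε
  ∑ˡ-edges {n} G F = ≈-trans
    (∑ˡ-filter edge? (cartesianProduct (allFin n) (allFin n)) F)
    (≈-trans (∑ˡ-cartesianProduct (allFin n) (allFin n) F′)
      (≈-trans (∑ˡ-tabulate (λ i → i) λ i → ∑ˡ (allFin n) λ j → F′ (i , j))
        (sum-cong-≋ λ i → ∑ˡ-tabulate (λ j → j) λ j → F′ (i , j))))
    where
    open Graph G
    edge? : Decidable λ ((i , j) : Fin n × Fin n) → i Fin.< j × i ~ j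
    edge? (i , j) = (i Fin.<? j) ×-dec (i ~? j)
    F′ : Fin n × Fin n → Carrier
    F′ x = if does (edge? x) then F x else ε

  -- All left vertices precede all right vertices in `Fin (m + n)`, so `edges` lists each edge with
  -- its left endpoint first; of the four blocks of pairs only left-right survives.
  ∑ˡ-edges-bipartite : ∀ m {n} (G : Graph (m ℕ.+ n)) (let open Graph G) →
    (∀ i i′ → ¬ (i ↑ˡ n) ~ (i′ ↑ˡ n)) → (∀ j j′ → ¬ (m ↑ʳ j) ~ (m ↑ʳ j′)) → ∀ F →
    ∑ˡ (edges G) F ≈
    ∑ λ (i : Fin m) → ∑ λ (j : Fin n) →
      if does ((i ↑ˡ n) ~? (m ↑ʳ j)) then F (i ↑ˡ n , m ↑ʳ j) else ε
  ∑ˡ-edges-bipartite m {n} G noˡ noʳ F = ≈-trans (∑ˡ-edges G F) (≈-trans (∑-++ m _)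
    (≈-trans (∙-cong
        (sum-cong-≋ λ i → ≈-trans (∑-++ m _) (≈-trans
          (∙-cong (∑-zero λ i′ → off (edge? (i ↑ˡ n) (i′ ↑ˡ n)) (noˡ i i′ ∘ proj₂))
                  (sum-cong-≋ λ j → cross i j))
          (identityˡ _)))
        (∑-zero λ j → ≈-trans (∑-++ m _) (≈-trans
          (∙-cong (∑-zero λ i → off (edge? (m ↑ʳ j) (i ↑ˡ n)) (ℕ.<-asym (left<right i j) ∘ proj₁))
                  (∑-zero λ j′ → off (edge? (m ↑ʳ j) (m ↑ʳ j′)) (noʳ j j′ ∘ proj₂)))
          (identityˡ ε))))
      (identityʳ _)))
    where
    open Graph G

    edge? : ∀ u v → Dec (u Fin.< v × u ~ v)
    edge? u v = (u Fin.<? v) ×-dec (u ~? v)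

    ∑-zero : ∀ {n} {f : Vector Carrier n} → (∀ i → f i ≈ ε) → ∑ f ≈ ε
    ∑-zero {n} f≈ε = ≈-trans (sum-cong-≋ f≈ε) (sum-replicate-zero n)

    off : ∀ {P : Set} (P? : Dec P) {x} → ¬ P → (if does P? then x else ε) ≈ ε
    off P? ¬p rewrite dec-false P? ¬p = ≈-refl

    left<right : ∀ i j → (i ↑ˡ n) Fin.< (m ↑ʳ j)
    left<right i j = subst₂ ℕ._<_ (sym (Fin.toℕ-↑ˡ i n)) (sym (Fin.toℕ-↑ʳ m j))
      (ℕ.<-≤-trans (Fin.toℕ<n i) (ℕ.m≤m+n m _))

    cross : ∀ i j → (if does (edge? (i ↑ˡ n) (m ↑ʳ j)) then F (i ↑ˡ n , m ↑ʳ j) else ε) ≈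
                    (if does ((i ↑ˡ n) ~? (m ↑ʳ j)) then F (i ↑ˡ n , m ↑ʳ j) else ε)
    cross i j rewrite dec-true ((i ↑ˡ n) Fin.<? (m ↑ʳ j)) (left<right i j) = ≈-refl

-- Edge counts of K_{a,b} and of subdivisions

module _ (a b : ℕ) where
  open Graph (completeBipartite a b)

  completeBipartite-noˡ : ∀ i i′ → ¬ (i ↑ˡ b) ~ (i′ ↑ˡ b)
  completeBipartite-noˡ i i′ rewrite Fin.splitAt-↑ˡ a i b | Fin.splitAt-↑ˡ a i′ b = λ ()

  completeBipartite-noʳ : ∀ j j′ → ¬ (a ↑ʳ j) ~ (a ↑ʳ j′)
  completeBipartite-noʳ j j′ rewrite Fin.splitAt-↑ʳ a b j | Fin.splitAt-↑ʳ a b j′ = λ ()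

  completeBipartite-cross : ∀ i j → does ((i ↑ˡ b) ~? (a ↑ʳ j)) ≡ true
  completeBipartite-cross i j rewrite Fin.splitAt-↑ˡ a i b | Fin.splitAt-↑ʳ a b j = refl

module _ {c} (M : CommutativeMonoid c 0ℓ) where
  open CommutativeMonoid M using (_≈_; ε; reflexive) renaming (trans to ≈-trans)
  open import Algebra.Properties.CommutativeMonoid.Sum M using (sum-cong-≋) renaming (sum to ∑)
  open ListSums M

  ∑ˡ-edges-completeBipartite : ∀ a b F → ∑ˡ (edges (completeBipartite a b)) F ≈
                               ∑ λ (i : Fin a) → ∑ λ (j : Fin b) → F (i ↑ˡ b , a ↑ʳ j)
  ∑ˡ-edges-completeBipartite a b F = ≈-trans
    (∑ˡ-edges-bipartite a (completeBipartite a b) (completeBipartite-noˡ a b) (completeBipartite-noʳ a b) F)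
    (sum-cong-≋ λ i → sum-cong-≋ λ j → reflexive
      (cong (if_then F (i ↑ˡ b , a ↑ʳ j) else ε) (completeBipartite-cross a b i j)))

sumℕ-const : ∀ n c → sumℕ {n} (λ _ → c) ≡ n ℕ.* c
sumℕ-const zero    c = refl
sumℕ-const (suc n) c = cong (c ℕ.+_) (sumℕ-const n c)

∣E∣≡sumℕ : ∀ {n} (G : Graph n) → ∣E∣ G ≡ sumℕ {∣E∣ G} λ _ → 1
∣E∣≡sumℕ G = sym (trans (sumℕ-const (∣E∣ G) 1) (ℕ.*-identityʳ (∣E∣ G)))

∣E∣-completeBipartite : ∀ a b → ∣E∣ (completeBipartite a b) ≡ a ℕ.* b
∣E∣-completeBipartite a b = begin
  ∣E∣ (completeBipartite a b)
    ≡⟨ ∣E∣≡sumℕ (completeBipartite a b) ⟩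
  (sumℕ {∣E∣ (completeBipartite a b)} λ _ → 1)
    ≡⟨ ∑ˡ-edges-completeBipartite ℕ.+-0-commutativeMonoid a b (λ _ → 1) ⟩
  (sumℕ {a} λ _ → sumℕ {b} λ _ → 1)
    ≡⟨ sumℕ-const a (sumℕ {b} λ _ → 1) ⟩
  a ℕ.* (sumℕ {b} λ _ → 1)
    ≡⟨ cong (a ℕ.*_) (trans (sumℕ-const b 1) (ℕ.*-identityʳ b)) ⟩
  a ℕ.* b ∎
  where open ≡-Reasoning

endpoint₁ endpoint₂ : ∀ {n} (H : Graph n) → Fin (∣E∣ H) → Fin n
endpoint₁ H k = proj₁ (lookup (edges H) k)
endpoint₂ H k = proj₂ (lookup (edges H) k)

endpoints-distinct : ∀ {n} (H : Graph n) k → endpoint₁ H k ≢ endpoint₂ H k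
endpoints-distinct {n} H k eq = ℕ.<⇒≢
  (proj₁ (proj₂ (∈-filter⁻ (λ (i , j) → (i Fin.<? j) ×-dec (i ~? j))
    {xs = cartesianProduct (allFin n) (allFin n)} (∈-lookup k))))
  (cong Fin.toℕ eq)
  where open Graph H

sumℕ-≟ : ∀ {n} (x : Fin n) → sumℕ (λ u → if does (u Fin.≟ x) then 1 else 0) ≡ 1
sumℕ-≟ {suc n} zero    = cong suc (trans (sumℕ-const n 0) (ℕ.*-zeroʳ n))
sumℕ-≟ {suc n} (suc x) = sumℕ-≟ x

module _ {n} (H : Graph n) where
  open Graph (sub H)

  sub-noˡ : ∀ i i′ → ¬ (i ↑ˡ ∣E∣ H) ~ (i′ ↑ˡ ∣E∣ H)
  sub-noˡ i i′ rewrite Fin.splitAt-↑ˡ n i (∣E∣ H) | Fin.splitAt-↑ˡ n i′ (∣E∣ H) = λ ()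

  sub-noʳ : ∀ j j′ → ¬ (n ↑ʳ j) ~ (n ↑ʳ j′)
  sub-noʳ j j′ rewrite Fin.splitAt-↑ʳ n (∣E∣ H) j | Fin.splitAt-↑ʳ n (∣E∣ H) j′ = λ ()

  sub-cross : ∀ i k → does ((i ↑ˡ ∣E∣ H) ~? (n ↑ʳ k)) ≡
                      does ((i Fin.≟ endpoint₁ H k) ⊎-dec (i Fin.≟ endpoint₂ H k))
  sub-cross i k rewrite Fin.splitAt-↑ˡ n i (∣E∣ H) | Fin.splitAt-↑ʳ n (∣E∣ H) k = refl

  -- Counted from the midpoints: each has its two endpoints as neighbours, and these are distinct
  -- because the smaller one is listed first.
  ∣E∣-sub : ∣E∣ (sub H) ≡ ∣E∣ H ℕ.* 2
  ∣E∣-sub = begin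
    ∣E∣ (sub H)
      ≡⟨ ∣E∣≡sumℕ (sub H) ⟩
    (sumℕ {∣E∣ (sub H)} λ _ → 1)
      ≡⟨ ListSums.∑ˡ-edges-bipartite ℕ.+-0-commutativeMonoid n (sub H) sub-noˡ sub-noʳ (λ _ → 1) ⟩
    (sumℕ λ i → sumℕ λ k → if does ((i ↑ˡ ∣E∣ H) ~? (n ↑ʳ k)) then 1 else 0)
      ≡⟨ sumℕ-comm (λ i k → if does ((i ↑ˡ ∣E∣ H) ~? (n ↑ʳ k)) then 1 else 0) ⟩
    (sumℕ λ k → sumℕ λ i → if does ((i ↑ˡ ∣E∣ H) ~? (n ↑ʳ k)) then 1 else 0)
      ≡⟨ sumℕ-cong two ⟩
    (sumℕ {∣E∣ H} λ k → 2)
      ≡⟨ sumℕ-const (∣E∣ H) 2 ⟩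
    ∣E∣ H ℕ.* 2 ∎
    where
    open ≡-Reasoning
    disjoint : ∀ {x y : Fin n} → x ≢ y → ∀ u →
      (if does ((u Fin.≟ x) ⊎-dec (u Fin.≟ y)) then 1 else 0) ≡
      (if does (u Fin.≟ x) then 1 else 0) ℕ.+ (if does (u Fin.≟ y) then 1 else 0)
    disjoint {x} {y} x≢y u with u Fin.≟ x | u Fin.≟ y
    ... | yes u≡x | yes u≡y = contradiction (trans (sym u≡x) u≡y) x≢y
    ... | yes _   | no _    = refl
    ... | no _    | yes _   = refl
    ... | no _    | no _    = refl
    two : ∀ k → (sumℕ λ i → if does ((i ↑ˡ ∣E∣ H) ~? (n ↑ʳ k)) then 1 else 0) ≡ 2
    two k = trans
      (sumℕ-cong λ i → trans (cong (if_then 1 else 0) (sub-cross i k))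
        (disjoint (endpoints-distinct H k) i))
      (trans (sumℕ-+ (λ i → if does (i Fin.≟ endpoint₁ H k) then 1 else 0)
                     (λ i → if does (i Fin.≟ endpoint₂ H k) then 1 else 0))
        (cong₂ ℕ._+_ (sumℕ-≟ (endpoint₁ H k)) (sumℕ-≟ (endpoint₂ H k))))

  sub-bipartite : Bipartite (sub H)
  sub-bipartite = side , λ {u} {v} → differ {u} {v}
    where
    side : Fin (n ℕ.+ ∣E∣ H) → Bool
    side u = [ (λ _ → false) , (λ _ → true) ]′ (splitAt n u)
    differ : ∀ {u v} → u ~ v → side u ≢ side v
    differ {u} {v} u~v eq with splitAt n u | splitAt n v
    differ u~v () | inj₁ _ | inj₂ _
    differ u~v () | inj₂ _ | inj₁ _

-- Counting homomorphisms

indicator : ∀ {P : Set} → Dec P → ℚ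
indicator P? = if does P? then 1ℚ else 0ℚ

indicator-nonNeg : ∀ {P : Set} (P? : Dec P) → 0ℚ ℚ.≤ indicator P?
indicator-nonNeg (yes _) = 0≤1
indicator-nonNeg (no _)  = ℚ.≤-refl

indicator-≤1 : ∀ {P : Set} (P? : Dec P) → indicator P? ℚ.≤ 1ℚ
indicator-≤1 (yes _) = ℚ.≤-refl
indicator-≤1 (no _)  = 0≤1

sum-1 : ∀ n → sum {n} (λ _ → 1ℚ) ≡ grid 0 n
sum-1 zero    = refl
sum-1 (suc n) = trans (cong (1ℚ ℚ.+_) (sum-1 n)) (trans (ℚ.+-comm 1ℚ (grid 0 n)) (sym (grid-suc 0 n)))

hom≡sumMaps : ∀ {m n} (F : Graph m) (G : Graph n) →
              grid 0 (hom F G) ≡ sumMaps m λ f → indicator (isHom? F G f)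
hom≡sumMaps {m} {n} F G = trans (sym (sum-1 (hom F G)))
  (trans (∑ˡ-filter (λ k → isHom? F G (finToFun {n} {m} k)) (allFin (n ℕ.^ m)) (λ _ → 1ℚ))
    (∑ˡ-tabulate (λ k → k) λ k → indicator (isHom? F G (finToFun {n} {m} k))))
  where open ListSums ℚ.+-0-commutativeMonoid

isHom-extensional : ∀ {m n} (F : Graph m) (G : Graph n) →
                    Extensional λ f → indicator (isHom? F G f)
isHom-extensional F G {f} {g} f≗g = cong (if_then 1ℚ else 0ℚ)
  (does-⇔ (mk⇔ (transfer f≗g) (transfer (sym ∘ f≗g))) (isHom? F G f) (isHom? F G g))
  where
  transfer : ∀ {f g} → f ≗ g → IsHom F G f → IsHom F G g
  transfer f≗g h i j i~j = subst₂ (Graph._~_ G) (f≗g i) (f≗g j) (h i j i~j)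

product-≤1 : ∀ {n} {f : Vector ℚ n} → (∀ i → 0ℚ ℚ.≤ f i) → (∀ i → f i ℚ.≤ 1ℚ) → product f ℚ.≤ 1ℚ
product-≤1 {zero}  0≤f f≤1 = ℚ.≤-refl
product-≤1 {suc n} 0≤f f≤1 = *-mono-≤ (product-nonNeg (0≤f ∘ suc)) 0≤1 (f≤1 zero)
  (product-≤1 (0≤f ∘ suc) (f≤1 ∘ suc))

product-zero : ∀ {n} {f : Vector ℚ n} i → f i ≡ 0ℚ → product f ≡ 0ℚ
product-zero {suc n} {f} zero    fi≡0 = trans (cong (ℚ._* product (f ∘ suc)) fi≡0) (ℚ.*-zeroˡ (product (f ∘ suc)))
product-zero {suc n} {f} (suc i) fi≡0 = trans (cong (f zero ℚ.*_) (product-zero i fi≡0)) (ℚ.*-zeroʳ (f zero))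

adjacency : ∀ {n} → Graph n → Kernel n
adjacency G i j = indicator (i ~? j)
  where open Graph G

adjacency-nonNeg : ∀ {n} (G : Graph n) i j → 0ℚ ℚ.≤ adjacency G i j
adjacency-nonNeg G i j = indicator-nonNeg (Graph._~?_ G i j)

adjacency-sym : ∀ {n} (G : Graph n) i j → adjacency G i j ≡ adjacency G j i
adjacency-sym G i j = cong (if_then 1ℚ else 0ℚ) (does-⇔ (mk⇔ ~-sym ~-sym) (i ~? j) (j ~? i))
  where open Graph G

module _ {m n} (H : Graph m) (G : Graph n) where
  open Graph G

  sub-hom-intro : ∀ (φ : Fin m → Fin n) (ψ : Fin (∣E∣ H) → Fin n) →
    (∀ k → φ (endpoint₁ H k) ~ ψ k × φ (endpoint₂ H k) ~ ψ k) → IsHom (sub H) G (φ ++ ψ)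
  sub-hom-intro φ ψ h u v u~v with splitAt m u | splitAt m v
  ... | inj₁ i | inj₂ k = meet u~v
    where
    meet : i ≡ endpoint₁ H k ⊎ i ≡ endpoint₂ H k → φ i ~ ψ k
    meet (inj₁ refl) = proj₁ (h k)
    meet (inj₂ refl) = proj₂ (h k)
  ... | inj₂ k | inj₁ i = ~-sym (meet u~v)
    where
    meet : i ≡ endpoint₁ H k ⊎ i ≡ endpoint₂ H k → φ i ~ ψ k
    meet (inj₁ refl) = proj₁ (h k)
    meet (inj₂ refl) = proj₂ (h k)

  private
    weight : (Fin m → Fin n) → (Fin (∣E∣ H) → Fin n) → Fin (∣E∣ H) → ℚ
    weight φ ψ k = adjacency G (φ (endpoint₁ H k)) (ψ k) ℚ.* adjacency G (φ (endpoint₂ H k)) (ψ k)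

    weight-nonNeg : ∀ φ ψ k → 0ℚ ℚ.≤ weight φ ψ k
    weight-nonNeg φ ψ k = *-nonNeg (adjacency-nonNeg G (φ (endpoint₁ H k)) (ψ k))
                                   (adjacency-nonNeg G (φ (endpoint₂ H k)) (ψ k))

    weight-≤1 : ∀ φ ψ k → weight φ ψ k ℚ.≤ 1ℚ
    weight-≤1 φ ψ k = *-mono-≤ (adjacency-nonNeg G (φ (endpoint₂ H k)) (ψ k)) 0≤1
      (indicator-≤1 (φ (endpoint₁ H k) ~? ψ k)) (indicator-≤1 (φ (endpoint₂ H k) ~? ψ k))

    weight-zero : ∀ φ ψ k → ¬ (φ (endpoint₁ H k) ~ ψ k × φ (endpoint₂ H k) ~ ψ k) → weight φ ψ k ≡ 0ℚ
    weight-zero φ ψ k ¬h with φ (endpoint₁ H k) ~? ψ k | φ (endpoint₂ H k) ~? ψ k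
    ... | yes h₁ | yes h₂ = contradiction (h₁ , h₂) ¬h
    ... | yes _  | no _   = refl
    ... | no _   | yes _  = refl
    ... | no _   | no _   = refl

    product-weight≤ : ∀ φ ψ → product (weight φ ψ) ℚ.≤ indicator (isHom? (sub H) G (φ ++ ψ))
    product-weight≤ φ ψ = go (isHom? (sub H) G (φ ++ ψ))
      where
      go : (h? : Dec (IsHom (sub H) G (φ ++ ψ))) → product (weight φ ψ) ℚ.≤ indicator h?
      go (yes _) = product-≤1 (weight-nonNeg φ ψ) (weight-≤1 φ ψ)
      go (no ¬h) =
        let k , ¬hk = Fin.¬∀⟶∃¬ (∣E∣ H) _
              (λ k → (φ (endpoint₁ H k) ~? ψ k) ×-dec (φ (endpoint₂ H k) ~? ψ k))
              (¬h ∘ sub-hom-intro φ ψ)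
        in ℚ.≤-reflexive (product-zero k (weight-zero φ ψ k ¬hk))

  -- Expanding the product of codegrees chooses an image `ψ k` for every midpoint. The resulting
  -- product of adjacencies lies between 0 and 1, and it has a zero factor whenever `φ ++ ψ` is not
  -- a homomorphism.
  hom-sub-≥ : (sumMaps m λ φ → product λ k → codegree (adjacency G) (φ (endpoint₁ H k)) (φ (endpoint₂ H k)))
              ℚ.≤ grid 0 (hom (sub H) G)
  hom-sub-≥ = begin
    (sumMaps m λ φ → product λ k → codegree (adjacency G) (φ (endpoint₁ H k)) (φ (endpoint₂ H k)))
      ≡⟨ sumMaps-cong m (λ φ → sumMaps-product (∣E∣ H) λ k z →
           adjacency G (φ (endpoint₁ H k)) z ℚ.* adjacency G (φ (endpoint₂ H k)) z) ⟨
    (sumMaps m λ φ → sumMaps (∣E∣ H) λ ψ → product (weight φ ψ))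
      ≤⟨ PositiveFunctional.mono (mapsFunctional m n) (λ φ →
           PositiveFunctional.mono (mapsFunctional (∣E∣ H) n) λ ψ → product-weight≤ φ ψ) ⟩
    (sumMaps m λ φ → sumMaps (∣E∣ H) λ ψ → indicator (isHom? (sub H) G (φ ++ ψ)))
      ≡⟨ sumMaps-++ m (∣E∣ H) (λ f → indicator (isHom? (sub H) G f)) (isHom-extensional (sub H) G) ⟨
    (sumMaps (m ℕ.+ ∣E∣ H) λ f → indicator (isHom? (sub H) G f))
      ≡⟨ hom≡sumMaps (sub H) G ⟨
    grid 0 (hom (sub H) G) ∎
    where open ℚ.≤-Reasoning

weightedHom≤hom : ∀ a b {n} (G : Graph n) →
  weightedHom a b (codegree (adjacency G)) ℚ.≤ grid 0 (hom (sub (completeBipartite a b)) G)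
weightedHom≤hom a b {n} G = ℚ.≤-trans (ℚ.≤-reflexive (sym expand)) (hom-sub-≥ K G)
  where
  open ≡-Reasoning
  K : Graph (a ℕ.+ b)
  K = completeBipartite a b
  B : Kernel n
  B = codegree (adjacency G)
  expand : (sumMaps (a ℕ.+ b) λ φ → product λ k → B (φ (endpoint₁ K k)) (φ (endpoint₂ K k))) ≡
           weightedHom a b B
  expand = begin
    (sumMaps (a ℕ.+ b) λ φ → product λ k → B (φ (endpoint₁ K k)) (φ (endpoint₂ K k)))
      ≡⟨ sumMaps-cong (a ℕ.+ b) (λ φ → ∑ˡ-edges-completeBipartite ℚ.*-1-commutativeMonoid a b
           λ (u , v) → B (φ u) (φ v)) ⟩
    (sumMaps (a ℕ.+ b) λ φ → product λ i → product λ j → B (φ (i ↑ˡ b)) (φ (a ↑ʳ j)))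
      ≡⟨ sumMaps-++ a b (λ φ → product λ i → product λ j → B (φ (i ↑ˡ b)) (φ (a ↑ʳ j)))
           (λ f≗g → product-cong λ i → product-cong λ j → cong₂ B (f≗g (i ↑ˡ b)) (f≗g (a ↑ʳ j))) ⟩
    (sumMaps a λ x → sumMaps b λ y → product λ i → product λ j → B ((x ++ y) (i ↑ˡ b)) ((x ++ y) (a ↑ʳ j)))
      ≡⟨ sumMaps-cong a (λ x → sumMaps-cong b λ y → product-cong λ i → product-cong λ j →
           cong₂ B (lookup-++ˡ x y i) (lookup-++ʳ x y j)) ⟩
    weightedHom a b B ∎

-- Order on ℝ

0<½* : ∀ {ε} → 0ℚ ℚ.< ε → 0ℚ ℚ.< ½ ℚ.* ε
0<½* = *-pos (ℚ.positive⁻¹ ½)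

divide : ∀ {K ε} → 0ℚ ℚ.< K → 0ℚ ℚ.< ε → ∃[ δ ] 0ℚ ℚ.< δ × δ ℚ.* K ≡ ε
divide {K} {ε} 0<K 0<ε = ε ℚ.* 1/K ,
  *-pos 0<ε (ℚ.positive⁻¹ 1/K {{ℚ.1/pos⇒pos K {{ℚ.positive 0<K}}}}) ,
  trans (ℚ.*-assoc ε 1/K K)
    (trans (cong (ε ℚ.*_) (ℚ.*-inverseˡ K {{ℚ.>-nonZero 0<K}})) (ℚ.*-identityʳ ε))
  where
  1/K : ℚ
  1/K = (ℚ.1/ K) {{ℚ.>-nonZero 0<K}}

≤-+ε : ∀ {p q ε} → 0ℚ ℚ.< ε → p ℚ.≤ q → p ℚ.≤ q ℚ.+ ε
≤-+ε {p} {q} {ε} 0<ε p≤q = ℚ.≤-trans p≤q (≤-from-gap ε (ℚ.<⇒≤ 0<ε) refl)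

≤ᵣ-pointwise : ∀ x y → (∀ n → seq x n ℚ.≤ seq y n) → x ≤ᵣ y
≤ᵣ-pointwise x y h ε 0<ε = 0 , λ n _ → ≤-+ε 0<ε (h n)

≤ᵣ-trans : ∀ x y z → x ≤ᵣ y → y ≤ᵣ z → x ≤ᵣ z
≤ᵣ-trans x y z x≤y y≤z ε 0<ε =
  let N₁ , h₁ = x≤y (½ ℚ.* ε) (0<½* 0<ε)
      N₂ , h₂ = y≤z (½ ℚ.* ε) (0<½* 0<ε)
  in N₁ ℕ.⊔ N₂ , λ n N≤n → begin
    seq x n                               ≤⟨ h₁ n (ℕ.m⊔n≤o⇒m≤o N₁ N₂ N≤n) ⟩
    seq y n ℚ.+ ½ ℚ.* ε                   ≤⟨ ℚ.+-monoˡ-≤ (½ ℚ.* ε) (h₂ n (ℕ.m⊔n≤o⇒n≤o N₁ N₂ N≤n)) ⟩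
    seq z n ℚ.+ ½ ℚ.* ε ℚ.+ ½ ℚ.* ε       ≡⟨ ℚ.+-assoc (seq z n) (½ ℚ.* ε) (½ ℚ.* ε) ⟩
    seq z n ℚ.+ (½ ℚ.* ε ℚ.+ ½ ℚ.* ε)     ≡⟨ cong (seq z n ℚ.+_) (half+half ε) ⟩
    seq z n ℚ.+ ε                         ∎
  where open ℚ.≤-Reasoning

+ᵣ-mono-≤ : ∀ x y z w → x ≤ᵣ y → z ≤ᵣ w → x +ᵣ z ≤ᵣ y +ᵣ w
+ᵣ-mono-≤ x y z w x≤y z≤w ε 0<ε =
  let N₁ , h₁ = x≤y (½ ℚ.* ε) (0<½* 0<ε)
      N₂ , h₂ = z≤w (½ ℚ.* ε) (0<½* 0<ε)
  in N₁ ℕ.⊔ N₂ , λ n N≤n → begin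
    seq x n ℚ.+ seq z n
      ≤⟨ ℚ.+-mono-≤ (h₁ n (ℕ.m⊔n≤o⇒m≤o N₁ N₂ N≤n)) (h₂ n (ℕ.m⊔n≤o⇒n≤o N₁ N₂ N≤n)) ⟩
    seq y n ℚ.+ ½ ℚ.* ε ℚ.+ (seq w n ℚ.+ ½ ℚ.* ε)
      ≡⟨ solve 3 (λ y w e → y :+ e :+ (w :+ e) := y :+ w :+ (e :+ e)) refl (seq y n) (seq w n) (½ ℚ.* ε) ⟩
    seq y n ℚ.+ seq w n ℚ.+ (½ ℚ.* ε ℚ.+ ½ ℚ.* ε)
      ≡⟨ cong (seq y n ℚ.+ seq w n ℚ.+_) (half+half ε) ⟩
    seq y n ℚ.+ seq w n ℚ.+ ε ∎
  where
  open ℚ.≤-Reasoning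
  open +-*-Solver

Σᵣ-mono-≤ : ∀ {n} (v w : Vector ℝ n) → (∀ i → v i ≤ᵣ w i) → Σᵣ v ≤ᵣ Σᵣ w
Σᵣ-mono-≤ {zero}  v w v≤w = ≤ᵣ-pointwise 0ᵣ 0ᵣ λ _ → ℚ.≤-refl
Σᵣ-mono-≤ {suc n} v w v≤w = +ᵣ-mono-≤ (v zero) (w zero) (Σᵣ (v ∘ suc)) (Σᵣ (w ∘ suc))
  (v≤w zero) (Σᵣ-mono-≤ (v ∘ suc) (w ∘ suc) (v≤w ∘ suc))

*ᵣ-monoʳ-≤ : ∀ x y z → (∀ n → 0ℚ ℚ.≤ seq z n) → x ≤ᵣ y → x *ᵣ z ≤ᵣ y *ᵣ z
*ᵣ-monoʳ-≤ x y z 0≤z x≤y ε 0<ε =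
  let K , 0<K , N₁ , z≤K = eventuallyBounded z
      δ , 0<δ , δK≡ε     = divide 0<K 0<ε
      N₂ , h             = x≤y δ 0<δ
  in N₁ ℕ.⊔ N₂ , λ n N≤n → begin
    seq x n ℚ.* seq z n
      ≤⟨ *-monoʳ-≤ (0≤z n) (h n (ℕ.m⊔n≤o⇒n≤o N₁ N₂ N≤n)) ⟩
    (seq y n ℚ.+ δ) ℚ.* seq z n
      ≡⟨ ℚ.*-distribʳ-+ (seq z n) (seq y n) δ ⟩
    seq y n ℚ.* seq z n ℚ.+ δ ℚ.* seq z n
      ≤⟨ ℚ.+-monoʳ-≤ (seq y n ℚ.* seq z n) (*-monoˡ-≤ (ℚ.<⇒≤ 0<δ)
           (ℚ.≤-trans (p≤∣p∣ (seq z n)) (z≤K n (ℕ.m⊔n≤o⇒m≤o N₁ N₂ N≤n)))) ⟩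
    seq y n ℚ.* seq z n ℚ.+ δ ℚ.* K
      ≡⟨ cong (seq y n ℚ.* seq z n ℚ.+_) δK≡ε ⟩
    seq y n ℚ.* seq z n ℚ.+ ε ∎
  where open ℚ.≤-Reasoning

-- The order on the reals is not decidable, but this overlapping alternative is settled by a single
-- rational comparison. Let z = x - y, δ = ε/4, and let N be a Cauchy index of z for δ: if z_N ≤ 2δ
-- then z ≤ 3δ ≤ ε from N on, and otherwise z ≥ δ from N on.
locate : ∀ x y ε → 0ℚ ℚ.< ε →
  (∃[ N ] (∀ n → N ℕ.≤ n → seq x n ℚ.≤ seq y n ℚ.+ ε)) ⊎
  (∃[ c ] 0ℚ ℚ.< c × ∃[ N ] (∀ n → N ℕ.≤ n → seq y n ℚ.+ c ℚ.≤ seq x n))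
locate x y ε 0<ε = decide (seq z N ℚ.≤? δ ℚ.+ δ)
  where
  open +-*-Solver
  z : ℝ
  z = x +ᵣ fromℚ (ℚ.- 1ℚ) *ᵣ y
  δ : ℚ
  δ = ½ ℚ.* (½ ℚ.* ε)
  0<δ : 0ℚ ℚ.< δ
  0<δ = 0<½* (0<½* 0<ε)
  N : ℕ
  N = proj₁ (cauchy z δ 0<δ)
  close : ∀ m n → N ℕ.≤ m → N ℕ.≤ n → seq z m ℚ.≤ seq z n ℚ.+ δ
  close m n N≤m N≤n = ∣-∣≤-elim (proj₂ (cauchy z δ 0<δ) m n N≤m N≤n)
  restore : ∀ n → seq y n ℚ.+ seq z n ≡ seq x n
  restore n = solve 2 (λ x y → y :+ (x :+ con (ℚ.- 1ℚ) :* y) := x) refl (seq x n) (seq y n)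
  4δ : δ ℚ.+ δ ℚ.+ δ ℚ.+ δ ≡ ε
  4δ = trans (ℚ.+-assoc (δ ℚ.+ δ) δ δ)
    (trans (cong₂ ℚ._+_ (half+half (½ ℚ.* ε)) (half+half (½ ℚ.* ε))) (half+half ε))
  decide : Dec (seq z N ℚ.≤ δ ℚ.+ δ) → _
  decide (yes zN≤2δ) = inj₁ (N , λ n N≤n → subst₂ ℚ._≤_ (restore n) refl
    (ℚ.+-monoʳ-≤ (seq y n) (ℚ.≤-trans (close n N N≤n ℕ.≤-refl)
      (ℚ.≤-trans (ℚ.+-monoˡ-≤ δ zN≤2δ) (≤-from-gap δ (ℚ.<⇒≤ 0<δ) 4δ)))))
  decide (no zN≰2δ) = inj₂ (δ , 0<δ , N , λ n N≤n → subst (seq y n ℚ.+ δ ℚ.≤_) (restore n)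
    (ℚ.+-monoʳ-≤ (seq y n) (+-cancelˡ-≤ δ (ℚ.≤-trans (ℚ.<⇒≤ (ℚ.≰⇒> zN≰2δ))
      (subst (seq z N ℚ.≤_) (ℚ.+-comm (seq z n) δ) (close N n ℕ.≤-refl N≤n))))))

separated⇒≰ : ∀ x y {c} → 0ℚ ℚ.< c → ∃[ N ] (∀ n → N ℕ.≤ n → seq y n ℚ.+ c ℚ.≤ seq x n) → ¬ x ≤ᵣ y
separated⇒≰ x y {c} 0<c (N₁ , h₁) x≤y =
  let N₂ , h₂ = x≤y (½ ℚ.* c) (0<½* 0<c)
      n       = N₁ ℕ.⊔ N₂
      c≤c/2   = +-cancelˡ-≤ (seq y n) (ℚ.≤-trans (h₁ n (ℕ.m≤m⊔n N₁ N₂)) (h₂ n (ℕ.m≤n⊔m N₁ N₂)))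
      c/2≤0   = +-cancelˡ-≤ (½ ℚ.* c) (subst₂ ℚ._≤_ (sym (half+half c)) (sym (ℚ.+-identityʳ (½ ℚ.* c))) c≤c/2)
  in contradiction (ℚ.<-≤-trans (0<½* 0<c) c/2≤0) (ℚ.<-irrefl refl)

-- For each ε, `locate` gives either the required bound or a positive gap, and a gap refutes x ≤ y.
≤ᵣ-stable : ∀ x y → ¬ ¬ x ≤ᵣ y → x ≤ᵣ y
≤ᵣ-stable x y ¬¬x≤y ε 0<ε with locate x y ε 0<ε
... | inj₁ h             = h
... | inj₂ (c , 0<c , h) = contradiction (separated⇒≰ x y 0<c h) ¬¬x≤y

*ᵣ-cancelʳ-≤ : ∀ x y z {c} → 0ℚ ℚ.< c → ∃[ N ] (∀ n → N ℕ.≤ n → c ℚ.≤ seq z n) →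
               x *ᵣ z ≤ᵣ y *ᵣ z → x ≤ᵣ y
*ᵣ-cancelʳ-≤ x y z {c} 0<c (N₁ , c≤z) xz≤yz ε 0<ε =
  let N₂ , h = xz≤yz (ε ℚ.* c) (*-pos 0<ε 0<c)
  in N₁ ℕ.⊔ N₂ , λ n N≤n →
    let c≤zₙ = c≤z n (ℕ.m⊔n≤o⇒m≤o N₁ N₂ N≤n) in
    ℚ.*-cancelʳ-≤-pos (seq z n) {{ℚ.positive (ℚ.<-≤-trans 0<c c≤zₙ)}} (begin
      seq x n ℚ.* seq z n                     ≤⟨ h n (ℕ.m⊔n≤o⇒n≤o N₁ N₂ N≤n) ⟩
      seq y n ℚ.* seq z n ℚ.+ ε ℚ.* c         ≤⟨ ℚ.+-monoʳ-≤ (seq y n ℚ.* seq z n) (*-monoˡ-≤ (ℚ.<⇒≤ 0<ε) c≤zₙ) ⟩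
      seq y n ℚ.* seq z n ℚ.+ ε ℚ.* seq z n   ≡⟨ ℚ.*-distribʳ-+ (seq z n) (seq y n) ε ⟨
      (seq y n ℚ.+ ε) ℚ.* seq z n             ∎)
  where open ℚ.≤-Reasoning

seq-^ᵣ : ∀ x k n → seq (x ^ᵣ k) n ≡ seq x n ↑ k
seq-^ᵣ x zero    n = refl
seq-^ᵣ x (suc k) n = cong (seq x n ℚ.*_) (seq-^ᵣ x k n)

seq-Σᵣ : ∀ {m} (v : Vector ℝ m) n → seq (Σᵣ v) n ≡ sum λ i → seq (v i) n
seq-Σᵣ {zero}  v n = refl
seq-Σᵣ {suc m} v n = cong (seq (v zero) n ℚ.+_) (seq-Σᵣ (v ∘ suc) n)

-- Reals all of whose approximations are nonnegative

record ℝ⁺ : Set where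
  constructor mkℝ⁺
  field
    real : ℝ
    0≤at : ∀ n → 0ℚ ℚ.≤ seq real n

  at : ℕ → ℚ
  at = seq real

open ℝ⁺

infix 4 _≼_ _≈_

-- Unlike real x ≤ᵣ real y, the record types _≼_ and _≈_ determine x and y.
record _≼_ (x y : ℝ⁺) : Set where
  constructor mk≼
  field un≼ : real x ≤ᵣ real y

record _≈_ (x y : ℝ⁺) : Set where
  constructor mk≈
  field
    ≈⇒≼ : x ≼ y
    ≈⇒≽ : y ≼ x

open _≼_
open _≈_

≼-at : ∀ {x y} → (∀ n → at x n ℚ.≤ at y n) → x ≼ y
≼-at {x} {y} h = mk≼ (≤ᵣ-pointwise (real x) (real y) h)

≈-at : ∀ {x y} → (∀ n → at x n ≡ at y n) → x ≈ y
≈-at h = mk≈ (≼-at λ n → ℚ.≤-reflexive (h n)) (≼-at λ n → ℚ.≤-reflexive (sym (h n)))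

≼-trans : ∀ {x y z} → x ≼ y → y ≼ z → x ≼ z
≼-trans {x} {y} {z} (mk≼ h) (mk≼ k) = mk≼ (≤ᵣ-trans (real x) (real y) (real z) h k)

≼-poset : Poset 0ℓ 0ℓ 0ℓ
≼-poset = record
  { Carrier        = ℝ⁺
  ; _≈_            = _≈_
  ; _≤_            = _≼_
  ; isPartialOrder = record
    { isPreorder = record
      { isEquivalence = record
        { refl  = ≈-at λ _ → refl
        ; sym   = λ (mk≈ h k) → mk≈ k h
        ; trans = λ (mk≈ h k) (mk≈ h′ k′) → mk≈ (≼-trans h h′) (≼-trans k′ k)
        }
      ; reflexive = ≈⇒≼
      ; trans     = ≼-trans
      }
    ; antisym = mk≈
    }
  }

open Poset ≼-poset using () renaming (module Eq to ≈)

infixl 7 _⊗_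
infixr 8 _^⁺_

_⊗_ : ℝ⁺ → ℝ⁺ → ℝ⁺
x ⊗ y = mkℝ⁺ (real x *ᵣ real y) λ n → *-nonNeg (0≤at x n) (0≤at y n)

_^⁺_ : ℝ⁺ → ℕ → ℝ⁺
x ^⁺ k = mkℝ⁺ (real x ^ᵣ k) λ n →
  subst (0ℚ ℚ.≤_) (sym (seq-^ᵣ (real x) k n)) (^-nonNeg k (0≤at x n))

∑⁺ : ∀ {n} → Vector ℝ⁺ n → ℝ⁺
∑⁺ v = mkℝ⁺ (Σᵣ (real ∘ v)) λ n →
  subst (0ℚ ℚ.≤_) (sym (seq-Σᵣ (real ∘ v) n))
    (PositiveFunctional.nonNeg (sumFunctional _) λ i → 0≤at (v i) n)

∣_∣⁺ : ℝ → ℝ⁺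
∣ x ∣⁺ = mkℝ⁺ ∣ x ∣ᵣ λ n → ℚ.0≤∣p∣ (seq x n)

fromℕ⁺ : ℕ → ℝ⁺
fromℕ⁺ k = mkℝ⁺ (fromℕ k) λ _ → grid-nonNeg 0 k

root⁺ : (k : ℕ) .{{_ : ℕ.NonZero k}} → ℝ⁺ → ℝ⁺
root⁺ (suc k) x = mkℝ⁺ (root (suc k) (real x)) λ n → rootℚ-nonNeg (suc k) n (at x n)

_^ℚ⁺_ : ℝ⁺ → ℚ → ℝ⁺
x ^ℚ⁺ p = root⁺ (↧ₙ p) (x ^⁺ ℤ.∣ ↥ p ∣)

at-^ : ∀ x k n → at (x ^⁺ k) n ≡ at x n ↑ k
at-^ x = seq-^ᵣ (real x)

at-∑ : ∀ {m} (v : Vector ℝ⁺ m) n → at (∑⁺ v) n ≡ sum λ i → at (v i) n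
at-∑ v = seq-Σᵣ (real ∘ v)

⊗-comm : ∀ x y → x ⊗ y ≈ y ⊗ x
⊗-comm x y = ≈-at λ n → ℚ.*-comm (at x n) (at y n)

⊗-monoʳ : ∀ {x y} z → x ≼ y → x ⊗ z ≼ y ⊗ z
⊗-monoʳ {x} {y} z (mk≼ h) = mk≼ (*ᵣ-monoʳ-≤ (real x) (real y) (real z) (0≤at z) h)

⊗-mono : ∀ {x y z w} → x ≼ y → z ≼ w → x ⊗ z ≼ y ⊗ w
⊗-mono {x} {y} {z} {w} x≼y z≼w = ≼-trans (⊗-monoʳ z x≼y) (≼-trans (≈⇒≼ (⊗-comm y z))
  (≼-trans (⊗-monoʳ y z≼w) (≈⇒≼ (⊗-comm w y))))

⊗-cong : ∀ {x y z w} → x ≈ y → z ≈ w → x ⊗ z ≈ y ⊗ w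
⊗-cong (mk≈ h k) (mk≈ h′ k′) = mk≈ (⊗-mono h h′) (⊗-mono k k′)

⊗-monoˡ : ∀ x {y z} → y ≼ z → x ⊗ y ≼ x ⊗ z
⊗-monoˡ x y≼z = ⊗-mono {x} (≈⇒≼ ≈.refl) y≼z

⊗-congˡ : ∀ x {y z} → y ≈ z → x ⊗ y ≈ x ⊗ z
⊗-congˡ x (mk≈ h k) = mk≈ (⊗-monoˡ x h) (⊗-monoˡ x k)

^⁺-mono : ∀ {x y} k → x ≼ y → x ^⁺ k ≼ y ^⁺ k
^⁺-mono zero    x≼y = ≼-at λ _ → ℚ.≤-refl
^⁺-mono {x} {y} (suc k) x≼y = mk≼ (un≼ (⊗-mono x≼y (^⁺-mono {x} {y} k x≼y)))

^⁺-cong : ∀ {x y} k → x ≈ y → x ^⁺ k ≈ y ^⁺ k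
^⁺-cong k (mk≈ h h′) = mk≈ (^⁺-mono k h) (^⁺-mono k h′)

∑⁺-mono : ∀ {n} {v w : Vector ℝ⁺ n} → (∀ i → v i ≼ w i) → ∑⁺ v ≼ ∑⁺ w
∑⁺-mono {v = v} {w} v≼w = mk≼ (Σᵣ-mono-≤ (real ∘ v) (real ∘ w) (un≼ ∘ v≼w))

∑⁺-cong : ∀ {n} {v w : Vector ℝ⁺ n} → (∀ i → v i ≈ w i) → ∑⁺ v ≈ ∑⁺ w
∑⁺-cong v≈w = mk≈ (∑⁺-mono (≈⇒≼ ∘ v≈w)) (∑⁺-mono (≈⇒≽ ∘ v≈w))

^⁺-+ : ∀ x j k → x ^⁺ (j ℕ.+ k) ≈ x ^⁺ j ⊗ x ^⁺ k
^⁺-+ x j k = ≈-at λ n → trans (at-^ x (j ℕ.+ k) n)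
  (trans (↑-+ (at x n) j k) (sym (cong₂ ℚ._*_ (at-^ x j n) (at-^ x k n))))

^⁺-* : ∀ x j k → (x ^⁺ j) ^⁺ k ≈ x ^⁺ (j ℕ.* k)
^⁺-* x j k = ≈-at λ n → trans (at-^ (x ^⁺ j) k n) (trans (cong (_↑ k) (at-^ x j n))
  (trans (↑-* (at x n) j k) (sym (at-^ x (j ℕ.* k) n))))

^⁺-^⁺-comm : ∀ x j k → (x ^⁺ j) ^⁺ k ≈ (x ^⁺ k) ^⁺ j
^⁺-^⁺-comm x j k = ≈.trans (^⁺-* x j k)
  (≈.trans (≈.reflexive (cong (x ^⁺_) (ℕ.*-comm j k))) (≈.sym (^⁺-* x k j)))

⊗-^⁺ : ∀ x y k → (x ⊗ y) ^⁺ k ≈ x ^⁺ k ⊗ y ^⁺ k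
⊗-^⁺ x y k = ≈-at λ n → trans (at-^ (x ⊗ y) k n) (trans (↑-distrib-* (at x n) (at y n) k)
  (sym (cong₂ ℚ._*_ (at-^ x k n) (at-^ y k n))))

-- By superadditivity y^k + ε^k ≤ (y + ε)^k, so a tolerance ε^k between the powers becomes ε between
-- the bases.
^⁺-cancel-≼ : ∀ {x y} k .{{_ : ℕ.NonZero k}} → x ^⁺ k ≼ y ^⁺ k → x ≼ y
^⁺-cancel-≼ {x} {y} (suc k) (mk≼ xᵏ≤yᵏ) = mk≼ λ ε 0<ε →
  let N , h = xᵏ≤yᵏ (ε ↑ suc k) (^-pos (suc k) 0<ε)
  in N , λ n N≤n → ^-cancel-≤ k (+-nonNeg (0≤at y n) (ℚ.<⇒≤ 0<ε))
    (ℚ.≤-trans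
      (subst₂ (λ u v → u ℚ.≤ v ℚ.+ ε ↑ suc k) (at-^ x (suc k) n) (at-^ y (suc k) n) (h n N≤n))
      (^-superadditive k (0≤at y n) (ℚ.<⇒≤ 0<ε)))

^⁺-cancel-≈ : ∀ {x y} k .{{_ : ℕ.NonZero k}} → x ^⁺ k ≈ y ^⁺ k → x ≈ y
^⁺-cancel-≈ k (mk≈ h h′) = mk≈ (^⁺-cancel-≼ k h) (^⁺-cancel-≼ k h′)

-- x may be 0, and this cannot be decided. Each approximation is compared with δ = min(ε, 1)
-- instead: if it is at most δ, then x^k ≤ δ ≤ ε since k ≥ 1 and δ ≤ 1; otherwise division by x^m ≥
-- δ^m turns the tolerance ε δ^m into at most ε.
^⁺-cancelʳ-≼ : ∀ x y k m .{{_ : ℕ.NonZero k}} → x ^⁺ k ⊗ x ^⁺ m ≼ y ⊗ x ^⁺ m → x ^⁺ k ≼ y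
^⁺-cancelʳ-≼ x y (suc k) m (mk≼ h) = mk≼ λ ε 0<ε →
  let δ      = ε ℚ.⊓ 1ℚ
      0<δ    = ⊓-pos 0<ε
      N , h′ = h (ε ℚ.* δ ↑ m) (*-pos 0<ε (^-pos m 0<δ))
  in N , λ n N≤n → subst (ℚ._≤ at y n ℚ.+ ε) (sym (at-^ x (suc k) n))
    (cases ε 0<ε n (ℚ.≤-total (at x n) δ)
      (subst₂ (λ u v → u ℚ.* v ℚ.≤ at y n ℚ.* v ℚ.+ ε ℚ.* δ ↑ m) (at-^ x (suc k) n) (at-^ x m n) (h′ n N≤n)))
  where
  ⊓-pos : ∀ {ε} → 0ℚ ℚ.< ε → 0ℚ ℚ.< ε ℚ.⊓ 1ℚ
  ⊓-pos {ε} 0<ε with ℚ.⊓-sel ε 1ℚ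
  ... | inj₁ eq = subst (0ℚ ℚ.<_) (sym eq) 0<ε
  ... | inj₂ eq = subst (0ℚ ℚ.<_) (sym eq) 0<1

  cases : ∀ ε (0<ε : 0ℚ ℚ.< ε) n → (let δ = ε ℚ.⊓ 1ℚ) → at x n ℚ.≤ δ ⊎ δ ℚ.≤ at x n →
          at x n ↑ suc k ℚ.* at x n ↑ m ℚ.≤ at y n ℚ.* at x n ↑ m ℚ.+ ε ℚ.* δ ↑ m →
          at x n ↑ suc k ℚ.≤ at y n ℚ.+ ε
  cases ε 0<ε n (inj₁ x≤δ) _ = begin
    at x n ↑ suc k     ≤⟨ ^-mono-≤ (suc k) (0≤at x n) x≤δ ⟩
    δ ℚ.* δ ↑ k        ≤⟨ *-monoˡ-≤ (ℚ.<⇒≤ (⊓-pos 0<ε)) (^-mono-≤ k (ℚ.<⇒≤ (⊓-pos 0<ε)) (ℚ.p⊓q≤q ε 1ℚ)) ⟩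
    δ ℚ.* 1ℚ ↑ k       ≡⟨ cong (δ ℚ.*_) (1↑ k) ⟩
    δ ℚ.* 1ℚ           ≡⟨ ℚ.*-identityʳ δ ⟩
    δ                  ≤⟨ ℚ.p⊓q≤p ε 1ℚ ⟩
    ε                  ≡⟨ ℚ.+-identityˡ ε ⟨
    0ℚ ℚ.+ ε           ≤⟨ ℚ.+-monoˡ-≤ ε (0≤at y n) ⟩
    at y n ℚ.+ ε       ∎
    where
    open ℚ.≤-Reasoning
    δ : ℚ
    δ = ε ℚ.⊓ 1ℚ
  cases ε 0<ε n (inj₂ δ≤x) h = ℚ.*-cancelʳ-≤-pos (at x n ↑ m)
    {{ℚ.positive (^-pos m (ℚ.<-≤-trans (⊓-pos 0<ε) δ≤x))}}
    (ℚ.≤-trans h (ℚ.≤-trans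
      (ℚ.+-monoʳ-≤ (at y n ℚ.* at x n ↑ m) (*-monoˡ-≤ (ℚ.<⇒≤ 0<ε) (^-mono-≤ m (ℚ.<⇒≤ (⊓-pos 0<ε)) δ≤x)))
      (ℚ.≤-reflexive (sym (ℚ.*-distribʳ-+ (at x n ↑ m) (at y n) ε)))))

grid-cauchy : Cauchy λ n → grid n 1
grid-cauchy ε 0<ε =
  let N , h = grid-archimedean ε 0<ε
      le : ∀ m n → N ℕ.≤ m → grid m 1 ℚ.≤ grid n 1 ℚ.+ ε
      le = λ m n N≤m → ℚ.≤-trans (h m N≤m) (≤-from-gap (grid n 1) (grid-nonNeg n 1) (ℚ.+-comm ε (grid n 1)))
  in N , λ m n N≤m N≤n → ∣-∣≤-intro (le m n N≤m) (le n m N≤n)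

-- Roots are rounded down to multiples of 1/(n+1). The powers of the rounded values do not exceed x,
-- one further grid step makes them at least x, and the added sequence 1/(n+1) tends to 0.
root⁺-^⁺ : ∀ k .{{_ : ℕ.NonZero k}} x → root⁺ k x ^⁺ k ≈ x
root⁺-^⁺ (suc k) x = mk≈ (≼-at lower) (≼-trans (≼-at upper) (^⁺-mono (suc k) r⁺≼r))
  where
  r r⁺ : ℝ⁺
  r  = root⁺ (suc k) x
  r⁺ = mkℝ⁺ (real r +ᵣ mkℝ (λ n → grid n 1) grid-cauchy) λ n → +-nonNeg (0≤at r n) (grid-nonNeg n 1)

  lower : ∀ n → at (r ^⁺ suc k) n ℚ.≤ at x n
  lower n = subst (ℚ._≤ at x n) (sym (at-^ r (suc k) n))
    ([ (λ r≡0 → subst (ℚ._≤ at x n)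
          (sym (trans (cong (ℚ._* at r n ↑ k) r≡0) (ℚ.*-zeroˡ (at r n ↑ k)))) (0≤at x n))
     , (λ h → h) ]′ (rootℚ-lower (suc k) n (at x n)))

  upper : ∀ n → at x n ℚ.≤ at (r⁺ ^⁺ suc k) n
  upper n = subst (at x n ℚ.≤_) (sym (at-^ r⁺ (suc k) n)) (rootℚ-upper k n (at x n))

  r⁺≼r : r⁺ ≼ r
  r⁺≼r = mk≼ λ ε 0<ε →
    let N , h = grid-archimedean ε 0<ε
    in N , λ n N≤n → ℚ.+-monoʳ-≤ (at r n) (h n N≤n)

-- The hypothesis is p = m / d, cross-multiplied. Comparing `↧ₙ p`-th powers removes the root hidden
-- in `x ^ℚ⁺ p`.
^ℚ⁺-^⁺ : ∀ x p d m → ℤ.∣ ↥ p ∣ ℕ.* d ≡ m ℕ.* ↧ₙ p → (x ^ℚ⁺ p) ^⁺ d ≈ x ^⁺ m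
^ℚ⁺-^⁺ x p d m eq = ^⁺-cancel-≈ (↧ₙ p) (begin-equality
  ((x ^ℚ⁺ p) ^⁺ d) ^⁺ ↧ₙ p        ≈⟨ ^⁺-^⁺-comm (x ^ℚ⁺ p) d (↧ₙ p) ⟩
  ((x ^ℚ⁺ p) ^⁺ ↧ₙ p) ^⁺ d        ≈⟨ ^⁺-cong d (root⁺-^⁺ (↧ₙ p) (x ^⁺ ℤ.∣ ↥ p ∣)) ⟩
  (x ^⁺ ℤ.∣ ↥ p ∣) ^⁺ d           ≈⟨ ^⁺-* x ℤ.∣ ↥ p ∣ d ⟩
  x ^⁺ (ℤ.∣ ↥ p ∣ ℕ.* d)          ≡⟨ cong (x ^⁺_) eq ⟩
  x ^⁺ (m ℕ.* ↧ₙ p)               ≈⟨ ^⁺-* x m (↧ₙ p) ⟨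
  (x ^⁺ m) ^⁺ ↧ₙ p                ∎)
  where open import Relation.Binary.Reasoning.PartialOrder ≼-poset

-- Norms

reciprocal : ∀ p .{{_ : ℚ.NonZero p}} → ℤ.∣ ↥ (ℚ.1/ p) ∣ ≡ ↧ₙ p × ↧ₙ (ℚ.1/ p) ≡ ℤ.∣ ↥ p ∣
reciprocal (mkℚ ℤ.+[1+ _ ] _ _) = refl , refl
reciprocal (mkℚ ℤ.-[1+ _ ] _ _) = refl , refl

-- E = D / m, without subjecting the fraction to normalisation.
_HasRatio_/_ : Exponent → ℕ → ℕ → Set
E HasRatio D / m = ℤ.∣ ↥ value ∣ ℕ.* m ≡ D ℕ.* ↧ₙ value
  where open Exponent E

exponent-ratio : ∀ n d (0<d : 0 ℕ.< d) (d≤n : d ℕ.≤ n) → exponent n d 0<d d≤n HasRatio n / d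
exponent-ratio n (suc d) 0<d d≤n = cross (+ n ℚ./ suc d) (ℚ.toℚᵘ-fromℚᵘ (ℚᵘ.mkℚᵘ (+ n) d))
  where
  cross : ∀ p → ℚ.toℚᵘ p ℚᵘ.≃ ℚᵘ.mkℚᵘ (+ n) d → ℤ.∣ ↥ p ∣ ℕ.* suc d ≡ n ℕ.* ↧ₙ p
  cross (mkℚ i k _) (ℚᵘ.*≡* eq) = trans (sym (ℤ.abs-* i (+ suc d)))
    (trans (cong ℤ.∣_∣ eq) (ℤ.abs-* (+ n) (+ suc k)))

norm⁺ : ∀ {n} → Vector ℝ n → Exponent → ℝ⁺
norm⁺ x E = (∑⁺ λ i → ∣ x i ∣⁺ ^ℚ⁺ value) ^ℚ⁺ (ℚ.1/ value) {{nonZero}}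
  where open Exponent E

module _ {n} (x : Vector ℝ n) (E : Exponent) (D m : ℕ) .{{_ : ℕ.NonZero m}} (E≡D/m : E HasRatio D / m) where
  open Exponent E
  open import Relation.Binary.Reasoning.PartialOrder ≼-poset

  power-substitution : ∀ i → ∣ x i ∣⁺ ^ℚ⁺ value ≈ root⁺ m ∣ x i ∣⁺ ^⁺ D
  power-substitution i = ^⁺-cancel-≈ m (begin-equality
    (∣ x i ∣⁺ ^ℚ⁺ value) ^⁺ m         ≈⟨ ^ℚ⁺-^⁺ ∣ x i ∣⁺ value m D E≡D/m ⟩
    ∣ x i ∣⁺ ^⁺ D                     ≈⟨ ^⁺-cong D (root⁺-^⁺ m ∣ x i ∣⁺) ⟨
    (root⁺ m ∣ x i ∣⁺ ^⁺ m) ^⁺ D      ≈⟨ ^⁺-^⁺-comm (root⁺ m ∣ x i ∣⁺) m D ⟩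
    (root⁺ m ∣ x i ∣⁺ ^⁺ D) ^⁺ m      ∎)

  -- With E = D / m and ξ = |x|^(1/m), each |x i|^E is ξ_i^D and the outer root has exponent m / D.
  -- This expresses the norm by natural powers alone, as the rational inequality requires.
  norm-^⁺ : norm⁺ x E ^⁺ D ≈ (∑⁺ λ i → root⁺ m ∣ x i ∣⁺ ^⁺ D) ^⁺ m
  norm-^⁺ = ≈.trans
    (^ℚ⁺-^⁺ (∑⁺ λ i → ∣ x i ∣⁺ ^ℚ⁺ value) ((ℚ.1/ value) {{nonZero}}) D m inverted)
    (^⁺-cong m (∑⁺-cong power-substitution))
    where
    inverted : ℤ.∣ ↥ (ℚ.1/ value) {{nonZero}} ∣ ℕ.* D ≡ m ℕ.* ↧ₙ ((ℚ.1/ value) {{nonZero}})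
    inverted with num , den ← reciprocal value {{nonZero}} = trans (cong (ℕ._* D) num)
      (trans (ℕ.*-comm (↧ₙ value) D) (trans (sym E≡D/m)
        (trans (ℕ.*-comm ℤ.∣ ↥ value ∣ m) (cong (m ℕ.*_) (sym den)))))

  ∣∣≼norm : .{{_ : ℕ.NonZero D}} → ∀ i → ∣ x i ∣⁺ ≼ norm⁺ x E
  ∣∣≼norm i = ^⁺-cancel-≼ D (begin
    ∣ x i ∣⁺ ^⁺ D                           ≈⟨ ^⁺-cong D (root⁺-^⁺ m ∣ x i ∣⁺) ⟨
    (root⁺ m ∣ x i ∣⁺ ^⁺ m) ^⁺ D            ≈⟨ ^⁺-^⁺-comm (root⁺ m ∣ x i ∣⁺) m D ⟩
    (root⁺ m ∣ x i ∣⁺ ^⁺ D) ^⁺ m            ≤⟨ ^⁺-mono m (≼-at λ k → subst (at (root⁺ m ∣ x i ∣⁺ ^⁺ D) k ℚ.≤_)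
                                                (sym (at-∑ (λ i → root⁺ m ∣ x i ∣⁺ ^⁺ D) k))
                                                (term≤sum (λ i → 0≤at (root⁺ m ∣ x i ∣⁺ ^⁺ D) k) i)) ⟩
    (∑⁺ λ i → root⁺ m ∣ x i ∣⁺ ^⁺ D) ^⁺ m   ≈⟨ norm-^⁺ ⟨
    norm⁺ x E ^⁺ D                          ∎)
    where
    term≤sum : ∀ {n} {f : Vector ℚ n} → (∀ i → 0ℚ ℚ.≤ f i) → ∀ i → f i ℚ.≤ sum f
    term≤sum {suc n} {f} 0≤f zero = ≤-from-gap (sum (f ∘ suc))
      (PositiveFunctional.nonNeg (sumFunctional n) (0≤f ∘ suc)) refl
    term≤sum {suc n} {f} 0≤f (suc i) = ℚ.≤-trans (term≤sum (0≤f ∘ suc) i)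
      (≤-from-gap (f zero) (0≤f zero) (ℚ.+-comm (sum (f ∘ suc)) (f zero)))

-- That x is not 0 yields an entry bounded away from 0 only up to double negation, which suffices
-- for proving inequalities because _≤ᵣ_ is stable.
norm-positive : ∀ {n} (x : Vector ℝ n) {X : ℝ⁺} → (∀ i → ∣ x i ∣⁺ ≼ X) → ¬ (∀ i → x i ≃ᵣ 0ᵣ) →
  ∀ {Z : Set} → (∀ {c} → 0ℚ ℚ.< c → ∃[ N ] (∀ n → N ℕ.≤ n → c ℚ.≤ at X n) → Z) → ¬ ¬ Z
norm-positive x {X} ∣x∣≼X x≢0 use ¬Z = x≢0 λ i → vanish₁ i , vanish₂ i
  where
  -- If some |x i| were eventually at least c > 0, then X, being at least |x i| - c/2 eventually,
  -- would be at least c/2, and `use` would give Z. So without Z all entries vanish.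
  small : ∀ i ε → 0ℚ ℚ.< ε → ∃[ N ] (∀ n → N ℕ.≤ n → ℚ.∣ seq (x i) n ∣ ℚ.≤ 0ℚ ℚ.+ ε)
  small i ε 0<ε with locate ∣ x i ∣ᵣ 0ᵣ ε 0<ε
  ... | inj₁ h = h
  ... | inj₂ (c , 0<c , N₁ , h₁) = contradiction (use (0<½* 0<c) (N₁ ℕ.⊔ N₂ , bound)) ¬Z
    where
    N₂ : ℕ
    N₂ = proj₁ (un≼ (∣x∣≼X i) (½ ℚ.* c) (0<½* 0<c))
    bound : ∀ n → N₁ ℕ.⊔ N₂ ℕ.≤ n → ½ ℚ.* c ℚ.≤ at X n
    bound n N≤n = +-cancelˡ-≤ (½ ℚ.* c) (begin
      ½ ℚ.* c ℚ.+ ½ ℚ.* c   ≡⟨ half+half c ⟩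
      c                     ≡⟨ ℚ.+-identityˡ c ⟨
      0ℚ ℚ.+ c              ≤⟨ h₁ n (ℕ.m⊔n≤o⇒m≤o N₁ N₂ N≤n) ⟩
      ℚ.∣ seq (x i) n ∣     ≤⟨ proj₂ (un≼ (∣x∣≼X i) (½ ℚ.* c) (0<½* 0<c)) n (ℕ.m⊔n≤o⇒n≤o N₁ N₂ N≤n) ⟩
      at X n ℚ.+ ½ ℚ.* c    ≡⟨ ℚ.+-comm (at X n) (½ ℚ.* c) ⟩
      ½ ℚ.* c ℚ.+ at X n    ∎)
      where open ℚ.≤-Reasoning

  vanish₁ : ∀ i → x i ≤ᵣ 0ᵣ
  vanish₁ i ε 0<ε with N , h ← small i ε 0<ε = N , λ n N≤n → ℚ.≤-trans (p≤∣p∣ (seq (x i) n)) (h n N≤n)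

  vanish₂ : ∀ i → 0ᵣ ≤ᵣ x i
  vanish₂ i ε 0<ε with N , h ← small i ε 0<ε = N , λ n N≤n → +-cancelˡ-≤ (ℚ.- seq (x i) n) (begin
    ℚ.- seq (x i) n ℚ.+ 0ℚ                 ≡⟨ ℚ.+-identityʳ (ℚ.- seq (x i) n) ⟩
    ℚ.- seq (x i) n                        ≤⟨ p≤∣p∣ (ℚ.- seq (x i) n) ⟩
    ℚ.∣ ℚ.- seq (x i) n ∣                  ≡⟨ ℚ.∣-p∣≡∣p∣ (seq (x i) n) ⟩
    ℚ.∣ seq (x i) n ∣                      ≤⟨ h n N≤n ⟩
    0ℚ ℚ.+ ε                               ≡⟨ solve 2 (λ x e → con 0ℚ :+ e := :- x :+ (x :+ e)) refl (seq (x i) n) ε ⟩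
    ℚ.- seq (x i) n ℚ.+ (seq (x i) n ℚ.+ ε) ∎)
    where
    open ℚ.≤-Reasoning
    open +-*-Solver

-- The operator norm bound

∣sum∣≤sum∣∣ : ∀ {n} (f : Vector ℚ n) → ℚ.∣ sum f ∣ ℚ.≤ sum λ i → ℚ.∣ f i ∣
∣sum∣≤sum∣∣ {zero}  f = ℚ.≤-refl
∣sum∣≤sum∣∣ {suc n} f = ℚ.≤-trans (ℚ.∣p+q∣≤∣p∣+∣q∣ (f zero) (sum (f ∘ suc)))
  (ℚ.+-monoʳ-≤ ℚ.∣ f zero ∣ (∣sum∣≤sum∣∣ (f ∘ suc)))

seq-adjacency : ∀ {n} (G : Graph n) i j k → seq (adjacencyMatrix G i j) k ≡ adjacency G i j
seq-adjacency G i j k = go (does (Graph._~?_ G i j))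
  where
  go : ∀ c → seq (if c then 1ᵣ else 0ᵣ) k ≡ (if c then 1ℚ else 0ℚ)
  go true  = refl
  go false = refl

-- Here c stands for 2e - v, D for 2e and H for the homomorphism count. They are parameters tied by
-- equations because the two final applications write them differently; the exponents enter only
-- through the ratios D / c and D / v.
module OperatorNormBound {n} (G : Graph n) (c v D e H : ℕ)
  .{{_ : ℕ.NonZero c}} .{{_ : ℕ.NonZero v}} .{{D-nonZero : ℕ.NonZero D}} .{{_ : ℕ.NonZero e}}
  (c+v≡D : c ℕ.+ v ≡ D) (e+e≡D : e ℕ.+ e ≡ D)
  (rational-bound : ∀ {η ξ : Vector ℚ n} → (∀ i → 0ℚ ℚ.≤ η i) → (∀ i → 0ℚ ℚ.≤ ξ i) →
    form (adjacency G) (λ (i , j) → η i ↑ c ℚ.* ξ j ↑ c) ↑ D ℚ.≤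
    grid 0 H ℚ.* grid 0 H ℚ.* ((sum λ i → η i ↑ D) ℚ.* (sum λ i → ξ i ↑ D)) ↑ c) where

  private
    A : Matrix n
    A = adjacencyMatrix G

    A⁺ : Fin n → Fin n → ℝ⁺
    A⁺ i j = mkℝ⁺ (A i j) λ k → subst (0ℚ ℚ.≤_) (sym (seq-adjacency G i j k)) (adjacency-nonNeg G i j)

    module _ (η ξ : Vector ℝ⁺ n) where

      S : ℝ⁺
      S = ∑⁺ λ i → ∑⁺ λ j → A⁺ i j ⊗ (η i ^⁺ c ⊗ ξ j ^⁺ c)

      real-bound : S ^⁺ D ≼ fromℕ⁺ H ⊗ fromℕ⁺ H ⊗ ((∑⁺ λ i → η i ^⁺ D) ⊗ (∑⁺ λ i → ξ i ^⁺ D)) ^⁺ c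
      real-bound = ≼-at λ k → subst₂ ℚ._≤_
        (sym (trans (at-^ S D k) (cong (_↑ D) (at-S k))))
        (sym (cong (grid 0 H ℚ.* grid 0 H ℚ.*_) (trans
          (at-^ ((∑⁺ λ i → η i ^⁺ D) ⊗ (∑⁺ λ i → ξ i ^⁺ D)) c k)
          (cong (_↑ c) (cong₂ ℚ._*_ (at-powers η k) (at-powers ξ k))))))
        (rational-bound (λ i → 0≤at (η i) k) (λ i → 0≤at (ξ i) k))
        where
        at-powers : ∀ (η : Vector ℝ⁺ n) k → at (∑⁺ λ i → η i ^⁺ D) k ≡ sum λ i → at (η i) k ↑ D
        at-powers η k = trans (at-∑ (λ i → η i ^⁺ D) k) (sum-cong-≗ λ i → at-^ (η i) D k)
        at-S : ∀ k → at S k ≡ form (adjacency G) λ (i , j) → at (η i) k ↑ c ℚ.* at (ξ j) k ↑ c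
        at-S k = trans (at-∑ (λ i → ∑⁺ λ j → A⁺ i j ⊗ (η i ^⁺ c ⊗ ξ j ^⁺ c)) k)
          (sum-cong-≗ λ i → trans (at-∑ (λ j → A⁺ i j ⊗ (η i ^⁺ c ⊗ ξ j ^⁺ c)) k)
            (sum-cong-≗ λ j → cong₂ ℚ._*_ (seq-adjacency G i j k)
              (cong₂ ℚ._*_ (at-^ (η i) c k) (at-^ (ξ j) c k))))

    ∣A·x∣≼ : ∀ (x : Vector ℝ n) i → ∣ (A · x) i ∣⁺ ≼ ∑⁺ λ j → A⁺ i j ⊗ ∣ x j ∣⁺
    ∣A·x∣≼ x i = ≼-at λ k → subst₂ ℚ._≤_
      (cong ℚ.∣_∣ (sym (seq-Σᵣ (λ j → A i j *ᵣ x j) k)))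
      (sym (trans (at-∑ (λ j → A⁺ i j ⊗ ∣ x j ∣⁺) k) (sum-cong-≗ λ j → sym (trans
        (ℚ.∣p*q∣≡∣p∣*∣q∣ (seq (A i j) k) (seq (x j) k))
        (cong (ℚ._* ℚ.∣ seq (x j) k ∣) (ℚ.0≤p⇒∣p∣≡p (0≤at (A⁺ i j) k)))))))
      (∣sum∣≤sum∣∣ λ j → seq (A i j) k ℚ.* seq (x j) k)

  module _ (P R : Exponent) (P≡D/c : P HasRatio D / c) (R≡D/v : R HasRatio D / v) where

    private
      t : ℝ⁺
      t = root⁺ e (fromℕ⁺ H)

    module _ (x : Vector ℝ n) where
      private
        ξ η : Vector ℝ⁺ n
        ξ j = root⁺ c ∣ x j ∣⁺
        η i = root⁺ v ∣ (A · x) i ∣⁺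

        X Y T N : ℝ⁺
        X = norm⁺ x P
        Y = norm⁺ (A · x) R
        T = ∑⁺ λ i → η i ^⁺ D
        N = ∑⁺ λ j → ξ j ^⁺ D

        open import Relation.Binary.Reasoning.PartialOrder ≼-poset

        -- As η^v = |Ax| and D = c + v, η^D is η^c |Ax|, and |Ax| is entrywise at most A|x| because
        -- A is nonnegative.
        T≼S : T ≼ S η ξ
        T≼S = ∑⁺-mono λ i → begin
          η i ^⁺ D
            ≡⟨ cong (η i ^⁺_) c+v≡D ⟨
          η i ^⁺ (c ℕ.+ v)
            ≈⟨ ^⁺-+ (η i) c v ⟩
          η i ^⁺ c ⊗ η i ^⁺ v
            ≈⟨ ⊗-congˡ (η i ^⁺ c) (root⁺-^⁺ v ∣ (A · x) i ∣⁺) ⟩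
          η i ^⁺ c ⊗ ∣ (A · x) i ∣⁺
            ≤⟨ ⊗-monoˡ (η i ^⁺ c) (∣A·x∣≼ x i) ⟩
          η i ^⁺ c ⊗ (∑⁺ λ j → A⁺ i j ⊗ ∣ x j ∣⁺)
            ≈⟨ ⊗-congˡ (η i ^⁺ c) (∑⁺-cong λ j → ⊗-congˡ (A⁺ i j) (root⁺-^⁺ c ∣ x j ∣⁺)) ⟨
          η i ^⁺ c ⊗ (∑⁺ λ j → A⁺ i j ⊗ ξ j ^⁺ c)
            ≈⟨ ≈-at (pull i) ⟩
          (∑⁺ λ j → A⁺ i j ⊗ (η i ^⁺ c ⊗ ξ j ^⁺ c)) ∎
          where
          open +-*-Solver
          pull : ∀ i k → at (η i ^⁺ c ⊗ (∑⁺ λ j → A⁺ i j ⊗ ξ j ^⁺ c)) k ≡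
                         at (∑⁺ λ j → A⁺ i j ⊗ (η i ^⁺ c ⊗ ξ j ^⁺ c)) k
          pull i k = trans (cong (at (η i ^⁺ c) k ℚ.*_) (at-∑ (λ j → A⁺ i j ⊗ ξ j ^⁺ c) k))
            (trans (*-distribˡ-sum (at (η i ^⁺ c) k) λ j → at (A⁺ i j ⊗ ξ j ^⁺ c) k)
              (trans (sum-cong-≗ λ j → solve 3 (λ y a z → y :* (a :* z) := a :* (y :* z)) refl
                  (at (η i ^⁺ c) k) (at (A⁺ i j) k) (at (ξ j ^⁺ c) k))
                (sym (at-∑ (λ j → A⁺ i j ⊗ (η i ^⁺ c ⊗ ξ j ^⁺ c)) k))))

        -- T^D ≤ S^D brings T^c to the right-hand side as well; cancelling it leaves T^v, which is
        -- the D-th power of the norm of Ax.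
        Tᵛ-bound : T ^⁺ v ≼ fromℕ⁺ H ⊗ fromℕ⁺ H ⊗ N ^⁺ c
        Tᵛ-bound = ^⁺-cancelʳ-≼ T (fromℕ⁺ H ⊗ fromℕ⁺ H ⊗ N ^⁺ c) v c (begin
          T ^⁺ v ⊗ T ^⁺ c                             ≈⟨ ^⁺-+ T v c ⟨
          T ^⁺ (v ℕ.+ c)                              ≡⟨ cong (T ^⁺_) (trans (ℕ.+-comm v c) c+v≡D) ⟩
          T ^⁺ D                                      ≤⟨ ^⁺-mono D T≼S ⟩
          S η ξ ^⁺ D                                  ≤⟨ real-bound η ξ ⟩
          fromℕ⁺ H ⊗ fromℕ⁺ H ⊗ (T ⊗ N) ^⁺ c          ≈⟨ ⊗-congˡ (fromℕ⁺ H ⊗ fromℕ⁺ H) (⊗-^⁺ T N c) ⟩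
          fromℕ⁺ H ⊗ fromℕ⁺ H ⊗ (T ^⁺ c ⊗ N ^⁺ c)     ≈⟨ ≈-at (λ k → solve 3 (λ h t n → h :* (t :* n) := h :* n :* t) refl
                                                           (grid 0 H ℚ.* grid 0 H) (at (T ^⁺ c) k) (at (N ^⁺ c) k)) ⟩
          fromℕ⁺ H ⊗ fromℕ⁺ H ⊗ N ^⁺ c ⊗ T ^⁺ c       ∎)
          where open +-*-Solver

        tᴰ : t ^⁺ D ≈ fromℕ⁺ H ⊗ fromℕ⁺ H
        tᴰ = begin-equality
          t ^⁺ D                    ≡⟨ cong (t ^⁺_) e+e≡D ⟨
          t ^⁺ (e ℕ.+ e)            ≈⟨ ^⁺-+ t e e ⟩
          t ^⁺ e ⊗ t ^⁺ e           ≈⟨ ⊗-cong (root⁺-^⁺ e (fromℕ⁺ H)) (root⁺-^⁺ e (fromℕ⁺ H)) ⟩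
          fromℕ⁺ H ⊗ fromℕ⁺ H       ∎

      norm-A·x : norm⁺ (A · x) R ≼ t ⊗ norm⁺ x P
      norm-A·x = ^⁺-cancel-≼ D (begin
        Y ^⁺ D                            ≈⟨ norm-^⁺ (A · x) R D v R≡D/v ⟩
        T ^⁺ v                            ≤⟨ Tᵛ-bound ⟩
        fromℕ⁺ H ⊗ fromℕ⁺ H ⊗ N ^⁺ c      ≈⟨ ⊗-cong tᴰ (norm-^⁺ x P D c P≡D/c) ⟨
        t ^⁺ D ⊗ X ^⁺ D                   ≈⟨ ⊗-^⁺ t X D ⟨
        (t ⊗ X) ^⁺ D                      ∎)

    ratio-bound : ∀ ρ → NormRatio A P R ρ → ρ ≤ᵣ real t
    ratio-bound ρ (x , x≢0 , ρX≤Y , _) = ≤ᵣ-stable ρ (real t)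
      (norm-positive x (∣∣≼norm x P D c P≡D/c) x≢0 λ 0<c X≥c →
        *ᵣ-cancelʳ-≤ ρ (real t) (real (norm⁺ x P)) 0<c X≥c
          (≤ᵣ-trans (ρ *ᵣ real (norm⁺ x P)) (real (norm⁺ (A · x) R)) (real (t ⊗ norm⁺ x P))
            ρX≤Y (un≼ (norm-A·x x))))

    -- The supremum N is nonnegative only as a real number, while monotonicity of powers is stated
    -- for sequences with nonnegative terms. Hence N is replaced by |N|, which is still at most t:
    -- where a term of |N| is minus that of N, nonnegativity of N bounds it by ε.
    operatorNorm-bound : ∀ N → IsOperatorNorm A P R N → N ^ᵣ e ≤ᵣ fromℕ H
    operatorNorm-bound N isNorm = ≤ᵣ-trans (N ^ᵣ e) (real (∣ N ∣⁺ ^⁺ e)) (fromℕ H)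
      (≤ᵣ-pointwise (N ^ᵣ e) (real (∣ N ∣⁺ ^⁺ e)) λ k → subst₂ ℚ._≤_
        (sym (seq-^ᵣ N e k)) (trans (∣∣-↑ (seq N k) e) (sym (at-^ ∣ N ∣⁺ e k))) (p≤∣p∣ (seq N k ↑ e)))
      (un≼ (≼-trans (^⁺-mono e ∣N∣≼t) (≈⇒≼ (root⁺-^⁺ e (fromℕ⁺ H)))))
      where
      open IsSupremum isNorm
      open +-*-Solver

      ∣∣-↑ : ∀ z k → ℚ.∣ z ↑ k ∣ ≡ ℚ.∣ z ∣ ↑ k
      ∣∣-↑ z zero    = refl
      ∣∣-↑ z (suc k) = trans (ℚ.∣p*q∣≡∣p∣*∣q∣ z (z ↑ k)) (cong (ℚ.∣ z ∣ ℚ.*_) (∣∣-↑ z k))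

      N≤t : N ≤ᵣ real t
      N≤t = least (real t) (≤ᵣ-pointwise 0ᵣ (real t) (0≤at t)) ratio-bound

      ∣N∣≼t : ∣ N ∣⁺ ≼ t
      ∣N∣≼t = mk≼ λ ε 0<ε →
        let N₁ , h₁ = N≤t ε 0<ε
            N₂ , h₂ = nonNeg ε 0<ε
        in N₁ ℕ.⊔ N₂ , λ k N≤k → both k (ℚ.∣p∣≡p∨∣p∣≡-p (seq N k))
             (h₁ k (ℕ.m⊔n≤o⇒m≤o N₁ N₂ N≤k)) (h₂ k (ℕ.m⊔n≤o⇒n≤o N₁ N₂ N≤k))
        where
        both : ∀ k {ε} → ℚ.∣ seq N k ∣ ≡ seq N k ⊎ ℚ.∣ seq N k ∣ ≡ ℚ.- seq N k →
               seq N k ℚ.≤ at t k ℚ.+ ε → 0ℚ ℚ.≤ seq N k ℚ.+ ε → ℚ.∣ seq N k ∣ ℚ.≤ at t k ℚ.+ ε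
        both k {ε} (inj₁ eq) h₁ h₂ = subst (ℚ._≤ at t k ℚ.+ ε) (sym eq) h₁
        both k {ε} (inj₂ eq) h₁ h₂ = ℚ.≤-trans (subst₂ ℚ._≤_
          (trans (ℚ.+-identityʳ (ℚ.- seq N k)) (sym eq))
          (solve 2 (λ x e → :- x :+ (x :+ e) := con 0ℚ :+ e) refl (seq N k) ε)
          (ℚ.+-monoʳ-≤ (ℚ.- seq N k) h₂))
          (ℚ.+-monoˡ-≤ ε (0≤at t k))

-- Application to the subdivision of a complete bipartite graph

graph-subdivision-bound : ∀ {n} (G : Graph n) α β c D → let a = suc α; b = suc β in
  c ≡ a ℕ.* β ℕ.+ b ℕ.* α ℕ.+ a ℕ.* b → D ≡ 4 ℕ.* (a ℕ.* b) →
  ∀ H → weightedHom a b (codegree (adjacency G)) ℚ.≤ grid 0 H →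
  ∀ {η ξ : Vector ℚ n} → (∀ i → 0ℚ ℚ.≤ η i) → (∀ i → 0ℚ ℚ.≤ ξ i) →
  form (adjacency G) (λ (i , j) → η i ↑ c ℚ.* ξ j ↑ c) ↑ D ℚ.≤
  grid 0 H ℚ.* grid 0 H ℚ.* ((sum λ i → η i ↑ D) ℚ.* (sum λ i → ξ i ↑ D)) ↑ c
graph-subdivision-bound {n} G α β c D refl refl H M≤H 0≤η 0≤ξ = ℚ.≤-trans
  (subdivision-bound (adjacency G) (adjacency-nonNeg G) (adjacency-sym G) α β 0≤η 0≤ξ)
  (*-monoʳ-≤ (^-nonNeg c (*-nonNeg (powers-nonNeg 0≤η) (powers-nonNeg 0≤ξ)))
    (*-mono-≤ 0≤M (grid-nonNeg 0 H) M≤H M≤H))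
  where
  powers-nonNeg : ∀ {η : Vector ℚ n} → (∀ i → 0ℚ ℚ.≤ η i) → 0ℚ ℚ.≤ sum λ i → η i ↑ D
  powers-nonNeg 0≤η = PositiveFunctional.nonNeg (sumFunctional n) λ i → ^-nonNeg D (0≤η i)
  0≤M : 0ℚ ℚ.≤ weightedHom (suc α) (suc β) (codegree (adjacency G))
  0≤M = PositiveFunctional.nonNeg (mapsFunctional (suc α) n) λ x →
    PositiveFunctional.nonNeg (mapsFunctional (suc β) n) λ y → product-nonNeg λ i → product-nonNeg λ j →
    PositiveFunctional.nonNeg (sumFunctional n) λ z →
      *-nonNeg (adjacency-nonNeg G (x i) z) (adjacency-nonNeg G (y j) z)

sub-operatorNorm-bound : ∀ {n} (G : Graph n) (α β v e c D : ℕ)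
  .{{_ : ℕ.NonZero v}} .{{_ : ℕ.NonZero e}} (P R : Exponent) → let a = suc α; b = suc β in
  c ≡ a ℕ.* β ℕ.+ b ℕ.* α ℕ.+ a ℕ.* b → D ≡ 4 ℕ.* (a ℕ.* b) → c ℕ.+ v ≡ D → e ℕ.+ e ≡ D →
  P HasRatio D / c → R HasRatio D / v → ∀ N →
  IsOperatorNorm (adjacencyMatrix G) P R N → N ^ᵣ e ≤ᵣ fromℕ (hom (sub (completeBipartite a b)) G)
sub-operatorNorm-bound G α β v e c D P R c≡ D≡ c+v≡D e+e≡D hP hR =
  OperatorNormBound.operatorNorm-bound G c v D e (hom (sub (completeBipartite (suc α) (suc β))) G)
    {{c-nonZero}} {{D-nonZero = D-nonZero}} c+v≡D e+e≡D
    (graph-subdivision-bound G α β c D c≡ D≡ (hom (sub (completeBipartite (suc α) (suc β))) G)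
      (weightedHom≤hom (suc α) (suc β) G))
    P R hP hR
  where
  c-nonZero : ℕ.NonZero c
  c-nonZero = ℕ.>-nonZero (subst (0 ℕ.<_) (sym c≡) (ℕ.<-≤-trans ℕ.z<s
    (ℕ.m≤n+m (suc α ℕ.* suc β) (suc α ℕ.* β ℕ.+ suc β ℕ.* α))))
  D-nonZero : ℕ.NonZero D
  D-nonZero = subst ℕ.NonZero (sym D≡) _

∣E∣-sub-completeBipartite : ∀ a b → ∣E∣ (sub (completeBipartite a b)) ≡ 2 * (a * b)
∣E∣-sub-completeBipartite a b = trans (∣E∣-sub (completeBipartite a b))
  (trans (cong (_* 2) (∣E∣-completeBipartite a b)) (ℕ.*-comm (a * b) 2))

-- This is (2e - v) + v = 2e: since aβ + a = ab and bα + b = ab, the terms add up to four copies of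
-- ab.
complementary : ∀ α β → let a = suc α; b = suc β in
  a * β ℕ.+ b * α ℕ.+ a * b ℕ.+ (a ℕ.+ b ℕ.+ a * b) ≡ 4 * (a * b)
complementary = solve 2 (λ α β → let a = con 1 :+ α; b = con 1 :+ β in
  a :* β :+ b :* α :+ a :* b :+ (a :+ b :+ a :* b) := con 4 :* (a :* b)) refl
  where open ℕ-Solver

certificate-bound : ∀ α β → let a = suc α; b = suc β in
  ∀ v e (0<v : 0 ℕ.< v) (v≤e : v ≤ e) → v ≡ a ℕ.+ b ℕ.+ a * b → e ≡ 2 * (a * b) →
  ∀ {n} (G : Graph n) N →
  IsOperatorNorm (adjacencyMatrix G) (s′-exponent v e 0<v v≤e) (s-exponent v e 0<v v≤e) N →
  N ^ᵣ e ≤ᵣ fromℕ (hom (sub (completeBipartite a b)) G)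
certificate-bound α β v e 0<v v≤e v≡ e≡ G =
  sub-operatorNorm-bound G α β v e (2 * e ℕ.∸ v) (2 * e)
    {{ℕ.>-nonZero 0<v}} {{ℕ.>-nonZero (ℕ.<-≤-trans 0<v v≤e)}}
    (s′-exponent v e 0<v v≤e) (s-exponent v e 0<v v≤e)
    2e∸v≡c 2e≡D (ℕ.m∸n+n≡m (ℕ.≤-trans v≤e (ℕ.m≤m+n e (e ℕ.+ 0)))) (cong (e ℕ.+_) (sym (ℕ.+-identityʳ e)))
    (exponent-ratio (2 * e) (2 * e ℕ.∸ v) _ _) (exponent-ratio (2 * e) v _ _)
  where
  a b : ℕ
  a = suc α
  b = suc β
  2e≡D : 2 * e ≡ 4 * (a * b)
  2e≡D = trans (cong (2 *_) e≡) (sym (ℕ.*-assoc 2 2 (a * b)))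
  2e∸v≡c : 2 * e ℕ.∸ v ≡ a * β ℕ.+ b * α ℕ.+ a * b
  2e∸v≡c = trans (cong₂ ℕ._∸_ (trans 2e≡D (sym (complementary α β))) v≡)
    (ℕ.m+n∸n≡m (a * β ℕ.+ b * α ℕ.+ a * b) (a ℕ.+ b ℕ.+ a * b))

-- For a = 2 + k and b = 2 + l the difference is k + l + kl. It yields v ≤ e for v = a + b + ab and
-- e = 2ab.
a+b≤ab : ∀ {a b} → 2 ≤ a → 2 ≤ b → a ℕ.+ b ≤ a * b
a+b≤ab {suc (suc k)} {suc (suc l)} (ℕ.s≤s (ℕ.s≤s _)) (ℕ.s≤s (ℕ.s≤s _)) = subst (suc (suc k) ℕ.+ suc (suc l) ≤_)
  (solve 2 (λ k l → con 2 :+ k :+ (con 2 :+ l) :+ (k :+ l :+ k :* l)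
    := (con 2 :+ k) :* (con 2 :+ l)) refl k l)
  (ℕ.m≤m+n (suc (suc k) ℕ.+ suc (suc l)) (k ℕ.+ l ℕ.+ k * l))
  where open ℕ-Solver

certificate : ∀ a b → 2 ≤ a → 2 ≤ b → Certificate (sub (completeBipartite a b))
certificate a@(suc α) b@(suc β) 2≤a 2≤b = record
  { bipartite = sub-bipartite (completeBipartite a b)
  ; 0<v       = ℕ.z<s
  ; v≤e       = v≤e
  ; bound     = certificate-bound α β _ _ ℕ.z<s v≤e
      (cong (a ℕ.+ b ℕ.+_) (∣E∣-completeBipartite a b)) (∣E∣-sub-completeBipartite a b)
  }
  where
  v≤e : a ℕ.+ b ℕ.+ ∣E∣ (completeBipartite a b) ≤ ∣E∣ (sub (completeBipartite a b))
  v≤e = subst₂ _≤_ (cong (a ℕ.+ b ℕ.+_) (sym (∣E∣-completeBipartite a b)))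
    (trans (cong (a * b ℕ.+_) (sym (ℕ.+-identityʳ (a * b)))) (sym (∣E∣-sub-completeBipartite a b)))
    (ℕ.+-monoˡ-≤ (a * b) (a+b≤ab 2≤a 2≤b))

HasRatio-scale : ∀ E k {D m} → E HasRatio D / m → E HasRatio (k * D) / (k * m)
HasRatio-scale E k {D} {m} h = trans (x∙yz≈y∙xz ℤ.∣ ↥ value ∣ k m)
  (trans (cong (k *_) h) (sym (ℕ.*-assoc k D (↧ₙ value))))
  where
  open Exponent E
  open import Algebra.Properties.CommutativeSemigroup ℕ.*-commutativeSemigroup using (x∙yz≈y∙xz)

-- Multiplying numerators and denominators of the stated exponents by t gives 4t^2 = 2e, t(3t - 2) =
-- 2e - v and t(t + 2) = v, the parameters of the subdivision of K_{t,t}.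
diagonal-bound : ∀ t (2≤t : 2 ≤ t) {n} (G : Graph n) N →
  IsOperatorNorm (adjacencyMatrix G) (domainExponent t 2≤t) (codomainExponent t 2≤t) N →
  N ^ᵣ (2 * t ^ 2) ≤ᵣ fromℕ (hom (sub (completeBipartite t t)) G)
diagonal-bound t 2≤t G N isNorm = subst (λ t′ → N ^ᵣ (2 * t ^ 2) ≤ᵣ fromℕ (hom (sub (completeBipartite t′ t′)) G))
  (sym t≡1+α)
  (sub-operatorNorm-bound G α α (t * (t ℕ.+ 2)) (2 * t ^ 2) (t * (3 * t ℕ.∸ 2)) (t * (4 * t))
    {{ℕ.>-nonZero (*-pos-ℕ 0<t (ℕ.≤-trans 0<t (ℕ.m≤m+n t 2)))}}
    {{ℕ.>-nonZero (*-pos-ℕ {2} ℕ.z<s (*-pos-ℕ 0<t (*-pos-ℕ 0<t ℕ.z<s)))}}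
    (domainExponent t 2≤t) (codomainExponent t 2≤t)
    c≡ D≡ c+v≡D (e+e≡D t)
    (HasRatio-scale (domainExponent t 2≤t) t (exponent-ratio (4 * t) (3 * t ℕ.∸ 2) _ _))
    (HasRatio-scale (codomainExponent t 2≤t) t (exponent-ratio (4 * t) (t ℕ.+ 2) _ _))
    N isNorm)
  where
  open ℕ-Solver
  α : ℕ
  α = ℕ.pred t
  0<t : 0 ℕ.< t
  0<t = ℕ.<⇒≤ 2≤t
  t≡1+α : t ≡ suc α
  t≡1+α = sym (ℕ.suc-pred t {{ℕ.>-nonZero 0<t}})
  *-pos-ℕ : ∀ {i j} → 0 ℕ.< i → 0 ℕ.< j → 0 ℕ.< i * j
  *-pos-ℕ {i} {j} 0<i 0<j = ℕ.*-mono-≤ {1} {i} {1} {j} 0<i 0<j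
  e+e≡D : ∀ t → 2 * t ^ 2 ℕ.+ 2 * t ^ 2 ≡ t * (4 * t)
  e+e≡D = solve 1 (λ t → con 2 :* t :^ 2 :+ con 2 :* t :^ 2 := t :* (con 4 :* t)) refl
  D≡ : t * (4 * t) ≡ 4 * (suc α * suc α)
  D≡ = trans (cong (λ t → t * (4 * t)) t≡1+α)
    (solve 1 (λ t → t :* (con 4 :* t) := con 4 :* (t :* t)) refl (suc α))
  c≡ : t * (3 * t ℕ.∸ 2) ≡ suc α * α ℕ.+ suc α * α ℕ.+ suc α * suc α
  c≡ = trans (cong (λ t → t * (3 * t ℕ.∸ 2)) t≡1+α)
    (trans (cong (λ z → suc α * (z ℕ.∸ 2))
        (solve 1 (λ α → con 3 :* (con 1 :+ α) := con 3 :* α :+ con 1 :+ con 2) refl α))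
      (trans (cong (suc α *_) (ℕ.m+n∸n≡m (3 * α ℕ.+ 1) 2))
        (solve 1 (λ α → let t = con 1 :+ α in
          t :* (con 3 :* α :+ con 1) := t :* α :+ t :* α :+ t :* t) refl α)))
  c+v≡D : t * (3 * t ℕ.∸ 2) ℕ.+ t * (t ℕ.+ 2) ≡ t * (4 * t)
  c+v≡D = trans (cong₂ ℕ._+_ c≡ (cong (λ t → t * (t ℕ.+ 2)) t≡1+α))
    (trans (solve 1 (λ α → let t = con 1 :+ α in
        t :* α :+ t :* α :+ t :* t :+ t :* (t :+ con 2) := con 4 :* (t :* t)) refl α)
      (sym D≡))

corollary2p6 : (∀ (a b : ℕ) → 2 ≤ a → 2 ≤ b → Certificate (sub (completeBipartite a b)))
    × (∀ (t : ℕ) (2≤t : 2 ≤ t) {n : ℕ} (G : Graph n) (N : ℝ) →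
    IsOperatorNorm (adjacencyMatrix G) (domainExponent t 2≤t) (codomainExponent t 2≤t) N →
    N ^ᵣ (2 * t ^ 2) ≤ᵣ fromℕ (hom (sub (completeBipartite t t)) G))
corollary2p6 = certificate , diagonal-bound
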